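{- There exists $g>0$ such that every cubic graph with girth at least $g$ has fractional chromatic number at most $2.2978$.
   Context: Graphs are finite and simple. A graph is cubic if every vertex has degree three. The girth of a graph is the length of its shortest cycle. A fractional coloring of a graph $G$ is an assignment of non-negative real weights to the independent sets of $G$ such that for each vertex $v$ the sum of the weights of the independent sets containing $v$ is at least one. The fractional chromatic number of $G$ is the minimum total weight of a fractional coloring of $G$. -}

module Defs where

open import Data.Fin.Base using (Fin; zero; suc; inject₁; fromℕ)
open import Data.Fin.Properties using (all?)
open import Data.Fin.Subset using (Subset; inside; outside; _∈_; ∣_∣)
open import Data.Fin.Subset.Properties using (_∈?_)
open import Data.List.Base using (List; []; _∷_; _++_; map; filter; foldr)
open import Data.Nat.Base as ℕ using (ℕ)
import Data.Nat.Properties as ℕ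
open import Data.Product.Base using (Σ-syntax; ∃-syntax; _×_; _,_)
open import Data.Rational.Base as ℚ using (ℚ; 0ℚ; 1ℚ; ½)
import Data.Rational.Properties as ℚ
open import Data.Rational.Solver using (module +-*-Solver)
open import Data.Vec.Base as Vec using (tabulate)
open import Function.Definitions using (Injective)
open import Level using (Level; _⊔_; 0ℓ)
open import Relation.Binary.Core using (Rel)
open import Relation.Binary.Definitions using (Symmetric; Irreflexive; Decidable)
open import Relation.Binary.PropositionalEquality.Core
  using (_≡_; refl; sym; cong; subst₂)
open import Relation.Nullary using (Dec; ¬_; does; ¬?; _→-dec_)
open import Relation.Unary using (Pred)

private
  variable
    a p r : Level

IsLeast : {A : Set a} → Rel A r → Pred A p → Pred A (a ⊔ p ⊔ r)
IsLeast _≤_ P m = P m × (∀ {x} → P x → m ≤ x)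

IsCauchy : (ℕ → ℚ) → Set
IsCauchy x = ∀ ε → 0ℚ ℚ.< ε →
  ∃[ N ] (∀ m n → N ℕ.≤ m → N ℕ.≤ n → ℚ.∣ x m ℚ.- x n ∣ ℚ.≤ ε)

record ℝ : Set where
  constructor mkℝ
  field
    seq    : ℕ → ℚ
    cauchy : IsCauchy seq

open ℝ public

infix 4 _≤ᵣ_ _≃ᵣ_

_≤ᵣ_ : Rel ℝ 0ℓ
x ≤ᵣ y = ∀ ε → 0ℚ ℚ.< ε →
  ∃[ N ] (∀ n → N ℕ.≤ n → seq x n ℚ.≤ seq y n ℚ.+ ε)

_≃ᵣ_ : Rel ℝ 0ℓ
x ≃ᵣ y = x ≤ᵣ y × y ≤ᵣ x

fromℚ : ℚ → ℝ
fromℚ q .seq    _     = q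
fromℚ q .cauchy ε 0<ε = 0 , λ _ _ _ _ →
  ℚ.≤-trans (ℚ.≤-reflexive (cong ℚ.∣_∣ (ℚ.+-inverseʳ q))) (ℚ.<⇒≤ 0<ε)

0ᵣ 1ᵣ : ℝ
0ᵣ = fromℚ 0ℚ
1ᵣ = fromℚ 1ℚ

+-cauchy : ∀ x y → IsCauchy x → IsCauchy y → IsCauchy (λ n → x n ℚ.+ y n)
+-cauchy x y cx cy ε 0<ε =
  let ε/2          = ε ℚ.* ½
      0<ε/2        = subst₂ ℚ._<_ (ℚ.*-zeroˡ ½) refl (ℚ.*-monoˡ-<-pos ½ 0<ε)
      (M , belowˣ) = cx ε/2 0<ε/2
      (N , belowʸ) = cy ε/2 0<ε/2
  in M ℕ.⊔ N , λ m n ≤m ≤n →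
    let open ℚ.≤-Reasoning in begin
      ℚ.∣ (x m ℚ.+ y m) ℚ.- (x n ℚ.+ y n) ∣
        ≡⟨ cong ℚ.∣_∣ (interchange (x m) (y m) (x n) (y n)) ⟩
      ℚ.∣ (x m ℚ.- x n) ℚ.+ (y m ℚ.- y n) ∣
        ≤⟨ ℚ.∣p+q∣≤∣p∣+∣q∣ (x m ℚ.- x n) (y m ℚ.- y n) ⟩
      ℚ.∣ x m ℚ.- x n ∣ ℚ.+ ℚ.∣ y m ℚ.- y n ∣
        ≤⟨ ℚ.+-mono-≤
             (belowˣ m n (ℕ.m⊔n≤o⇒m≤o M N ≤m) (ℕ.m⊔n≤o⇒m≤o M N ≤n))
             (belowʸ m n (ℕ.m⊔n≤o⇒n≤o M N ≤m) (ℕ.m⊔n≤o⇒n≤o M N ≤n)) ⟩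
      ε ℚ.* ½ ℚ.+ ε ℚ.* ½
        ≡⟨ sym (ℚ.*-distribˡ-+ ε ½ ½) ⟩
      ε ℚ.* 1ℚ
        ≡⟨ ℚ.*-identityʳ ε ⟩
      ε ∎
  where
  open +-*-Solver
  interchange : ∀ a b c d →
    (a ℚ.+ b) ℚ.- (c ℚ.+ d) ≡ (a ℚ.- c) ℚ.+ (b ℚ.- d)
  interchange = solve 4
    (λ a b c d → (a :+ b) :- (c :+ d) := (a :- c) :+ (b :- d)) refl

infixl 6 _+ᵣ_

_+ᵣ_ : ℝ → ℝ → ℝ
(x +ᵣ y) .seq n  = seq x n ℚ.+ seq y n
(x +ᵣ y) .cauchy = +-cauchy (seq x) (seq y) (cauchy x) (cauchy y)

sumᵣ : List ℝ → ℝ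
sumᵣ = foldr _+ᵣ_ 0ᵣ

record Graph : Set₁ where
  field
    order : ℕ

  Vertex : Set
  Vertex = Fin order

  infix 4 _~_ _~?_

  field
    _~_      : Rel Vertex 0ℓ
    _~?_     : Decidable _~_
    ~-sym    : Symmetric _~_
    ~-irrefl : Irreflexive _≡_ _~_

  neighbours : Vertex → Subset order
  neighbours v = tabulate (λ u → does (v ~? u))

  degree : Vertex → ℕ
  degree v = ∣ neighbours v ∣

Cubic : Graph → Set
Cubic G = ∀ v → degree v ≡ 3
  where open Graph G

-- The cycle v₀ ~ v₁ ~ … ~ vₘ ~ v₀ through m + 1 ≥ 3 distinct vertices.
record Cycle (G : Graph) : Set where
  open Graph G
  field
    {m}       : ℕ
    2≤m       : 2 ℕ.≤ m
    vertex    : Fin (ℕ.suc m) → Vertex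
    injective : Injective _≡_ _≡_ vertex
    step      : ∀ (i : Fin m) → vertex (inject₁ i) ~ vertex (suc i)
    close     : vertex (fromℕ m) ~ vertex zero

  length : ℕ
  length = ℕ.suc m

IsGirth : Graph → ℕ → Set
IsGirth G = IsLeast ℕ._≤_ (λ k → Σ[ C ∈ Cycle G ] Cycle.length C ≡ k)

-- An acyclic graph has infinite girth, so it satisfies every lower bound.
GirthAtLeast : ℕ → Graph → Set
GirthAtLeast g G = ∀ {k} → IsGirth G k → g ℕ.≤ k

subsets : ∀ n → List (Subset n)
subsets ℕ.zero    = Vec.[] ∷ []
subsets (ℕ.suc n) =
  map (outside Vec.∷_) (subsets n) ++ map (inside Vec.∷_) (subsets n)

module _ (G : Graph) where
  open Graph G

  Independent : Subset order → Set
  Independent S = ∀ u v → u ∈ S → v ∈ S → ¬ (u ~ v)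

  independent? : ∀ S → Dec (Independent S)
  independent? S = all? λ u → all? λ v →
    (u ∈? S) →-dec ((v ∈? S) →-dec ¬? (u ~? v))

  independentSets : List (Subset order)
  independentSets = filter independent? (subsets order)

  -- The function `weight` is total for convenience; its values at sets that
  -- are not independent are unconstrained and enter no sum.
  record FractionalColouring : Set where
    field
      weight : Subset order → ℝ
      nonneg : ∀ {S} → Independent S → 0ᵣ ≤ᵣ weight S
      covers : ∀ v →
        1ᵣ ≤ᵣ sumᵣ (map weight (filter (v ∈?_) independentSets))

    total : ℝ
    total = sumᵣ (map weight independentSets)

  IsFractionalChromaticNumber : ℝ → Set
  IsFractionalChromaticNumber = IsLeast _≤ᵣ_
    (λ t → Σ[ c ∈ FractionalColouring ] FractionalColouring.total c ≃ᵣ t)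

{-# OPTIONS --safe #-}
-- A randomised local procedure finds the independent set. Call a vertex real
-- while it is undecided and has three undecided neighbours left, and smoothed
-- once it has two; real vertices are joined by arms, paths of smoothed vertices,
-- which at first are the edges of G. In each round, an arm with an odd number of
-- smoothed vertices fires with a small probability: both ends are excluded. (A
-- first round, in which even arms fire, starts the process.) If an end of an arm
-- is excluded then, one round later, the other end is excluded too when the arm
-- is odd, and loses the arm, hence gets smoothed, when it is even; the smoothed
-- vertices of the arm are alternately selected and rejected.
--
-- What a vertex learns through an edge depends on the coins in the branch behind
-- this edge only. For large girth the branches are disjoint, so the messages
-- through the three edges are independent, and the weights of the possible
-- states of an arm satisfy a recursion by polynomials with nonnegative
-- coefficients. Lower bounds can therefore be propagated in rounded arithmetic:
-- in the end a vertex is selected with probability p where 2.2978 p ≥ 1, and the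
-- random set, scaled by 2.2978, is a fractional colouring.
--
-- A least fractional colouring exists because Fourier–Motzkin elimination solves
-- the linear program over ℚ, with error terms that control real colourings.
module Submission where

open import Defs
import Data.Bool as Bool
open import Data.Bool.Base using (Bool; true; false; not; _∧_; _∨_; _xor_; if_then_else_)
open import Data.Bool.Properties using (xor-assoc; xor-comm; ∧-comm)
open import Data.Empty using (⊥; ⊥-elim)
open import Data.Fin.Base using (Fin; zero; suc; inject₁; fromℕ)
open import Data.Fin.Patterns using (1F; 2F)
import Data.Fin.Properties as Fin
open import Data.Fin.Subset using (Subset; inside; outside; _∈_; ∣_∣)
open import Data.Fin.Subset.Properties using (_∈?_)
import Data.Integer.Base as ℤ
import Data.Integer.Properties as ℤ
open import Data.Integer.Base using (+_)
open import Data.List.Base as List using (List; []; _∷_)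
open import Data.List.Membership.Propositional using () renaming (_∈_ to _∈ˡ_)
import Data.List.Membership.Propositional.Properties as Membership
open import Data.List.Relation.Unary.All as All using (All; []; _∷_)
import Data.List.Relation.Unary.All.Properties as All
open import Data.List.Relation.Unary.AllPairs using ([]; _∷_)
import Data.List.Relation.Unary.Any as Any
open import Data.List.Relation.Unary.Unique.Propositional using (Unique)
import Data.List.Relation.Unary.Unique.Propositional.Properties as Unique
import Data.Nat.Base as ℕ
open import Data.Nat.Base using (ℕ; zero; suc; _<_)
import Data.Nat.Coprimality as Coprime
import Data.Nat.DivMod as ℕ
open import Data.Nat.Induction using (<-rec)
import Data.Nat.Properties as ℕ
open import Data.Product.Base using (Σ-syntax; ∃-syntax; _×_; _,_; proj₁; proj₂)
import Data.Rational.Base as ℚ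
open import Data.Rational.Base using (ℚ; 0ℚ; 1ℚ; _+_; _*_; _-_; -_; _≤_; _/_)
import Data.Rational.Properties as ℚ
open import Data.Rational.Properties using (≤-trans; ≤-reflexive; ≤-refl; +-mono-≤)
import Data.Rational.Unnormalised.Base as ℚᵘ
import Data.Rational.Unnormalised.Properties as ℚᵘ
open import Data.Rational.Solver using (module +-*-Solver)
open import Data.Sum.Base using (_⊎_; inj₁; inj₂)
open import Data.Unit.Base using (⊤; tt)
open import Data.Vec.Base as Vec using (Vec; []; _∷_; head; tail; lookup; _[_]≔_; here; there)
open import Data.Vec.Relation.Binary.Pointwise.Inductive as Pointwise using (Pointwise; []; _∷_)
import Data.Vec.Properties as Vec
open import Function.Base using (_∘_)
open import Function.Strict using (force)
open import Relation.Binary.Definitions using (tri<; tri≈; tri>)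
open import Relation.Binary.PropositionalEquality
  using (_≡_; _≢_; refl; sym; trans; cong; cong₂; subst; subst₂; subst-injective; subst-sym-subst; module ≡-Reasoning)
open import Relation.Nullary.Decidable using (dec-true; dec-false; from-yes; map′; _×-dec_)
open import Relation.Nullary using (Dec; yes; no; ¬_; does; contradiction)
open +-*-Solver using (Polynomial; solve; con; _:+_; _:*_; _:-_; :-_; _:=_)

-- Finite measures

-- The obstacle is that a round is not local. A vertex that gets smoothed passes on the message of
-- its other arm within the same round, and the vertex beyond it may do likewise, so the state of an
-- arm can depend on vertices at any distance. Messages are therefore truncated at a finite depth;
-- undetermined entries are `unknown` and lead to rejection. As more information never revokes a
-- selection, truncation yields lower bounds, and the set stays independent although neighbours see
-- each other at different depths. In place of a limit law, the law at a larger depth is bounded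
-- below by a mixture built from the law at a smaller depth, with four coefficients per round.
-- Mergers within a round make the condition on these coefficients self-referential; finitely many
-- iterations from zero produce valid ones. Mixtures are not normalised: mass that is not classified
-- is dropped, which is legitimate because laws are compared on nonnegative, monotone test functions
-- only. The number to be reached is 5000 / 11489 = 1 / 2.2978, about 0.4352.

*-mono-≤ : ∀ {a b c d} → 0ℚ ≤ a → 0ℚ ≤ c → a ≤ b → c ≤ d → a * c ≤ b * d
*-mono-≤ {a} {b} {c} {d} 0≤a 0≤c a≤b c≤d = ≤-trans
  (ℚ.*-monoʳ-≤-nonNeg c {{ℚ.nonNegative 0≤c}} a≤b)
  (ℚ.*-monoˡ-≤-nonNeg b {{ℚ.nonNegative (≤-trans 0≤a a≤b)}} c≤d)

*-monoˡ : ∀ {a} → 0ℚ ≤ a → ∀ {c d} → c ≤ d → a * c ≤ a * d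
*-monoˡ {a} 0≤a = ℚ.*-monoˡ-≤-nonNeg a {{ℚ.nonNegative 0≤a}}

*-monoʳ : ∀ {a} → 0ℚ ≤ a → ∀ {c d} → c ≤ d → c * a ≤ d * a
*-monoʳ {a} 0≤a = ℚ.*-monoʳ-≤-nonNeg a {{ℚ.nonNegative 0≤a}}

0≤* : ∀ {a b} → 0ℚ ≤ a → 0ℚ ≤ b → 0ℚ ≤ a * b
0≤* {a} {b} 0≤a 0≤b = subst (_≤ a * b) (ℚ.*-zeroʳ a) (*-monoˡ 0≤a 0≤b)

0≤+ : ∀ {a b} → 0ℚ ≤ a → 0ℚ ≤ b → 0ℚ ≤ a + b
0≤+ = +-mono-≤

-- A measure is given as a positive linear functional, so that restrictions to events and
-- unnormalised mixtures are handled by integration alone. Monotonicity also supplies congruence for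
-- pointwise equal integrands.
record Measure (Ω : Set) : Set where
  field
    ∫      : (Ω → ℚ) → ℚ
    ∫-mono : ∀ {f g} → (∀ a → f a ≤ g a) → ∫ f ≤ ∫ g
    ∫-+    : ∀ f g → ∫ (λ a → f a + g a) ≡ ∫ f + ∫ g
    ∫-*    : ∀ k f → ∫ (λ a → k * f a) ≡ k * ∫ f

  ∫-cong : ∀ {f g} → (∀ a → f a ≡ g a) → ∫ f ≡ ∫ g
  ∫-cong f≡g = ℚ.≤-antisym (∫-mono (≤-reflexive ∘ f≡g)) (∫-mono (≤-reflexive ∘ sym ∘ f≡g))

  ∫-*ʳ : ∀ k f → ∫ (λ a → f a * k) ≡ ∫ f * k
  ∫-*ʳ k f = trans (∫-cong (λ a → ℚ.*-comm (f a) k)) (trans (∫-* k f) (ℚ.*-comm k (∫ f)))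

  ∫-0 : ∫ (λ _ → 0ℚ) ≡ 0ℚ
  ∫-0 = trans (∫-* 0ℚ (λ _ → 0ℚ)) (ℚ.*-zeroˡ (∫ (λ _ → 0ℚ)))

  ∫-nonneg : ∀ {f} → (∀ a → 0ℚ ≤ f a) → 0ℚ ≤ ∫ f
  ∫-nonneg {f} 0≤f = subst (_≤ ∫ f) ∫-0 (∫-mono 0≤f)

  mass : ℚ
  mass = ∫ (λ _ → 1ℚ)

  ∫-const : ∀ k → ∫ (λ _ → k) ≡ k * mass
  ∫-const k = trans (∫-cong (λ _ → sym (ℚ.*-identityʳ k))) (∫-* k (λ _ → 1ℚ))

open Measure public

private
  variable
    Ω Ω′ : Set

dirac : Ω → Measure Ω
dirac a .∫ f = f a
dirac a .∫-mono f≤g = f≤g a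
dirac a .∫-+ f g = refl
dirac a .∫-* k f = refl

infixl 1 _>>=_
_>>=_ : Measure Ω → (Ω → Measure Ω′) → Measure Ω′
(μ >>= ν) .∫ f = ∫ μ λ a → ∫ (ν a) f
(μ >>= ν) .∫-mono f≤g = ∫-mono μ λ a → ∫-mono (ν a) f≤g
(μ >>= ν) .∫-+ f g = trans (∫-cong μ λ a → ∫-+ (ν a) f g) (∫-+ μ _ _)
(μ >>= ν) .∫-* k f = trans (∫-cong μ λ a → ∫-* (ν a) k f) (∫-* μ k _)

scale : ∀ k → 0ℚ ≤ k → Measure Ω → Measure Ω
scale k 0≤k μ .∫ f = k * ∫ μ f
scale k 0≤k μ .∫-mono f≤g = *-monoˡ 0≤k (∫-mono μ f≤g)
scale k 0≤k μ .∫-+ f g = trans (cong (k *_) (∫-+ μ f g)) (ℚ.*-distribˡ-+ k _ _)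
scale k 0≤k μ .∫-* c f = trans (cong (k *_) (∫-* μ c f))
  (solve 3 (λ k c x → k :* (c :* x) := c :* (k :* x)) refl k c (∫ μ f))

_⊕_ : Measure Ω → Measure Ω → Measure Ω
(μ ⊕ ν) .∫ f = ∫ μ f + ∫ ν f
(μ ⊕ ν) .∫-mono f≤g = +-mono-≤ (∫-mono μ f≤g) (∫-mono ν f≤g)
(μ ⊕ ν) .∫-+ f g = trans (cong₂ _+_ (∫-+ μ f g) (∫-+ ν f g))
  (solve 4 (λ a b c d → (a :+ b) :+ (c :+ d) := (a :+ c) :+ (b :+ d)) refl
    (∫ μ f) (∫ μ g) (∫ ν f) (∫ ν g))
(μ ⊕ ν) .∫-* k f = trans (cong₂ _+_ (∫-* μ k f) (∫-* ν k f)) (sym (ℚ.*-distribˡ-+ k _ _))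

-- Fubini, as a property of one factor against an arbitrary second measure. It holds by construction
-- for coins and everything bound together from them; the other factor may then be a restricted
-- message law.
Commutes : Measure Ω → Set₁
Commutes {Ω} μ = ∀ {Ω′ : Set} (ν : Measure Ω′) (f : Ω → Ω′ → ℚ) →
  ∫ μ (λ a → ∫ ν (f a)) ≡ ∫ ν (λ b → ∫ μ (λ a → f a b))

commutes-dirac : (a : Ω) → Commutes (dirac a)
commutes-dirac a ν f = refl

commutes->>= : {μ : Measure Ω} {ν : Ω → Measure Ω′} →
  Commutes μ → (∀ a → Commutes (ν a)) → Commutes (μ >>= ν)
commutes->>= {μ = μ} cμ cν ρ f =
  trans (∫-cong μ (λ a → cν a ρ f)) (cμ ρ _)

record Probability (Ω : Set) : Set₁ where
  field
    measure  : Measure Ω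
    mass≡1   : mass measure ≡ 1ℚ
    commutes : Commutes measure

  ∫-const₁ : ∀ k → ∫ measure (λ _ → k) ≡ k
  ∫-const₁ k = trans (∫-const measure k) (trans (cong (k *_) mass≡1) (ℚ.*-identityʳ k))

open Probability public

𝔼 : Probability Ω → (Ω → ℚ) → ℚ
𝔼 P = ∫ (measure P)

bind : Probability Ω → (Ω → Probability Ω′) → Probability Ω′
bind P Q .measure = measure P >>= λ a → measure (Q a)
bind P Q .mass≡1 = trans (∫-cong (measure P) (λ a → mass≡1 (Q a))) (mass≡1 P)
bind P Q .commutes = commutes->>= {μ = measure P} {ν = λ a → measure (Q a)} (commutes P) (λ a → commutes (Q a))

return : Ω → Probability Ω
return a .measure = dirac a
return a .mass≡1 = refl
return a .commutes = commutes-dirac a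

coin : ∀ p → 0ℚ ≤ p → 0ℚ ≤ 1ℚ - p → Probability Bool
coin p 0≤p 0≤q .measure = scale p 0≤p (dirac true) ⊕ scale (1ℚ - p) 0≤q (dirac false)
coin p 0≤p 0≤q .mass≡1 = solve 1 (λ p → p :* con 1ℚ :+ (con 1ℚ :- p) :* con 1ℚ := con 1ℚ) refl p
coin p 0≤p 0≤q .commutes ν f = sym (trans
  (∫-+ ν (λ b → p * f true b) (λ b → (1ℚ - p) * f false b))
  (cong₂ _+_ (∫-* ν p (f true)) (∫-* ν (1ℚ - p) (f false))))

replicateᴾ : Probability Ω → ∀ n → Probability (Vec Ω n)
replicateᴾ P zero = return []
replicateᴾ P (suc n) = bind P λ a → bind (replicateᴾ P n) λ as → return (a ∷ as)

-- Messages

-- The state of an arm, as seen from one end: alive with its parity, or pending.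
-- `pend false` announces that the arm is lost (so that the end gets smoothed),
-- `pend true` that the end has to be excluded. What a branch of bounded depth
-- does not determine is unknown. The Boolean next to the state is the coin
-- which the far end has for this arm in this round.
data State : Set where
  unknown : State
  alive   : (odd : Bool) → State
  pend    : (out : Bool) → State

Msg : ℕ → Set
Msg = Vec (State × Bool)

Coins : Set
Coins = Bool × Bool × Bool

shiftₛ : Bool → State × Bool → State × Bool
shiftₛ b (unknown , κ) = unknown , κ
shiftₛ b (alive p , κ) = alive (b xor p) , κ
shiftₛ b (pend p  , κ) = pend (b xor p) , κ

shift : ∀ {n} → Bool → Msg n → Msg n
shift b [] = []
shift b (m ∷ ms) = shiftₛ b m ∷ shift b ms

silent : ∀ n → Msg n
silent n = Vec.replicate n (unknown , false)

pending : Bool → ∀ n → Msg n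
pending b n = Vec.replicate n (pend b , false)

data Event : Set where
  quiet lose leave lost : Event

fires : (kick odd near far : Bool) → Bool
fires true  p x y = not p ∧ (x ∧ y)
fires false p x y = p ∧ (x ∨ y)

event : (kick near : Bool) → State × Bool → Event
event k x (unknown    , y) = lost
event k x (alive p    , y) = if fires k p x y then leave else quiet
event k x (pend false , y) = lose
event k x (pend true  , y) = leave

-- A loss on one arm smooths the vertex, and the message of the other arm passes through with one
-- more smoothed vertex. After two losses that message is `pending false` already, and `shift true`
-- turns it into an exclusion. An exclusion of the vertex itself becomes visible one round later, at
-- all later indices.
next : ∀ {n} → Event → Event → Msg n → Msg n → Msg n → Msg n
next quiet quiet r a b = r
next quiet lose  r a b = shift true a
next lose  quiet r a b = shift true b
next lose  lose  r a b = shift true b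
next leave leave r a b = pending false _
next leave quiet r a b = pending false _
next leave lose  r a b = pending false _
next quiet leave r a b = pending false _
next lose  leave r a b = pending false _
next lost  _     r a b = silent _
next quiet lost  r a b = silent _
next lose  lost  r a b = silent _
next leave lost  r a b = silent _

-- The message of a vertex through one edge, given those through the other two
-- and on the assumption that nothing happens through the first edge. The coins
-- of a vertex are for its three edges, the first one in front; the Booleans
-- mark the kicks, rounds in which even arms fire.
forward : ∀ {n} → Vec Bool n → Vec Coins n → Msg n → Msg n → Msg n
forward [] l a b = []
forward (k ∷ ks) ((o , x , y) ∷ l) a b = (alive false , o) ∷
  next (event k x (head a)) (event k y (head b))
    (forward ks l (tail a) (tail b)) (tail a) (tail b)

-- Is a smoothed vertex selected, whose two arms send the given messages?
decide₂ : ∀ {n} → Vec Bool n → Msg n → Msg n → Bool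
decide₂ [] [] [] = false
decide₂ (k ∷ ks) ((alive p , x) ∷ a) ((alive q , y) ∷ b) =
  if fires k (not (p xor q)) x y then not p ∧ not q else decide₂ ks a b
decide₂ (k ∷ ks) ((pend p  , _) ∷ a) ((pend q  , _) ∷ b) = not p ∧ not q
decide₂ (k ∷ ks) ((pend p  , _) ∷ a) ((alive _ , _) ∷ b) = not p
decide₂ (k ∷ ks) ((alive _ , _) ∷ a) ((pend q  , _) ∷ b) = not q
decide₂ (k ∷ ks) ((unknown , _) ∷ a) (_ ∷ b) = false
decide₂ (k ∷ ks) ((alive _ , _) ∷ a) ((unknown , _) ∷ b) = false
decide₂ (k ∷ ks) ((pend _  , _) ∷ a) ((unknown , _) ∷ b) = false

-- A vertex that loses several arms in one round is given up: a rejection can weaken the bound but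
-- cannot spoil independence.
decide₃′ : Event → Event → Event → (r ab ac bc : Bool) → Bool
decide₃′ quiet quiet quiet r ab ac bc = r
decide₃′ lose  quiet quiet r ab ac bc = bc
decide₃′ quiet lose  quiet r ab ac bc = ac
decide₃′ quiet quiet lose  r ab ac bc = ab
decide₃′ _     _     _     r ab ac bc = false

decide₃ : ∀ {n} → Vec Bool n → Vec Coins n → Msg n → Msg n → Msg n → Bool
decide₃ [] l a b c = false
decide₃ (k ∷ ks) ((x , y , z) ∷ l) a b c =
  decide₃′ (event k x (head a)) (event k y (head b)) (event k z (head c))
    (decide₃ ks l (tail a) (tail b) (tail c))
    (decide₂ ks (tail a) (tail b))
    (decide₂ ks (tail a) (tail c))
    (decide₂ ks (tail b) (tail c))

-- Adjacent vertices are not both selected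

fires-comm : ∀ k p x y → fires k p x y ≡ fires k p y x
fires-comm true  true  x     y     = refl
fires-comm true  false false false = refl
fires-comm true  false false true  = refl
fires-comm true  false true  false = refl
fires-comm true  false true  true  = refl
fires-comm false false x     y     = refl
fires-comm false true  false false = refl
fires-comm false true  false true  = refl
fires-comm false true  true  false = refl
fires-comm false true  true  true  = refl

true≢false : true ≢ false
true≢false ()

-- Two adjacent smoothed vertices lie on the same arm; `x` and `y` are its pieces beyond them. Both
-- compute the same total parity from the same end coins, so the arm fires for both or for neither,
-- and the alternation selects at most one of the two.
exclusive₂₂ : ∀ {n} (ks : Vec Bool n) x y →
  decide₂ ks (shift true y) x ≡ true → decide₂ ks (shift true x) y ≡ true → ⊥
exclusive₂₂ [] [] [] ()
exclusive₂₂ (k ∷ ks) ((alive p , u) ∷ x) ((alive q , v) ∷ y) dy dx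
  rewrite fires-comm k (not (not p xor q)) u v with p | q
... | false | false with fires k false v u
...   | false = exclusive₂₂ ks x y dy dx
...   | true = true≢false (sym dy)
exclusive₂₂ (k ∷ ks) ((alive p , u) ∷ x) ((alive q , v) ∷ y) dy dx | true | true with fires k false v u
...   | false = exclusive₂₂ ks x y dy dx
...   | true = true≢false (sym dy)
exclusive₂₂ (k ∷ ks) ((alive p , u) ∷ x) ((alive q , v) ∷ y) dy dx | false | true with fires k true v u
...   | false = exclusive₂₂ ks x y dy dx
...   | true = true≢false (sym dx)
exclusive₂₂ (k ∷ ks) ((alive p , u) ∷ x) ((alive q , v) ∷ y) dy dx | true | false with fires k true v u
...   | false = exclusive₂₂ ks x y dy dx
...   | true = true≢false (sym dy)
exclusive₂₂ (k ∷ ks) ((pend false , u) ∷ x) ((pend false , v) ∷ y) ()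
exclusive₂₂ (k ∷ ks) ((pend false , u) ∷ x) ((pend true , v) ∷ y) dy ()
exclusive₂₂ (k ∷ ks) ((pend true , u) ∷ x) ((pend false , v) ∷ y) ()
exclusive₂₂ (k ∷ ks) ((pend true , u) ∷ x) ((pend true , v) ∷ y) ()
exclusive₂₂ (k ∷ ks) ((pend false , u) ∷ x) ((alive q , v) ∷ y) dy ()
exclusive₂₂ (k ∷ ks) ((pend true , u) ∷ x) ((alive q , v) ∷ y) ()
exclusive₂₂ (k ∷ ks) ((alive p , u) ∷ x) ((pend false , v) ∷ y) ()
exclusive₂₂ (k ∷ ks) ((alive p , u) ∷ x) ((pend true , v) ∷ y) dy ()
exclusive₂₂ (k ∷ ks) ((alive p , u) ∷ x) ((unknown , v) ∷ y) ()
exclusive₂₂ (k ∷ ks) ((pend p , u) ∷ x) ((unknown , v) ∷ y) ()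
exclusive₂₂ (k ∷ ks) ((unknown , u) ∷ x) ((unknown , v) ∷ y) ()
exclusive₂₂ (k ∷ ks) ((unknown , u) ∷ x) ((alive q , v) ∷ y) ()
exclusive₂₂ (k ∷ ks) ((unknown , u) ∷ x) ((pend q , v) ∷ y) ()

-- If the real vertex loses `y` or `z`, it becomes smoothed and two smoothed neighbours remain. If
-- `x` is pending, the parity that selects the smoothed vertex excludes the real one, since
-- `shift true` flips it.
exclusive₂₃ : ∀ {n} (ks : Vec Bool n) l x y z →
  decide₂ ks (forward ks l y z) x ≡ true → decide₃ ks l (shift true x) y z ≡ true → ⊥
exclusive₂₃ [] [] [] [] [] ()
exclusive₂₃ (k ∷ ks) ((o , _) ∷ l) ((unknown , v) ∷ x) (m ∷ y) (m′ ∷ z) ()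
exclusive₂₃ (k ∷ ks) ((o , _) ∷ l) ((pend true , v) ∷ x) (m ∷ y) (m′ ∷ z) ()
exclusive₂₃ (k ∷ ks) ((o , _) ∷ l) ((pend false , v) ∷ x) (m ∷ y) (m′ ∷ z) d₂ ()
exclusive₂₃ (k ∷ ks) ((o , c , c′) ∷ l) ((alive p , v) ∷ x) (m ∷ y) (m′ ∷ z) d₂ d₃
  with fires k (not p) o v
... | true = true≢false (sym d₃)
... | false with event k c m | event k c′ m′
...   | quiet | quiet = exclusive₂₃ ks l x y z d₂ d₃
...   | quiet | lose = exclusive₂₂ ks x y d₂ d₃
...   | lose | quiet = exclusive₂₂ ks x z d₂ d₃
...   | lose | lose = true≢false (sym d₃)
...   | quiet | leave = true≢false (sym d₃)
...   | quiet | lost = true≢false (sym d₃)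
...   | lose | leave = true≢false (sym d₃)
...   | lose | lost = true≢false (sym d₃)
...   | leave | _ = true≢false (sym d₃)
...   | lost | _ = true≢false (sym d₃)

-- Each vertex computes its message as if nothing happened through the common edge. This is
-- consistent because both see the coins `o` and `o′`: either the edge fires and excludes both, or
-- each vertex stays real or gets smoothed by its other arms, which leads to one of the three
-- exclusion statements for the remaining rounds.
exclusive₃₃ : ∀ {n} (ks : Vec Bool n) l l′ x y x′ y′ →
  decide₃ ks l (forward ks l′ x′ y′) x y ≡ true → decide₃ ks l′ (forward ks l x y) x′ y′ ≡ true → ⊥
exclusive₃₃ [] [] [] [] [] [] [] ()
exclusive₃₃ (k ∷ ks) ((o , c , d) ∷ l) ((o′ , c′ , d′) ∷ l′) (m ∷ x) (n ∷ y) (m′ ∷ x′) (n′ ∷ y′) h h′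
  rewrite fires-comm k false o′ o with fires k false o o′
... | true = true≢false (sym h)
... | false with event k c m | event k d n
...   | leave | _ = true≢false (sym h)
...   | lost | _ = true≢false (sym h)
...   | lose | lose = true≢false (sym h)
...   | lose | leave = true≢false (sym h)
...   | lose | lost = true≢false (sym h)
...   | quiet | leave = true≢false (sym h)
...   | quiet | lost = true≢false (sym h)
exclusive₃₃ (k ∷ ks) ((o , c , d) ∷ l) ((o′ , c′ , d′) ∷ l′) (m ∷ x) (n ∷ y) (m′ ∷ x′) (n′ ∷ y′) h h′ | false | quiet | quiet with event k c′ m′ | event k d′ n′
exclusive₃₃ (k ∷ ks) ((o , c , d) ∷ l) ((o′ , c′ , d′) ∷ l′) (m ∷ x) (n ∷ y) (m′ ∷ x′) (n′ ∷ y′) h h′ | false | quiet | quiet | quiet | quiet = exclusive₃₃ ks l l′ x y x′ y′ h h′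
exclusive₃₃ (k ∷ ks) ((o , c , d) ∷ l) ((o′ , c′ , d′) ∷ l′) (m ∷ x) (n ∷ y) (m′ ∷ x′) (n′ ∷ y′) h h′ | false | quiet | quiet | quiet | lose = exclusive₂₃ ks l x′ x y h′ h
exclusive₃₃ (k ∷ ks) ((o , c , d) ∷ l) ((o′ , c′ , d′) ∷ l′) (m ∷ x) (n ∷ y) (m′ ∷ x′) (n′ ∷ y′) h h′ | false | quiet | quiet | lose | quiet = exclusive₂₃ ks l y′ x y h′ h
exclusive₃₃ (k ∷ ks) ((o , c , d) ∷ l) ((o′ , c′ , d′) ∷ l′) (m ∷ x) (n ∷ y) (m′ ∷ x′) (n′ ∷ y′) h h′ | false | quiet | quiet | lose | lose = true≢false (sym h′)
exclusive₃₃ (k ∷ ks) ((o , c , d) ∷ l) ((o′ , c′ , d′) ∷ l′) (m ∷ x) (n ∷ y) (m′ ∷ x′) (n′ ∷ y′) h h′ | false | quiet | quiet | quiet | leave = true≢false (sym h′)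
exclusive₃₃ (k ∷ ks) ((o , c , d) ∷ l) ((o′ , c′ , d′) ∷ l′) (m ∷ x) (n ∷ y) (m′ ∷ x′) (n′ ∷ y′) h h′ | false | quiet | quiet | quiet | lost = true≢false (sym h′)
exclusive₃₃ (k ∷ ks) ((o , c , d) ∷ l) ((o′ , c′ , d′) ∷ l′) (m ∷ x) (n ∷ y) (m′ ∷ x′) (n′ ∷ y′) h h′ | false | quiet | quiet | lose | leave = true≢false (sym h′)
exclusive₃₃ (k ∷ ks) ((o , c , d) ∷ l) ((o′ , c′ , d′) ∷ l′) (m ∷ x) (n ∷ y) (m′ ∷ x′) (n′ ∷ y′) h h′ | false | quiet | quiet | lose | lost = true≢false (sym h′)
exclusive₃₃ (k ∷ ks) ((o , c , d) ∷ l) ((o′ , c′ , d′) ∷ l′) (m ∷ x) (n ∷ y) (m′ ∷ x′) (n′ ∷ y′) h h′ | false | quiet | quiet | leave | _ = true≢false (sym h′)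
exclusive₃₃ (k ∷ ks) ((o , c , d) ∷ l) ((o′ , c′ , d′) ∷ l′) (m ∷ x) (n ∷ y) (m′ ∷ x′) (n′ ∷ y′) h h′ | false | quiet | quiet | lost | _ = true≢false (sym h′)
exclusive₃₃ (k ∷ ks) ((o , c , d) ∷ l) ((o′ , c′ , d′) ∷ l′) (m ∷ x) (n ∷ y) (m′ ∷ x′) (n′ ∷ y′) h h′ | false | quiet | lose with event k c′ m′ | event k d′ n′
exclusive₃₃ (k ∷ ks) ((o , c , d) ∷ l) ((o′ , c′ , d′) ∷ l′) (m ∷ x) (n ∷ y) (m′ ∷ x′) (n′ ∷ y′) h h′ | false | quiet | lose | quiet | quiet = exclusive₂₃ ks l′ x x′ y′ h h′
exclusive₃₃ (k ∷ ks) ((o , c , d) ∷ l) ((o′ , c′ , d′) ∷ l′) (m ∷ x) (n ∷ y) (m′ ∷ x′) (n′ ∷ y′) h h′ | false | quiet | lose | quiet | lose = exclusive₂₂ ks x x′ h h′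
exclusive₃₃ (k ∷ ks) ((o , c , d) ∷ l) ((o′ , c′ , d′) ∷ l′) (m ∷ x) (n ∷ y) (m′ ∷ x′) (n′ ∷ y′) h h′ | false | quiet | lose | lose | quiet = exclusive₂₂ ks x y′ h h′
exclusive₃₃ (k ∷ ks) ((o , c , d) ∷ l) ((o′ , c′ , d′) ∷ l′) (m ∷ x) (n ∷ y) (m′ ∷ x′) (n′ ∷ y′) h h′ | false | quiet | lose | lose | lose = true≢false (sym h′)
exclusive₃₃ (k ∷ ks) ((o , c , d) ∷ l) ((o′ , c′ , d′) ∷ l′) (m ∷ x) (n ∷ y) (m′ ∷ x′) (n′ ∷ y′) h h′ | false | quiet | lose | quiet | leave = true≢false (sym h′)
exclusive₃₃ (k ∷ ks) ((o , c , d) ∷ l) ((o′ , c′ , d′) ∷ l′) (m ∷ x) (n ∷ y) (m′ ∷ x′) (n′ ∷ y′) h h′ | false | quiet | lose | quiet | lost = true≢false (sym h′)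
exclusive₃₃ (k ∷ ks) ((o , c , d) ∷ l) ((o′ , c′ , d′) ∷ l′) (m ∷ x) (n ∷ y) (m′ ∷ x′) (n′ ∷ y′) h h′ | false | quiet | lose | lose | leave = true≢false (sym h′)
exclusive₃₃ (k ∷ ks) ((o , c , d) ∷ l) ((o′ , c′ , d′) ∷ l′) (m ∷ x) (n ∷ y) (m′ ∷ x′) (n′ ∷ y′) h h′ | false | quiet | lose | lose | lost = true≢false (sym h′)
exclusive₃₃ (k ∷ ks) ((o , c , d) ∷ l) ((o′ , c′ , d′) ∷ l′) (m ∷ x) (n ∷ y) (m′ ∷ x′) (n′ ∷ y′) h h′ | false | quiet | lose | leave | _ = true≢false (sym h′)
exclusive₃₃ (k ∷ ks) ((o , c , d) ∷ l) ((o′ , c′ , d′) ∷ l′) (m ∷ x) (n ∷ y) (m′ ∷ x′) (n′ ∷ y′) h h′ | false | quiet | lose | lost | _ = true≢false (sym h′)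
exclusive₃₃ (k ∷ ks) ((o , c , d) ∷ l) ((o′ , c′ , d′) ∷ l′) (m ∷ x) (n ∷ y) (m′ ∷ x′) (n′ ∷ y′) h h′ | false | lose | quiet with event k c′ m′ | event k d′ n′
exclusive₃₃ (k ∷ ks) ((o , c , d) ∷ l) ((o′ , c′ , d′) ∷ l′) (m ∷ x) (n ∷ y) (m′ ∷ x′) (n′ ∷ y′) h h′ | false | lose | quiet | quiet | quiet = exclusive₂₃ ks l′ y x′ y′ h h′
exclusive₃₃ (k ∷ ks) ((o , c , d) ∷ l) ((o′ , c′ , d′) ∷ l′) (m ∷ x) (n ∷ y) (m′ ∷ x′) (n′ ∷ y′) h h′ | false | lose | quiet | quiet | lose = exclusive₂₂ ks y x′ h h′
exclusive₃₃ (k ∷ ks) ((o , c , d) ∷ l) ((o′ , c′ , d′) ∷ l′) (m ∷ x) (n ∷ y) (m′ ∷ x′) (n′ ∷ y′) h h′ | false | lose | quiet | lose | quiet = exclusive₂₂ ks y y′ h h′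
exclusive₃₃ (k ∷ ks) ((o , c , d) ∷ l) ((o′ , c′ , d′) ∷ l′) (m ∷ x) (n ∷ y) (m′ ∷ x′) (n′ ∷ y′) h h′ | false | lose | quiet | lose | lose = true≢false (sym h′)
exclusive₃₃ (k ∷ ks) ((o , c , d) ∷ l) ((o′ , c′ , d′) ∷ l′) (m ∷ x) (n ∷ y) (m′ ∷ x′) (n′ ∷ y′) h h′ | false | lose | quiet | quiet | leave = true≢false (sym h′)
exclusive₃₃ (k ∷ ks) ((o , c , d) ∷ l) ((o′ , c′ , d′) ∷ l′) (m ∷ x) (n ∷ y) (m′ ∷ x′) (n′ ∷ y′) h h′ | false | lose | quiet | quiet | lost = true≢false (sym h′)
exclusive₃₃ (k ∷ ks) ((o , c , d) ∷ l) ((o′ , c′ , d′) ∷ l′) (m ∷ x) (n ∷ y) (m′ ∷ x′) (n′ ∷ y′) h h′ | false | lose | quiet | lose | leave = true≢false (sym h′)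
exclusive₃₃ (k ∷ ks) ((o , c , d) ∷ l) ((o′ , c′ , d′) ∷ l′) (m ∷ x) (n ∷ y) (m′ ∷ x′) (n′ ∷ y′) h h′ | false | lose | quiet | lose | lost = true≢false (sym h′)
exclusive₃₃ (k ∷ ks) ((o , c , d) ∷ l) ((o′ , c′ , d′) ∷ l′) (m ∷ x) (n ∷ y) (m′ ∷ x′) (n′ ∷ y′) h h′ | false | lose | quiet | leave | _ = true≢false (sym h′)
exclusive₃₃ (k ∷ ks) ((o , c , d) ∷ l) ((o′ , c′ , d′) ∷ l′) (m ∷ x) (n ∷ y) (m′ ∷ x′) (n′ ∷ y′) h h′ | false | lose | quiet | lost | _ = true≢false (sym h′)

-- Symmetry

decide₂-comm : ∀ {n} (ks : Vec Bool n) a b → decide₂ ks a b ≡ decide₂ ks b a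
decide₂-comm [] [] [] = refl
decide₂-comm (k ∷ ks) ((alive p , u) ∷ x) ((alive q , v) ∷ y)
  rewrite xor-comm q p | ∧-comm (not q) (not p) | fires-comm k (not (p xor q)) v u
  with fires k (not (p xor q)) u v
... | true  = refl
... | false = decide₂-comm ks x y
decide₂-comm (k ∷ ks) ((pend p , u) ∷ x) ((pend q , v) ∷ y) = ∧-comm (not p) (not q)
decide₂-comm (k ∷ ks) ((pend p , u) ∷ x) ((alive q , v) ∷ y) = refl
decide₂-comm (k ∷ ks) ((alive p , u) ∷ x) ((pend q , v) ∷ y) = refl
decide₂-comm (k ∷ ks) ((alive p , u) ∷ x) ((unknown , v) ∷ y) = refl
decide₂-comm (k ∷ ks) ((pend p , u) ∷ x) ((unknown , v) ∷ y) = refl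
decide₂-comm (k ∷ ks) ((unknown , u) ∷ x) ((unknown , v) ∷ y) = refl
decide₂-comm (k ∷ ks) ((unknown , u) ∷ x) ((alive q , v) ∷ y) = refl
decide₂-comm (k ∷ ks) ((unknown , u) ∷ x) ((pend q , v) ∷ y) = refl

every-event? : {P : Event → Set} → (∀ e → Dec (P e)) → Dec (∀ e → P e)
every-event? P? = map′
  (λ { (q , l , m , n) → λ { quiet → q ; lose → l ; leave → m ; lost → n } })
  (λ p → p quiet , p lose , p leave , p lost)
  (P? quiet ×-dec P? lose ×-dec P? leave ×-dec P? lost)

every-bool? : {P : Bool → Set} → (∀ b → Dec (P b)) → Dec (∀ b → P b)
every-bool? P? = map′ (λ { (f , t) → λ { false → f ; true → t } }) (λ p → p false , p true) (P? false ×-dec P? true)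

every-case? : {P : (e f g : Event) (r ab ac bc : Bool) → Set} → (∀ e f g r ab ac bc → Dec (P e f g r ab ac bc)) →
  Dec (∀ e f g r ab ac bc → P e f g r ab ac bc)
every-case? P? = every-event? λ e → every-event? λ f → every-event? λ g →
  every-bool? λ r → every-bool? λ ab → every-bool? λ ac → every-bool? λ bc → P? e f g r ab ac bc

decide₃′-swap₁ : ∀ e f g r ab ac bc → decide₃′ e f g r ab ac bc ≡ decide₃′ f e g r ab bc ac
decide₃′-swap₁ = from-yes (every-case? λ e f g r ab ac bc →
  decide₃′ e f g r ab ac bc Bool.≟ decide₃′ f e g r ab bc ac)

decide₃′-swap₂ : ∀ e f g r ab ac bc → decide₃′ e f g r ab ac bc ≡ decide₃′ e g f r ac ab bc
decide₃′-swap₂ = from-yes (every-case? λ e f g r ab ac bc →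
  decide₃′ e f g r ab ac bc Bool.≟ decide₃′ e g f r ac ab bc)

front : Fin 3 → Coins → Coins
front zero             (x , y , z) = x , y , z
front 1F       (x , y , z) = y , x , z
front 2F (x , y , z) = z , x , y

other₁ other₂ : Fin 3 → Fin 3
other₁ zero    = suc zero
other₁ (suc _) = zero
other₂ zero             = suc 1F
other₂ 1F       = suc 1F
other₂ 2F = suc zero

decide₃-swap₁ : ∀ {n} (ks : Vec Bool n) l a b c →
  decide₃ ks l a b c ≡ decide₃ ks (Vec.map (front 1F) l) b a c
decide₃-swap₁ [] [] [] [] [] = refl
decide₃-swap₁ (k ∷ ks) ((x , y , z) ∷ l) (m ∷ a) (m′ ∷ b) (m″ ∷ c)
  rewrite decide₃-swap₁ ks l a b c | decide₂-comm ks b a =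
  decide₃′-swap₁ (event k x m) (event k y m′) (event k z m″) _ _ _ _

decide₃-rotate : ∀ {n} (ks : Vec Bool n) l a b c →
  decide₃ ks l a b c ≡ decide₃ ks (Vec.map (front 2F) l) c a b
decide₃-rotate [] [] [] [] [] = refl
decide₃-rotate (k ∷ ks) ((x , y , z) ∷ l) (m ∷ a) (m′ ∷ b) (m″ ∷ c)
  rewrite decide₃-rotate ks l a b c | decide₂-comm ks c a | decide₂-comm ks c b = trans
  (decide₃′-swap₂ (event k x m) (event k y m′) (event k z m″) _ _ _ _)
  (decide₃′-swap₁ (event k x m) (event k z m″) (event k y m′) _ _ _ _)

-- Exclusion is stated for the edge in first position, whereas every vertex numbers its edges in its
-- own way.
decide₃-front : ∀ {n} (ks : Vec Bool n) l (m : Fin 3 → Msg n) i →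
  decide₃ ks l (m zero) (m 1F) (m 2F) ≡
  decide₃ ks (Vec.map (front i) l) (m i) (m (other₁ i)) (m (other₂ i))
decide₃-front ks l m zero = cong
  (λ l → decide₃ ks l (m zero) (m 1F) (m 2F)) (sym (Vec.map-id l))
decide₃-front ks l m 1F = decide₃-swap₁ ks l _ _ _
decide₃-front ks l m 2F = decide₃-rotate ks l _ _ _

-- Monotonicity in the amount of information

infix 4 _⊑ₛ_ _⊑_

-- The coins are unrelated in the first case because `event` ignores both coins of an arm in an
-- unknown state.
data _⊑ₛ_ : State × Bool → State × Bool → Set where
  unknown : ∀ {κ m} → (unknown , κ) ⊑ₛ m
  known   : ∀ {m} → m ⊑ₛ m

_⊑_ : ∀ {n} → Msg n → Msg n → Set
_⊑_ = Pointwise _⊑ₛ_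

⊑-refl : ∀ {n} {a : Msg n} → a ⊑ a
⊑-refl = Pointwise.refl known

silent-least : ∀ {n} (a : Msg n) → silent n ⊑ a
silent-least [] = []
silent-least (m ∷ a) = unknown ∷ silent-least a

shift-mono : ∀ {n} b {a a′ : Msg n} → a ⊑ a′ → shift b a ⊑ shift b a′
shift-mono b [] = []
shift-mono b (unknown ∷ p) = unknown ∷ shift-mono b p
shift-mono b (known   ∷ p) = known ∷ shift-mono b p

next-lostʳ : ∀ {n} e {r r′ a b a′ b′ : Msg n} f → next e lost r a b ⊑ next e f r′ a′ b′
next-lostʳ quiet f = silent-least _
next-lostʳ lose  f = silent-least _
next-lostʳ leave f = silent-least _
next-lostʳ lost  f = ⊑-refl

next-mono : ∀ {n} e f {r r′ a b a′ b′ : Msg n} → r ⊑ r′ → a ⊑ a′ → b ⊑ b′ →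
  next e f r a b ⊑ next e f r′ a′ b′
next-mono quiet quiet r a b = r
next-mono quiet lose  r a b = shift-mono true a
next-mono lose  quiet r a b = shift-mono true b
next-mono lose  lose  r a b = shift-mono true b
next-mono leave leave r a b = ⊑-refl
next-mono leave quiet r a b = ⊑-refl
next-mono leave lose  r a b = ⊑-refl
next-mono quiet leave r a b = ⊑-refl
next-mono lose  leave r a b = ⊑-refl
next-mono lost  f     r a b = ⊑-refl
next-mono quiet lost  r a b = ⊑-refl
next-mono lose  lost  r a b = ⊑-refl
next-mono leave lost  r a b = ⊑-refl

forward-mono : ∀ {n} (ks : Vec Bool n) l {a b a′ b′} → a ⊑ a′ → b ⊑ b′ →
  forward ks l a b ⊑ forward ks l a′ b′
forward-mono [] [] [] [] = []
forward-mono (k ∷ ks) (_ ∷ l) (unknown ∷ p) (q ∷ qs) = known ∷ silent-least _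
forward-mono (k ∷ ks) ((_ , x , y) ∷ l) (known {m} ∷ p) (unknown ∷ q) = known ∷ next-lostʳ (event k x m) _
forward-mono (k ∷ ks) ((_ , x , y) ∷ l) (known {m} ∷ p) (known {m′} ∷ q) =
  known ∷ next-mono (event k x m) (event k y m′) (forward-mono ks l p q) p q

decide₂-mono : ∀ {n} (ks : Vec Bool n) {a b a′ b′} → a ⊑ a′ → b ⊑ b′ →
  decide₂ ks a b ≡ true → decide₂ ks a′ b′ ≡ true
decide₂-mono [] [] [] ()
decide₂-mono (k ∷ ks) (unknown ∷ p) (q ∷ qs) ()
decide₂-mono (k ∷ ks) (known {alive _ , _} ∷ p) (unknown ∷ q) ()
decide₂-mono (k ∷ ks) (known {pend _ , _} ∷ p) (unknown ∷ q) ()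
decide₂-mono (k ∷ ks) (known {unknown , _} ∷ p) (unknown ∷ q) ()
decide₂-mono (k ∷ ks) (known {alive u , x} ∷ p) (known {alive v , y} ∷ q) h
  with fires k (not (u xor v)) x y
... | true  = h
... | false = decide₂-mono ks p q h
decide₂-mono (k ∷ ks) (known {alive _ , _} ∷ p) (known {pend _ , _} ∷ q) h = h
decide₂-mono (k ∷ ks) (known {pend _ , _} ∷ p) (known {alive _ , _} ∷ q) h = h
decide₂-mono (k ∷ ks) (known {pend _ , _} ∷ p) (known {pend _ , _} ∷ q) h = h
decide₂-mono (k ∷ ks) (known {alive _ , _} ∷ p) (known {unknown , _} ∷ q) ()
decide₂-mono (k ∷ ks) (known {pend _ , _} ∷ p) (known {unknown , _} ∷ q) ()
decide₂-mono (k ∷ ks) (known {unknown , _} ∷ p) (known ∷ q) ()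

decide₃′-mono : ∀ e f g {r ab ac bc r′ ab′ ac′ bc′} →
  (r ≡ true → r′ ≡ true) → (ab ≡ true → ab′ ≡ true) →
  (ac ≡ true → ac′ ≡ true) → (bc ≡ true → bc′ ≡ true) →
  decide₃′ e f g r ab ac bc ≡ true → decide₃′ e f g r′ ab′ ac′ bc′ ≡ true
decide₃′-mono quiet quiet quiet r ab ac bc = r
decide₃′-mono lose  quiet quiet r ab ac bc = bc
decide₃′-mono quiet lose  quiet r ab ac bc = ac
decide₃′-mono quiet quiet lose  r ab ac bc = ab
decide₃′-mono quiet quiet leave r ab ac bc ()
decide₃′-mono quiet quiet lost r ab ac bc ()
decide₃′-mono quiet lose lose r ab ac bc ()
decide₃′-mono quiet lose leave r ab ac bc ()
decide₃′-mono quiet lose lost r ab ac bc ()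
decide₃′-mono quiet leave g r ab ac bc ()
decide₃′-mono quiet lost g r ab ac bc ()
decide₃′-mono lose quiet lose r ab ac bc ()
decide₃′-mono lose quiet leave r ab ac bc ()
decide₃′-mono lose quiet lost r ab ac bc ()
decide₃′-mono lose lose g r ab ac bc ()
decide₃′-mono lose leave g r ab ac bc ()
decide₃′-mono lose lost g r ab ac bc ()
decide₃′-mono leave f g r ab ac bc ()
decide₃′-mono lost f g r ab ac bc ()

decide₃′-lost₂ : ∀ e f r ab ac bc → decide₃′ e lost f r ab ac bc ≢ true
decide₃′-lost₂ quiet f r ab ac bc ()
decide₃′-lost₂ lose  f r ab ac bc ()
decide₃′-lost₂ leave f r ab ac bc ()
decide₃′-lost₂ lost  f r ab ac bc ()

decide₃′-lost₃ : ∀ e f r ab ac bc → decide₃′ e f lost r ab ac bc ≢ true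
decide₃′-lost₃ quiet quiet r ab ac bc ()
decide₃′-lost₃ quiet lose  r ab ac bc ()
decide₃′-lost₃ quiet leave r ab ac bc ()
decide₃′-lost₃ quiet lost  r ab ac bc ()
decide₃′-lost₃ lose  quiet r ab ac bc ()
decide₃′-lost₃ lose  lose  r ab ac bc ()
decide₃′-lost₃ lose  leave r ab ac bc ()
decide₃′-lost₃ lose  lost  r ab ac bc ()
decide₃′-lost₃ leave f     r ab ac bc ()
decide₃′-lost₃ lost  f     r ab ac bc ()

-- An unknown entry gives the event `lost`, which means rejection in `decide₃′` and silence in
-- `next`. Hence a selection rests on known entries only and survives when others become known.
decide₃-mono : ∀ {n} (ks : Vec Bool n) l {a b c a′ b′ c′} → a ⊑ a′ → b ⊑ b′ → c ⊑ c′ →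
  decide₃ ks l a b c ≡ true → decide₃ ks l a′ b′ c′ ≡ true
decide₃-mono [] [] [] [] [] ()
decide₃-mono (k ∷ ks) ((x , y , z) ∷ l) (unknown ∷ p) (q ∷ qs) (r ∷ rs) ()
decide₃-mono (k ∷ ks) ((x , y , z) ∷ l) {c = m″ ∷ c} (known {m} ∷ p) (unknown ∷ qs) (r ∷ rs) h =
  ⊥-elim (decide₃′-lost₂ (event k x m) (event k z m″) _ _ _ _ h)
decide₃-mono (k ∷ ks) ((x , y , z) ∷ l) (known {m} ∷ p) (known {m′} ∷ qs) (unknown ∷ rs) h =
  ⊥-elim (decide₃′-lost₃ (event k x m) (event k y m′) _ _ _ _ h)
decide₃-mono (k ∷ ks) ((x , y , z) ∷ l) (known {m} ∷ p) (known {m′} ∷ q) (known {m″} ∷ r) =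
  decide₃′-mono (event k x m) (event k y m′) (event k z m″)
    (decide₃-mono ks l p q r) (decide₂-mono ks p q) (decide₂-mono ks p r) (decide₂-mono ks q r)

-- The law of a message

χ : Bool → ℚ
χ false = 0ℚ
χ true  = 1ℚ

0≤1 : 0ℚ ≤ 1ℚ
0≤1 = ℚ.nonNegative⁻¹ 1ℚ

0≤χ : ∀ b → 0ℚ ≤ χ b
0≤χ false = ≤-refl
0≤χ true  = 0≤1

quiet? lose? leave? : Event → Bool
quiet? quiet = true
quiet? _     = false
lose? lose = true
lose? _    = false
leave? leave = true
leave? _     = false

isQuiet isLose isLeave : Event → ℚ
isQuiet = χ ∘ quiet?
isLose  = χ ∘ lose?
isLeave = χ ∘ leave?

0≤isQuiet : ∀ e → 0ℚ ≤ isQuiet e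
0≤isQuiet = 0≤χ ∘ quiet?

0≤isLose : ∀ e → 0ℚ ≤ isLose e
0≤isLose = 0≤χ ∘ lose?

0≤isLeave : ∀ e → 0ℚ ≤ isLeave e
0≤isLeave = 0≤χ ∘ leave?

module _ {n : ℕ} (φ : Msg n → ℚ) (0≤φ : ∀ m → 0ℚ ≤ φ m) where

  private
    terms : (q l r q′ l′ r′ R A B C : Polynomial 10) → Polynomial 10
    terms q l r q′ l′ r′ R A B C =
      q :* (q′ :* R) :+ (l :* (q′ :* B) :+ ((q :* A) :* l′ :+
      (l :* (l′ :* B) :+ ((r :* C) :* (r′ :+ (l′ :+ q′)) :+ ((l :+ q) :* C) :* r′))))

    o i : Polynomial 10
    o = con 0ℚ
    i = con 1ℚ

  -- Each term is a product of factors for the two arms, which are independent.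
  expansion : Event → Event → (R A B C : ℚ) → ℚ
  expansion e f R A B C =
    isQuiet e * (isQuiet f * R) + (isLose e * (isQuiet f * B) + ((isQuiet e * A) * isLose f +
    (isLose e * (isLose f * B) + ((isLeave e * C) * (isLeave f + (isLose f + isQuiet f)) +
    ((isLose e + isQuiet e) * C) * isLeave f))))

  -- For known events this is an equality, with the indicators entering the solver as the constants
  -- 0 and 1; once an event is `lost`, the expansion vanishes.
  next-cases : ∀ e f r a b →
    expansion e f (φ r) (φ (shift true a)) (φ (shift true b)) (φ (pending false n)) ≤ φ (next e f r a b)
  next-cases e f r a b = cases e f
    where
    z R A B C : ℚ
    z = 0ℚ
    R = φ r
    A = φ (shift true a)
    B = φ (shift true b)
    C = φ (pending false n)
    cases : ∀ e f → expansion e f R A B C ≤ φ (next e f r a b)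
    cases quiet quiet = ≤-reflexive (solve 10 (λ _ _ _ _ _ _ R A B C → terms i o o i o o R A B C := R) refl z z z z z z R A B C)
    cases quiet lose  = ≤-reflexive (solve 10 (λ _ _ _ _ _ _ R A B C → terms i o o o i o R A B C := A) refl z z z z z z R A B C)
    cases quiet leave = ≤-reflexive (solve 10 (λ _ _ _ _ _ _ R A B C → terms i o o o o i R A B C := C) refl z z z z z z R A B C)
    cases lose  quiet = ≤-reflexive (solve 10 (λ _ _ _ _ _ _ R A B C → terms o i o i o o R A B C := B) refl z z z z z z R A B C)
    cases lose  lose  = ≤-reflexive (solve 10 (λ _ _ _ _ _ _ R A B C → terms o i o o i o R A B C := B) refl z z z z z z R A B C)
    cases lose  leave = ≤-reflexive (solve 10 (λ _ _ _ _ _ _ R A B C → terms o i o o o i R A B C := C) refl z z z z z z R A B C)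
    cases leave quiet = ≤-reflexive (solve 10 (λ _ _ _ _ _ _ R A B C → terms o o i i o o R A B C := C) refl z z z z z z R A B C)
    cases leave lose  = ≤-reflexive (solve 10 (λ _ _ _ _ _ _ R A B C → terms o o i o i o R A B C := C) refl z z z z z z R A B C)
    cases leave leave = ≤-reflexive (solve 10 (λ _ _ _ _ _ _ R A B C → terms o o i o o i R A B C := C) refl z z z z z z R A B C)
    cases lost f = ≤-trans (≤-reflexive (solve 10 (λ _ _ _ q l r R A B C → terms o o o q l r R A B C := o) refl
      z z z (isQuiet f) (isLose f) (isLeave f) R A B C)) (0≤φ _)
    cases quiet lost = ≤-trans (≤-reflexive (solve 10 (λ _ _ _ _ _ _ R A B C → terms i o o o o o R A B C := o) refl z z z z z z R A B C)) (0≤φ _)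
    cases lose  lost = ≤-trans (≤-reflexive (solve 10 (λ _ _ _ _ _ _ R A B C → terms o i o o o o R A B C := o) refl z z z z z z R A B C)) (0≤φ _)
    cases leave lost = ≤-trans (≤-reflexive (solve 10 (λ _ _ _ _ _ _ R A B C → terms o o i o o o R A B C := o) refl z z z z z z R A B C)) (0≤φ _)
-- The functions on which message laws are compared: nonnegative, so that mass may be discarded, and
-- monotone, so that their integrals grow with the truncation depth.
record Test {n} (f : Msg n → ℚ) : Set where
  field
    nonneg : ∀ a → 0ℚ ≤ f a
    mono   : ∀ {a b} → a ⊑ b → f a ≤ f b

open Test public

head-mono : ∀ {n} {a b : Msg (suc n)} → a ⊑ b → head a ⊑ₛ head b
head-mono (p ∷ _) = p

tail-mono : ∀ {n} {a b : Msg (suc n)} → a ⊑ b → tail a ⊑ tail b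
tail-mono (_ ∷ p) = p

indicator-mono : ∀ k x {m m′} (ι : Event → ℚ) → (∀ e → 0ℚ ≤ ι e) → ι lost ≡ 0ℚ →
  m ⊑ₛ m′ → ι (event k x m) ≤ ι (event k x m′)
indicator-mono k x {m′ = m′} ι 0≤ι ι₀ unknown = subst (_≤ ι (event k x m′)) (sym ι₀) (0≤ι _)
indicator-mono k x ι 0≤ι ι₀ known = ≤-refl

module Law (side : Probability Bool) where

  private
    σ : Measure Bool
    σ = measure side

  coins : Probability Coins
  coins = bind side λ o → bind side λ x → bind side λ y → return (o , x , y)

  streams : ∀ n → Probability (Vec Coins n)
  streams = replicateᴾ coins

  part : ∀ {n} → Vec Bool n → Bool → Measure (Msg n) → Measure (Msg n)
  part {n} ks p μ =
    measure (streams n) >>= λ l → μ >>= λ a → μ >>= λ b → dirac (shift p (forward ks l a b))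

  -- The law of the rest of a message, restricted to a quiet round at a vertex of degree three.
  advance : ∀ {n} → Bool → Measure (Msg (suc n)) → Measure (Msg n)
  advance k μ = μ >>= λ m → σ >>= λ x →
    scale (isQuiet (event k x (head m))) (0≤isQuiet (event k x (head m))) (dirac (tail m))

  module _ {n} (k : Bool) (ks : Vec Bool n) (μ : Measure (Msg (suc n))) where

    private
      T : Set
      T = Bool × Bool × Vec Coins n × Msg (suc n) × Msg (suc n)

      on : (Bool → Bool → Vec Coins n → Msg (suc n) → Msg (suc n) → ℚ) → T → ℚ
      on h (x , y , l , a , b) = h x y l a b

      joint : Measure T
      joint = σ >>= λ x → σ >>= λ y → measure (streams n) >>= λ l → μ >>= λ a → μ >>= λ b →
        dirac (x , y , l , a , b)

      ev : Bool → Msg (suc n) → Event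
      ev x a = event k x (head a)

    -- The rest of a message of `part (k ∷ ks) p μ` after its head.
    step : Bool → Measure (Msg n)
    step p = joint >>= λ { (x , y , l , a , b) → dirac (shift p
      (next (ev x a) (ev y b) (forward ks l (tail a) (tail b)) (tail a) (tail b))) }

    -- Each coin is moved next to the message of the arm it acts on; integrals of products over the
    -- two arms then factor.
    reorder : ∀ h → ∫ joint (on h) ≡
      ∫ (measure (streams n)) λ l → ∫ μ λ a → ∫ σ λ x → ∫ μ λ b → ∫ σ λ y → h x y l a b
    reorder h = trans
      (∫-cong σ λ x → commutes side
        (measure (streams n) >>= λ l → μ >>= λ a → μ >>= λ b → dirac (l , a , b))
        (λ { y (l , a , b) → h x y l a b }))
      (commutes side
        (measure (streams n) >>= λ l → μ >>= λ a → dirac (l , a))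
        (λ { x (l , a) → ∫ μ λ b → ∫ σ λ y → h x y l a b }))

    product : ∀ (u v : Bool → Msg (suc n) → ℚ) →
      ∫ joint (on λ x y l a b → u x a * v y b) ≡
      (∫ μ λ a → ∫ σ λ x → u x a) * (∫ μ λ b → ∫ σ λ y → v y b)
    product u v = trans (reorder _) (trans
      (∫-cong (measure (streams n)) λ l → trans
        (∫-cong μ λ a → trans
          (∫-cong σ λ x → trans
            (∫-cong μ λ b → ∫-* σ (u x a) (λ y → v y b))
            (∫-* μ (u x a) _))
          (∫-*ʳ σ _ (λ x → u x a)))
        (∫-*ʳ μ _ (λ a → ∫ σ λ x → u x a)))
      (∫-const₁ (streams n) _))

    loses : (Msg n → ℚ) → ℚ
    loses f = ∫ μ λ a → ∫ σ λ x → isLose (ev x a) * f (tail a)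

    leaves : ℚ
    leaves = ∫ μ λ a → ∫ σ λ x → isLeave (ev x a)

    stays : ℚ
    stays = mass (advance k μ)

    quiet-part : ∀ p f →
      ∫ joint (on λ x y l a b → isQuiet (ev x a) * (isQuiet (ev y b) *
        f (shift p (forward ks l (tail a) (tail b))))) ≡
      ∫ (part ks p (advance k μ)) f
    quiet-part p f = trans (reorder _)
      (∫-cong (measure (streams n)) λ l → ∫-cong μ λ a → ∫-cong σ λ x → trans
        (∫-cong μ λ b → ∫-* σ (isQuiet (ev x a)) _)
        (∫-* μ (isQuiet (ev x a)) _))

    mass-step : ∀ p → mass (step p) ≡ mass μ * mass μ
    mass-step p = trans (∫-const₁ side _) (trans (∫-const₁ side _) (trans (∫-const₁ (streams n) _)
      (∫-const μ (mass μ))) )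

    -- Every term of `expansion` is a product over independent arms, and each factor is replaced by
    -- its lower bound. The hypothesis on `loses` ranges over all tests because it bounds a whole
    -- law: that of the rest of a message after a loss, by a point mass at `pending false`.
    step-lower : ∀ p {f} → Test f → ∀ {zl er nn} → 0ℚ ≤ zl → 0ℚ ≤ er → 0ℚ ≤ nn →
      (∀ {ψ} → Test ψ → zl * ψ (pending false n) ≤ loses ψ) → er ≤ leaves → nn ≤ stays →
      ∫ (part ks p (advance k μ)) f +
        (zl * ∫ (advance k μ) (f ∘ shift p ∘ shift true) +
        (∫ (advance k μ) (f ∘ shift p ∘ shift true) * zl +
        (zl * (zl * f (shift p (shift true (pending false n)))) +
        ((er * f (shift p (pending false n))) * (er + (zl + nn)) +
        ((zl + nn) * f (shift p (pending false n))) * er)))) ≤ ∫ (step p) f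
    step-lower p {f} tf {zl} {er} {nn} 0≤zl 0≤er 0≤nn hl hr hq = begin
      _ ≤⟨ +-mono-≤ (≤-reflexive (sym (quiet-part p f)))
          (+-mono-≤ b₂ (+-mono-≤ b₃ (+-mono-≤ b₄ (+-mono-≤ b₅ b₆)))) ⟩
      _ ≡⟨ sym split ⟩
      _ ≤⟨ ∫-mono joint (λ { (x , y , l , a , b) →
             next-cases (f ∘ shift p) (λ m → nonneg tf _) (ev x a) (ev y b) _ _ _ }) ⟩
      _ ∎
      where
      open ℚ.≤-Reasoning
      C : ℚ
      C = f (shift p (pending false n))
      0≤C : 0ℚ ≤ C
      0≤C = nonneg tf _
      D : Msg (suc n) → ℚ
      D a = f (shift p (shift true (tail a)))
      h₁ h₂ h₃ h₄ h₅ h₆ : Bool → Bool → Vec Coins n → Msg (suc n) → Msg (suc n) → ℚ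
      h₁ x y l a b = isQuiet (ev x a) * (isQuiet (ev y b) *
        f (shift p (forward ks l (tail a) (tail b))))
      h₂ x y l a b = isLose (ev x a) * (isQuiet (ev y b) * D b)
      h₃ x y l a b = (isQuiet (ev x a) * D a) * isLose (ev y b)
      h₄ x y l a b = isLose (ev x a) * (isLose (ev y b) * D b)
      h₅ x y l a b = (isLeave (ev x a) * C) *
        (isLeave (ev y b) + (isLose (ev y b) + isQuiet (ev y b)))
      h₆ x y l a b = ((isLose (ev x a) + isQuiet (ev x a)) * C) * isLeave (ev y b)
      split : ∫ joint (on λ x y l a b → h₁ x y l a b + (h₂ x y l a b + (h₃ x y l a b +
          (h₄ x y l a b + (h₅ x y l a b + h₆ x y l a b))))) ≡
        ∫ joint (on h₁) + (∫ joint (on h₂) + (∫ joint (on h₃) + (∫ joint (on h₄) +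
          (∫ joint (on h₅) + ∫ joint (on h₆)))))
      split = trans (∫-+ joint (on h₁) _) (cong (_+_ (∫ joint (on h₁)))
        (trans (∫-+ joint (on h₂) _) (cong (_+_ (∫ joint (on h₂)))
        (trans (∫-+ joint (on h₃) _) (cong (_+_ (∫ joint (on h₃)))
        (trans (∫-+ joint (on h₄) _) (cong (_+_ (∫ joint (on h₄)))
        (∫-+ joint (on h₅) (on h₆)))))))))
      μσ : Measure (Bool × Msg (suc n))
      μσ = μ >>= λ a → σ >>= λ x → dirac (x , a)
      lose-mass quiet-mass leave-mass : ℚ
      lose-mass  = ∫ μ λ a → ∫ σ λ x → isLose (ev x a)
      quiet-mass = ∫ μ λ a → ∫ σ λ x → isQuiet (ev x a)
      leave-mass = ∫ μ λ a → ∫ σ λ x → isLeave (ev x a)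
      zl≤ : zl ≤ lose-mass
      zl≤ = subst₂ _≤_ (ℚ.*-identityʳ zl)
        (∫-cong μσ {g = λ { (x , a) → isLose (ev x a) }} (λ { (x , a) → ℚ.*-identityʳ _ }))
        (hl {λ _ → 1ℚ} record { nonneg = λ _ → 0≤1 ; mono = λ _ → ≤-refl })
      nn≤ : nn ≤ quiet-mass
      nn≤ = subst (nn ≤_)
        (∫-cong μσ {g = λ { (x , a) → isQuiet (ev x a) }} (λ { (x , a) → ℚ.*-identityʳ _ })) hq
      tD : Test (f ∘ shift p ∘ shift true)
      tD = record { nonneg = λ _ → nonneg tf _
                  ; mono = λ a⊑b → mono tf (shift-mono p (shift-mono true a⊑b)) }
      0≤adv : 0ℚ ≤ ∫ (advance k μ) (f ∘ shift p ∘ shift true)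
      0≤adv = ∫-nonneg (advance k μ) (nonneg tD)
      b₂ : zl * ∫ (advance k μ) (f ∘ shift p ∘ shift true) ≤ ∫ joint (on h₂)
      b₂ = ≤-trans (*-monoʳ 0≤adv zl≤)
        (≤-reflexive (sym (product (λ x a → isLose (ev x a)) (λ y b → isQuiet (ev y b) * D b))))
      b₃ : ∫ (advance k μ) (f ∘ shift p ∘ shift true) * zl ≤ ∫ joint (on h₃)
      b₃ = ≤-trans (*-monoˡ 0≤adv zl≤)
        (≤-reflexive (sym (product (λ x a → isQuiet (ev x a) * D a) (λ y b → isLose (ev y b)))))
      b₄ : zl * (zl * f (shift p (shift true (pending false n)))) ≤ ∫ joint (on h₄)
      b₄ = ≤-trans (*-mono-≤ 0≤zl (0≤* 0≤zl (nonneg tf (shift p (shift true (pending false n))))) zl≤ (hl tD))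
        (≤-reflexive (sym (product (λ x a → isLose (ev x a)) (λ y b → isLose (ev y b) * D b))))
      b₅ : (er * C) * (er + (zl + nn)) ≤ ∫ joint (on h₅)
      b₅ = ≤-trans
        (*-mono-≤ (0≤* 0≤er 0≤C) (0≤+ 0≤er (0≤+ 0≤zl 0≤nn)) (*-monoʳ 0≤C hr)
          (+-mono-≤ hr (+-mono-≤ zl≤ nn≤)))
        (≤-reflexive (sym (trans
          (product (λ x a → isLeave (ev x a) * C)
            (λ y b → isLeave (ev y b) + (isLose (ev y b) + isQuiet (ev y b))))
          (cong₂ _*_ (∫-*ʳ μσ C (λ { (x , a) → isLeave (ev x a) }))
            (trans (∫-+ μσ (λ { (x , a) → isLeave (ev x a) }) _)
              (cong (_+_ leave-mass)
                (∫-+ μσ (λ { (x , a) → isLose (ev x a) }) (λ { (x , a) → isQuiet (ev x a) }))))))))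
      b₆ : ((zl + nn) * C) * er ≤ ∫ joint (on h₆)
      b₆ = ≤-trans
        (*-mono-≤ (0≤* (0≤+ 0≤zl 0≤nn) 0≤C) 0≤er (*-monoʳ 0≤C (+-mono-≤ zl≤ nn≤)) hr)
        (≤-reflexive (sym (trans
          (product (λ x a → (isLose (ev x a) + isQuiet (ev x a)) * C) (λ y b → isLeave (ev y b)))
          (cong (_* leave-mass) (trans
            (∫-*ʳ μσ C (λ { (x , a) → isLose (ev x a) + isQuiet (ev x a) }))
            (cong (_* C)
              (∫-+ μσ (λ { (x , a) → isLose (ev x a) }) (λ { (x , a) → isQuiet (ev x a) }))))))))

-- Lower bounds for message laws, round by round

shift-shift : ∀ {n} b c (m : Msg n) → shift b (shift c m) ≡ shift (b xor c) m
shift-shift b c [] = refl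
shift-shift b c ((unknown , κ) ∷ m) = cong (_ ∷_) (shift-shift b c m)
shift-shift b c ((alive p , κ) ∷ m) = cong₂ (λ q → (alive q , κ) ∷_) (sym (xor-assoc b c p)) (shift-shift b c m)
shift-shift b c ((pend p  , κ) ∷ m) = cong₂ (λ q → (pend q , κ) ∷_) (sym (xor-assoc b c p)) (shift-shift b c m)

shift-pending : ∀ b c n → shift b (pending c n) ≡ pending (b xor c) n
shift-pending b c zero = refl
shift-pending b c (suc n) = cong ((pend (b xor c) , false) ∷_) (shift-pending b c n)

-- A combination of messages through a vertex both of whose arms are alive,
-- with an arm of either parity in front, and of the two pending messages.
record Weights : Set where
  constructor weights
  field
    even odd drop out : ℚ

open Weights public

record NonNegʷ (w : Weights) : Set where
  field
    0≤even : 0ℚ ≤ even w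
    0≤odd  : 0ℚ ≤ odd w
    0≤drop : 0ℚ ≤ drop w
    0≤out  : 0ℚ ≤ out w

open NonNegʷ public

mix : ℚ → Weights → ℚ → Weights → Weights
mix a v b w = weights (a * even v + b * even w) (a * odd v + b * odd w)
  (a * drop v + b * drop w) (a * out v + b * out w)

-- The effect of one round on an arm of parity p, if e is twice the weight of
-- loss, r that of exclusion and l that of a double loss at its end, and w the
-- weights after the round.
round : (e r l : ℚ) → Bool → Weights → Weights
round e r l false w = weights (1ℚ + e * odd w) (e * even w) (r + e * out w) (l + e * drop w)
round e r l true  w = weights (e * even w) (1ℚ + e * odd w) (l + e * drop w) (r + e * out w)

nothing : Weights
nothing = weights 0ℚ 0ℚ 0ℚ 0ℚ

iterate : ℕ → (Weights → Weights) → Weights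
iterate zero    f = nothing
iterate (suc j) f = f (iterate j f)

exclusion : (er zl nn : ℚ) → ℚ
exclusion er zl nn = er * (er + (zl + nn)) + (zl + nn) * er

round-nonneg : ∀ {e r l} → 0ℚ ≤ e → 0ℚ ≤ r → 0ℚ ≤ l → ∀ p {w} → NonNegʷ w → NonNegʷ (round e r l p w)
round-nonneg 0≤e 0≤r 0≤l false 0≤w = record
  { 0≤even = 0≤+ 0≤1 (0≤* 0≤e (0≤odd 0≤w)) ; 0≤odd = 0≤* 0≤e (0≤even 0≤w)
  ; 0≤drop = 0≤+ 0≤r (0≤* 0≤e (0≤out 0≤w)) ; 0≤out = 0≤+ 0≤l (0≤* 0≤e (0≤drop 0≤w)) }
round-nonneg 0≤e 0≤r 0≤l true 0≤w = record
  { 0≤even = 0≤* 0≤e (0≤even 0≤w) ; 0≤odd = 0≤+ 0≤1 (0≤* 0≤e (0≤odd 0≤w))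
  ; 0≤drop = 0≤+ 0≤l (0≤* 0≤e (0≤drop 0≤w)) ; 0≤out = 0≤+ 0≤r (0≤* 0≤e (0≤out 0≤w)) }

mix-nonneg : ∀ {a b v w} → 0ℚ ≤ a → NonNegʷ v → 0ℚ ≤ b → NonNegʷ w → NonNegʷ (mix a v b w)
mix-nonneg 0≤a 0≤v 0≤b 0≤w = record
  { 0≤even = 0≤+ (0≤* 0≤a (0≤even 0≤v)) (0≤* 0≤b (0≤even 0≤w))
  ; 0≤odd  = 0≤+ (0≤* 0≤a (0≤odd 0≤v)) (0≤* 0≤b (0≤odd 0≤w))
  ; 0≤drop = 0≤+ (0≤* 0≤a (0≤drop 0≤v)) (0≤* 0≤b (0≤drop 0≤w))
  ; 0≤out  = 0≤+ (0≤* 0≤a (0≤out 0≤v)) (0≤* 0≤b (0≤out 0≤w)) }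

iterate-nonneg : ∀ j {f} → (∀ {w} → NonNegʷ w → NonNegʷ (f w)) → NonNegʷ (iterate j f)
iterate-nonneg zero    0≤f = record { 0≤even = ≤-refl ; 0≤odd = ≤-refl ; 0≤drop = ≤-refl ; 0≤out = ≤-refl }
iterate-nonneg (suc j) 0≤f = 0≤f (iterate-nonneg j 0≤f)

module Evolution (side : Probability Bool) where

  open Law side

  private
    σ : Measure Bool
    σ = measure side

  fire calm : Bool → Bool → ℚ
  fire k p = ∫ σ λ o → ∫ σ λ x → isLeave (event k x (alive p , o))
  calm k p = ∫ σ λ o → ∫ σ λ x → isQuiet (event k x (alive p , o))

  0≤fire : ∀ k p → 0ℚ ≤ fire k p
  0≤fire k p = ∫-nonneg σ λ o → ∫-nonneg σ λ x → 0≤isLeave (event k x (alive p , o))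

  0≤calm : ∀ k p → 0ℚ ≤ calm k p
  0≤calm k p = ∫-nonneg σ λ o → ∫-nonneg σ λ x → 0≤isQuiet (event k x (alive p , o))

  -- An unnormalised message law described by four numbers. What happens behind the far real vertex
  -- is left to `μ`, so that a law can be bounded in terms of itself at another depth.
  ⟦_⟧ : ∀ {n} → Weights → Vec Bool n → Measure (Msg n) → (Msg n → ℚ) → ℚ
  ⟦_⟧ {n} w ks μ f = even w * ∫ (part ks false μ) f + (odd w * ∫ (part ks true μ) f +
    (drop w * f (pending false n) + out w * f (pending true n)))

  part-∷ : ∀ {n} k (ks : Vec Bool n) p μ h →
    ∫ (part (k ∷ ks) p μ) h ≡ ∫ σ λ o → ∫ (step k ks μ p) λ m → h ((alive p , o) ∷ m)
  part-∷ k ks false μ h = refl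
  part-∷ k ks true  μ h = refl

  part-mono : ∀ {n} (ks : Vec Bool n) p {μ ν f} → Test f → (∀ {h} → Test h → ∫ μ h ≤ ∫ ν h) →
    ∫ (part ks p μ) f ≤ ∫ (part ks p ν) f
  part-mono {n} ks p {μ} {ν} {f} tf μ≤ν = ∫-mono (measure (streams n)) λ l → ≤-trans
    (μ≤ν record
      { nonneg = λ a → ∫-nonneg μ λ b → nonneg tf (shift p (forward ks l a b))
      ; mono = λ a⊑a′ → ∫-mono μ λ b → mono tf (shift-mono p (forward-mono ks l a⊑a′ ⊑-refl)) })
    (∫-mono ν λ a → μ≤ν record
      { nonneg = λ b → nonneg tf (shift p (forward ks l a b))
      ; mono = λ b⊑b′ → mono tf (shift-mono p (forward-mono ks l ⊑-refl b⊑b′)) })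

  part-mass : ∀ {n} (ks : Vec Bool n) p μ → mass (part ks p μ) ≡ mass μ * mass μ
  part-mass {n} ks p μ = trans (∫-const₁ (streams n) _) (∫-const μ (mass μ))

  part-shift : ∀ {n} (ks : Vec Bool n) p μ f b →
    ∫ (part ks p μ) (f ∘ shift b) ≡ ∫ (part ks (b xor p) μ) f
  part-shift {n} ks p μ f b = ∫-cong (measure (streams n)) λ l → ∫-cong μ λ a → ∫-cong μ λ a′ →
    cong f (shift-shift b p (forward ks l a a′))

  advance-test : ∀ {n} k {f : Msg n → ℚ} → Test f →
    Test (λ (m : Msg (suc n)) → ∫ σ λ x → isQuiet (event k x (head m)) * f (tail m))
  advance-test k {f} tf = record
    { nonneg = λ m → ∫-nonneg σ λ x → 0≤* (0≤isQuiet (event k x (head m))) (nonneg tf (tail m))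
    ; mono = λ {a} a⊑b → ∫-mono σ λ x → *-mono-≤ (0≤isQuiet (event k x (head a))) (nonneg tf (tail a))
        (indicator-mono k x isQuiet 0≤isQuiet refl (head-mono a⊑b)) (mono tf (tail-mono a⊑b)) }

  part-advance : ∀ {n} k (ks : Vec Bool n) p μ f →
    ∫ (part (k ∷ ks) p μ) (λ m → ∫ σ λ x → isQuiet (event k x (head m)) * f (tail m)) ≡
    calm k p * ∫ (step k ks μ p) f
  part-advance k ks p μ f = trans
    (part-∷ k ks p μ λ m → ∫ σ λ x → isQuiet (event k x (head m)) * f (tail m)) (trans
    (∫-cong σ λ o → trans
      (∫-cong (step k ks μ p) λ m → ∫-*ʳ σ (f m) λ x → isQuiet (event k x (alive p , o)))
      (∫-* (step k ks μ p) (∫ σ λ x → isQuiet (event k x (alive p , o))) f))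
    (∫-*ʳ σ (∫ (step k ks μ p) f) λ o → ∫ σ λ x → isQuiet (event k x (alive p , o))))

  part-leave : ∀ {n} k (ks : Vec Bool n) p μ →
    ∫ (part (k ∷ ks) p μ) (λ m → ∫ σ λ x → isLeave (event k x (head m))) ≡
    fire k p * (mass μ * mass μ)
  part-leave k ks p μ = trans
    (part-∷ k ks p μ λ m → ∫ σ λ x → isLeave (event k x (head m))) (trans
    (∫-cong σ λ o → let c = ∫ σ λ x → isLeave (event k x (alive p , o)) in
      trans (∫-const (step k ks μ p) c) (cong (c *_) (mass-step k ks μ p)))
    (∫-*ʳ σ (mass μ * mass μ) λ o → ∫ σ λ x → isLeave (event k x (alive p , o))))

  -- The bound is self-similar: the law at depth `depth + d` dominates the mixture built from the
  -- law at depth `d`, for every `d`. This stands in for a fixed-point equation of a law at infinite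
  -- depth. The number `S` bounds the remaining mass, since laws are restricted to what has been
  -- quiet so far.
  record Regular {n} (ks : Vec Bool n) (S : ℚ) (w : Weights) (N : ℕ → Measure (Msg n)) : Set where
    field
      0≤S   : 0ℚ ≤ S
      0≤w   : NonNegʷ w
      grow  : ∀ d {f} → Test f → ∫ (N d) f ≤ ∫ (N (suc d)) f
      size  : ∀ d → S ≤ mass (N d)
      depth : ℕ
      lower : ∀ d {f} → Test f → ⟦ w ⟧ ks (N d) f ≤ ∫ (N (depth ℕ.+ d)) f

module Round (side : Probability Bool) where

  open Law side
  open Evolution side

  private
    σ : Measure Bool
    σ = measure side

  module Formula (k : Bool) (S : ℚ) (w : Weights) where

    -- Bounds for a quiet round and for an exclusion through one arm. The factor `S * S` is the mass
    -- of the two messages entering the real vertex at the far end of a live arm; a pending message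
    -- has no such vertex, so `out w` enters as it is.
    nn er : ℚ
    nn = (even w * calm k false + odd w * calm k true) * (S * S)
    er = out w + (even w * fire k false + odd w * fire k true) * (S * S)

    after : Bool → Weights → Weights
    after = round (drop w + drop w) (exclusion er (drop w) nn) (drop w * drop w)

    refine : Weights → Weights
    refine v = mix (even w * calm k false) (after false v) (odd w * calm k true) (after true v)

  ⟦⟧-lower : ∀ {n} {w} → NonNegʷ w → ∀ (ks : Vec Bool n) {μ f x₀ x₁ x₂ x₃} →
    x₀ ≤ ∫ (part ks false μ) f → x₁ ≤ ∫ (part ks true μ) f →
    x₂ ≤ f (pending false n) → x₃ ≤ f (pending true n) →
    even w * x₀ + (odd w * x₁ + (drop w * x₂ + out w * x₃)) ≤ ⟦ w ⟧ ks μ f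
  ⟦⟧-lower 0≤w ks p₀ p₁ p₂ p₃ = +-mono-≤ (*-monoˡ (0≤even 0≤w) p₀) (+-mono-≤
    (*-monoˡ (0≤odd 0≤w) p₁) (+-mono-≤ (*-monoˡ (0≤drop 0≤w) p₂) (*-monoˡ (0≤out 0≤w) p₃)))

  part-nonneg : ∀ {n} (ks : Vec Bool n) p μ {f} → Test f → 0ℚ ≤ ∫ (part ks p μ) f
  part-nonneg ks p μ tf = ∫-nonneg (part ks p μ) (nonneg tf)

  module _ {n k} {ks : Vec Bool n} {S w N} (R : Regular (k ∷ ks) S w N) where

    open Regular R
    open Formula k S w

    N′ : ℕ → Measure (Msg n)
    N′ d = advance k (N (depth ℕ.+ d))

    private
      0≤SS : 0ℚ ≤ S * S
      0≤SS = 0≤* 0≤S 0≤S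

      SS≤ : ∀ d → S * S ≤ mass (N d) * mass (N d)
      SS≤ d = *-mono-≤ 0≤S 0≤S (size d) (size d)

    0≤nn : 0ℚ ≤ nn
    0≤nn = 0≤* (0≤+ (0≤* (0≤even 0≤w) (0≤calm k false)) (0≤* (0≤odd 0≤w) (0≤calm k true))) 0≤SS

    0≤er : 0ℚ ≤ er
    0≤er = 0≤+ (0≤out 0≤w) (0≤* (0≤+ (0≤* (0≤even 0≤w) (0≤fire k false)) (0≤* (0≤odd 0≤w) (0≤fire k true))) 0≤SS)

    -- Among the four components of the mixture only `pending false` shows a loss at its head, and
    -- its tail is `pending false` again; the others are bounded by 0.
    drop-lower : ∀ d {ψ} → Test ψ → drop w * ψ (pending false n) ≤ loses k ks (N (depth ℕ.+ d)) ψ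
    drop-lower d {ψ} tψ = begin
      drop w * ψ (pending false n)
        ≡⟨ solve 5 (λ e o d u x → d :* x := e :* con 0ℚ :+ (o :* con 0ℚ :+ (d :* x :+ u :* con 0ℚ)))
             refl (even w) (odd w) (drop w) (out w) (ψ (pending false n)) ⟩
      even w * 0ℚ + (odd w * 0ℚ + (drop w * ψ (pending false n) + out w * 0ℚ))
        ≤⟨ ⟦⟧-lower 0≤w (k ∷ ks) {N d} {g} (part-nonneg (k ∷ ks) false (N d) test)
             (part-nonneg (k ∷ ks) true (N d) test)
             (≤-reflexive (sym (trans (∫-const₁ side _) (ℚ.*-identityˡ _))))
             (nonneg test (pending true (suc n))) ⟩
      ⟦ w ⟧ (k ∷ ks) (N d) g ≤⟨ lower d test ⟩
      loses k ks (N (depth ℕ.+ d)) ψ ∎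
      where
      open ℚ.≤-Reasoning
      g : Msg (suc n) → ℚ
      g m = ∫ σ λ x → isLose (event k x (head m)) * ψ (tail m)
      test : Test g
      test = record
        { nonneg = λ m → ∫-nonneg σ λ x → 0≤* (0≤isLose (event k x (head m))) (nonneg tψ (tail m))
        ; mono = λ {a} a⊑b → ∫-mono σ λ x → *-mono-≤ (0≤isLose (event k x (head a))) (nonneg tψ (tail a))
            (indicator-mono k x isLose 0≤isLose refl (head-mono a⊑b)) (mono tψ (tail-mono a⊑b)) }

    leave-lower : ∀ d → er ≤ leaves k ks (N (depth ℕ.+ d))
    leave-lower d = begin
      er
        ≡⟨ solve 7 (λ e o d u f f′ s → u :+ (e :* f :+ o :* f′) :* s :=
              e :* (f :* s) :+ (o :* (f′ :* s) :+ (d :* con 0ℚ :+ u :* con 1ℚ))) refl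
             (even w) (odd w) (drop w) (out w) (fire k false) (fire k true) (S * S) ⟩
      even w * (fire k false * (S * S)) + (odd w * (fire k true * (S * S)) + (drop w * 0ℚ + out w * 1ℚ))
        ≤⟨ ⟦⟧-lower 0≤w (k ∷ ks) {N d} {g} (part-bound false) (part-bound true)
             (nonneg test (pending false (suc n))) (≤-reflexive (sym (∫-const₁ side 1ℚ))) ⟩
      ⟦ w ⟧ (k ∷ ks) (N d) g ≤⟨ lower d test ⟩
      leaves k ks (N (depth ℕ.+ d)) ∎
      where
      open ℚ.≤-Reasoning
      g : Msg (suc n) → ℚ
      g m = ∫ σ λ x → isLeave (event k x (head m))
      test : Test g
      test = record
        { nonneg = λ m → ∫-nonneg σ λ x → 0≤isLeave (event k x (head m))
        ; mono = λ a⊑b → ∫-mono σ λ x → indicator-mono k x isLeave 0≤isLeave refl (head-mono a⊑b) }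
      part-bound : ∀ p → fire k p * (S * S) ≤ ∫ (part (k ∷ ks) p (N d)) g
      part-bound p = ≤-trans (*-monoˡ (0≤fire k p) (SS≤ d))
        (≤-reflexive (sym (part-leave k ks p (N d))))

    advance-lower : ∀ d {f} → Test f → ∀ {x₀ x₁} →
      x₀ ≤ ∫ (step k ks (N d) false) f → x₁ ≤ ∫ (step k ks (N d) true) f →
      even w * calm k false * x₀ + odd w * calm k true * x₁ ≤ ∫ (N′ d) f
    advance-lower d {f} tf {x₀} {x₁} p₀ p₁ = begin
      even w * calm k false * x₀ + odd w * calm k true * x₁
        ≡⟨ solve 8 (λ e o d u c c′ x x′ → e :* c :* x :+ o :* c′ :* x′ :=
              e :* (c :* x) :+ (o :* (c′ :* x′) :+ (d :* con 0ℚ :+ u :* con 0ℚ))) refl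
             (even w) (odd w) (drop w) (out w) (calm k false) (calm k true) x₀ x₁ ⟩
      even w * (calm k false * x₀) + (odd w * (calm k true * x₁) + (drop w * 0ℚ + out w * 0ℚ))
        ≤⟨ ⟦⟧-lower 0≤w (k ∷ ks) {N d} {g} (part-bound false p₀) (part-bound true p₁)
             (nonneg test (pending false (suc n))) (nonneg test (pending true (suc n))) ⟩
      ⟦ w ⟧ (k ∷ ks) (N d) g ≤⟨ lower d test ⟩
      ∫ (N′ d) f ∎
      where
      open ℚ.≤-Reasoning
      g : Msg (suc n) → ℚ
      g m = ∫ σ λ x → isQuiet (event k x (head m)) * f (tail m)
      test : Test g
      test = advance-test k tf
      part-bound : ∀ p {x} → x ≤ ∫ (step k ks (N d) p) f → calm k p * x ≤ ∫ (part (k ∷ ks) p (N d)) g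
      part-bound p x≤ = ≤-trans (*-monoˡ (0≤calm k p) x≤)
        (≤-reflexive (sym (part-advance k ks p (N d) f)))

    size′ : ∀ d → nn ≤ mass (N′ d)
    size′ d = ≤-trans
      (≤-reflexive (ℚ.*-distribʳ-+ (S * S) (even w * calm k false) (odd w * calm k true)))
      (advance-lower d record { nonneg = λ _ → 0≤1 ; mono = λ _ → ≤-refl }
        (≤-trans (SS≤ d) (≤-reflexive (sym (mass-step k ks (N d) false))))
        (≤-trans (SS≤ d) (≤-reflexive (sym (mass-step k ks (N d) true)))))

    grow′ : ∀ d {f} → Test f → ∫ (N′ d) f ≤ ∫ (N′ (suc d)) f
    grow′ d {f} tf = ≤-trans (grow (depth ℕ.+ d) (advance-test k tf))
      (≤-reflexive (cong (λ x → ∫ (advance k (N x)) f) (sym (ℕ.+-suc depth d))))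

    grow′⁺ : ∀ j d {f} → Test f → ∫ (N′ d) f ≤ ∫ (N′ (j ℕ.+ d)) f
    grow′⁺ zero    d tf = ≤-refl
    grow′⁺ (suc j) d tf = ≤-trans (grow′⁺ j d tf) (grow′ (j ℕ.+ d) tf)

    Lower : ℕ → Weights → Set
    Lower j v = ∀ d {f} → Test f → ⟦ v ⟧ ks (N′ d) f ≤ ∫ (N′ (j ℕ.+ d)) f

    -- When an arm of the far vertex is lost, the vertex passes on the message of its other arm.
    -- That message belongs to the same round and has law `N′`, to which the bound `v` applies. As
    -- `shift true` exchanges even with odd and pending false with pending true, `v` enters `after`
    -- crosswise; the factor 2 in `e` comes from the choice of the lost arm.
    round-lower : ∀ p {j v} → Lower j v → ∀ d {f} → Test f →
      ⟦ after p v ⟧ ks (N′ d) f ≤ ∫ (step k ks (N (depth ℕ.+ (j ℕ.+ d))) p) f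
    round-lower p {j} {v} Lv d {f} tf = begin
      ⟦ after p v ⟧ ks (N′ d) f
        ≡⟨ expand p ⟩
      ∫ (part ks p (N′ d)) f + (zl * Y + (Y * zl + (zl * (zl * D) + ((er * C) * (er + (zl + nn)) + ((zl + nn) * C) * er))))
        ≤⟨ +-mono-≤ (part-mono ks p {N′ d} {N′ (j ℕ.+ d)} tf (λ th → grow′⁺ j d th)) (+-mono-≤ (*-monoˡ (0≤drop 0≤w) Y≤X)
             (ℚ.+-monoˡ-≤ (zl * (zl * D) + ((er * C) * (er + (zl + nn)) + ((zl + nn) * C) * er)) (*-monoʳ (0≤drop 0≤w) Y≤X))) ⟩
      ∫ (part ks p (N′ (j ℕ.+ d))) f + (zl * X + (X * zl + (zl * (zl * D) + ((er * C) * (er + (zl + nn)) + ((zl + nn) * C) * er))))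
        ≤⟨ step-lower k ks (N (depth ℕ.+ (j ℕ.+ d))) p tf (0≤drop 0≤w) 0≤er 0≤nn
             (drop-lower (j ℕ.+ d)) (leave-lower (j ℕ.+ d)) (size′ (j ℕ.+ d)) ⟩
      ∫ (step k ks (N (depth ℕ.+ (j ℕ.+ d))) p) f ∎
      where
      open ℚ.≤-Reasoning
      zl C D X Y : ℚ
      zl = drop w
      C = f (shift p (pending false n))
      D = f (shift p (shift true (pending false n)))
      X = ∫ (N′ (j ℕ.+ d)) (f ∘ shift p ∘ shift true)
      Y = ⟦ v ⟧ ks (N′ d) (f ∘ shift p ∘ shift true)
      Y≤X : Y ≤ X
      Y≤X = Lv d record { nonneg = λ m → nonneg tf (shift p (shift true m)) ; mono = λ a⊑b → mono tf (shift-mono p (shift-mono true a⊑b)) }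
      expand : ∀ p → ⟦ after p v ⟧ ks (N′ d) f ≡
        (let Y = ⟦ v ⟧ ks (N′ d) (f ∘ shift p ∘ shift true)
             C = f (shift p (pending false n))
             D = f (shift p (shift true (pending false n)))
         in ∫ (part ks p (N′ d)) f + (zl * Y + (Y * zl + (zl * (zl * D) + ((er * C) * (er + (zl + nn)) + ((zl + nn) * C) * er)))))
      expand false
        rewrite part-shift ks false (N′ d) (f ∘ shift false) true | part-shift ks true (N′ d) (f ∘ shift false) true
              | part-shift ks false (N′ d) f false | part-shift ks true (N′ d) f false
              | shift-pending true false n | shift-pending true true n
              | shift-pending false false n | shift-pending false true n =
        solve 11 (λ ve vo vd vu P₀ P₁ FL FR z r s →
            (con 1ℚ :+ (z :+ z) :* vo) :* P₀ :+ (((z :+ z) :* ve) :* P₁ :+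
            (((r :* (r :+ (z :+ s)) :+ (z :+ s) :* r) :+ (z :+ z) :* vu) :* FL :+ (z :* z :+ (z :+ z) :* vd) :* FR)) :=
            P₀ :+ (z :* (ve :* P₁ :+ (vo :* P₀ :+ (vd :* FR :+ vu :* FL))) :+
            ((ve :* P₁ :+ (vo :* P₀ :+ (vd :* FR :+ vu :* FL))) :* z :+ (z :* (z :* FR) :+
            ((r :* FL) :* (r :+ (z :+ s)) :+ ((z :+ s) :* FL) :* r))))) refl
          (even v) (odd v) (drop v) (out v) (∫ (part ks false (N′ d)) f) (∫ (part ks true (N′ d)) f)
          (f (pending false n)) (f (pending true n)) zl er nn
      expand true
        rewrite part-shift ks false (N′ d) (f ∘ shift true) true | part-shift ks true (N′ d) (f ∘ shift true) true
              | part-shift ks false (N′ d) f true | part-shift ks true (N′ d) f true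
              | shift-pending true false n | shift-pending true true n
              | shift-pending true false n =
        solve 11 (λ ve vo vd vu P₀ P₁ FL FR z r s →
            ((z :+ z) :* ve) :* P₀ :+ ((con 1ℚ :+ (z :+ z) :* vo) :* P₁ :+
            ((z :* z :+ (z :+ z) :* vd) :* FL :+ ((r :* (r :+ (z :+ s)) :+ (z :+ s) :* r) :+ (z :+ z) :* vu) :* FR)) :=
            P₁ :+ (z :* (ve :* P₀ :+ (vo :* P₁ :+ (vd :* FL :+ vu :* FR))) :+
            ((ve :* P₀ :+ (vo :* P₁ :+ (vd :* FL :+ vu :* FR))) :* z :+ (z :* (z :* FL) :+
            ((r :* FR) :* (r :+ (z :+ s)) :+ ((z :+ s) :* FR) :* r))))) refl
          (even v) (odd v) (drop v) (out v) (∫ (part ks false (N′ d)) f) (∫ (part ks true (N′ d)) f)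
          (f (pending false n)) (f (pending true n)) zl er nn

    -- From one bound on `N′` another is obtained, at the cost of `depth` further levels. A fixed
    -- point of `refine` would account for chains of mergers of any length; starting at zero, each
    -- iteration allows for one more.
    refine-lower : ∀ {j v} → Lower j v → Lower (depth ℕ.+ j) (refine v)
    refine-lower {j} {v} Lv d {f} tf = begin
      ⟦ refine v ⟧ ks (N′ d) f
        ≡⟨ solve 14 (λ a b e o d u e′ o′ d′ u′ P₀ P₁ FL FR →
              (a :* e :+ b :* e′) :* P₀ :+ ((a :* o :+ b :* o′) :* P₁ :+ ((a :* d :+ b :* d′) :* FL :+ (a :* u :+ b :* u′) :* FR)) :=
              a :* (e :* P₀ :+ (o :* P₁ :+ (d :* FL :+ u :* FR))) :+ b :* (e′ :* P₀ :+ (o′ :* P₁ :+ (d′ :* FL :+ u′ :* FR)))) refl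
             (even w * calm k false) (odd w * calm k true)
             (even (after false v)) (odd (after false v)) (drop (after false v)) (out (after false v))
             (even (after true v)) (odd (after true v)) (drop (after true v)) (out (after true v))
             (∫ (part ks false (N′ d)) f) (∫ (part ks true (N′ d)) f) (f (pending false n)) (f (pending true n)) ⟩
      even w * calm k false * ⟦ after false v ⟧ ks (N′ d) f + odd w * calm k true * ⟦ after true v ⟧ ks (N′ d) f
        ≤⟨ advance-lower (depth ℕ.+ (j ℕ.+ d)) tf (round-lower false {j} {v} Lv d tf) (round-lower true {j} {v} Lv d tf) ⟩
      ∫ (N′ (depth ℕ.+ (j ℕ.+ d))) f
        ≡⟨ cong (λ x → ∫ (N′ x) f) (sym (ℕ.+-assoc depth j d)) ⟩
      ∫ (N′ (depth ℕ.+ j ℕ.+ d)) f ∎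
      where
      open ℚ.≤-Reasoning

    refine-nonneg : ∀ {v} → NonNegʷ v → NonNegʷ (refine v)
    refine-nonneg 0≤v = mix-nonneg (0≤* (0≤even 0≤w) (0≤calm k false)) (after-nonneg false)
      (0≤* (0≤odd 0≤w) (0≤calm k true)) (after-nonneg true)
      where
      after-nonneg : ∀ p → NonNegʷ (after p _)
      after-nonneg p = round-nonneg (0≤+ (0≤drop 0≤w) (0≤drop 0≤w))
        (0≤+ (0≤* 0≤er (0≤+ 0≤er (0≤+ (0≤drop 0≤w) 0≤nn))) (0≤* (0≤+ (0≤drop 0≤w) 0≤nn) 0≤er))
        (0≤* (0≤drop 0≤w) (0≤drop 0≤w)) p 0≤v

    iterate-depth : ℕ → ℕ
    iterate-depth zero    = zero
    iterate-depth (suc j) = depth ℕ.+ iterate-depth j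

    iterate-lower : ∀ j → Lower (iterate-depth j) (iterate j refine)
    iterate-lower zero d {f} tf = ≤-trans
      (≤-reflexive (solve 4 (λ a b c d → con 0ℚ :* a :+ (con 0ℚ :* b :+ (con 0ℚ :* c :+ con 0ℚ :* d)) := con 0ℚ) refl
        (∫ (part ks false (N′ d)) f) (∫ (part ks true (N′ d)) f) (f (pending false n)) (f (pending true n))))
      (∫-nonneg (N′ d) (nonneg tf))
    iterate-lower (suc j) = refine-lower {iterate-depth j} (iterate-lower j)

    evolve : ∀ J → Regular ks nn (iterate J refine) N′
    evolve J = record
      { 0≤S = 0≤nn ; 0≤w = iterate-nonneg J refine-nonneg ; grow = grow′ ; size = size′
      ; depth = iterate-depth J ; lower = iterate-lower J }

-- The probability of being selected

cases₃ : (e f g : Event) (r ab ac bc : Bool) → ℚ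
cases₃ e f g r ab ac bc =
  isQuiet e * (isQuiet f * (isQuiet g * χ r)) + (isLose e * (isQuiet f * (isQuiet g * χ bc)) +
    (isQuiet e * (isLose f * (isQuiet g * χ ac)) + isQuiet e * (isQuiet f * (isLose g * χ ab))))

cases₃≤decide₃′ : ∀ e f g r ab ac bc → cases₃ e f g r ab ac bc ≤ χ (decide₃′ e f g r ab ac bc)
cases₃≤decide₃′ = from-yes (every-case? λ e f g r ab ac bc →
  cases₃ e f g r ab ac bc ℚ.≤? χ (decide₃′ e f g r ab ac bc))

χ-mono : ∀ {b c} → (b ≡ true → c ≡ true) → χ b ≤ χ c
χ-mono {false} {c} h = 0≤χ c
χ-mono {true}  {c} h rewrite h refl = ≤-refl

decide₂-testʳ : ∀ {n} (ks : Vec Bool n) a → Test (λ b → χ (decide₂ ks a b))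
decide₂-testʳ ks a = record
  { nonneg = λ b → 0≤χ (decide₂ ks a b) ; mono = λ b⊑b′ → χ-mono (decide₂-mono ks ⊑-refl b⊑b′) }

module Selection (side : Probability Bool) where

  open Law side
  open Evolution side
  open Round side

  private
    σ : Measure Bool
    σ = measure side

  V₃ : ∀ {n} → Vec Bool n → Measure (Msg n) → ℚ
  V₃ {n} ks μ = ∫ (measure (streams n)) λ l → ∫ μ λ a → ∫ μ λ b → ∫ μ λ c → χ (decide₃ ks l a b c)

  V₂ : ∀ {n} → Vec Bool n → Bool → Bool → Measure (Msg n) → ℚ
  V₂ ks p q μ = ∫ (part ks p μ) λ a → ∫ (part ks q μ) λ b → χ (decide₂ ks a b)

  V₃-mono : ∀ {n} (ks : Vec Bool n) {μ ν} → (∀ {h} → Test h → ∫ μ h ≤ ∫ ν h) → V₃ ks μ ≤ V₃ ks ν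
  V₃-mono {n} ks {μ} {ν} μ≤ν = ∫-mono (measure (streams n)) λ l → ≤-trans
    (μ≤ν record
      { nonneg = λ a → ∫-nonneg μ λ b → ∫-nonneg μ λ c → 0≤χ (decide₃ ks l a b c)
      ; mono = λ a → ∫-mono μ λ b → ∫-mono μ λ c → χ-mono (decide₃-mono ks l a ⊑-refl ⊑-refl) })
    (∫-mono ν λ a → ≤-trans
      (μ≤ν record
        { nonneg = λ b → ∫-nonneg μ λ c → 0≤χ (decide₃ ks l a b c)
        ; mono = λ b → ∫-mono μ λ c → χ-mono (decide₃-mono ks l ⊑-refl b ⊑-refl) })
      (∫-mono ν λ b → μ≤ν record
        { nonneg = λ c → 0≤χ (decide₃ ks l a b c)
        ; mono = λ c → χ-mono (decide₃-mono ks l ⊑-refl ⊑-refl c) }))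

  module _ {n} (k : Bool) (ks : Vec Bool n) (μ : Measure (Msg (suc n))) where

    private
      ev : Bool → Msg (suc n) → Event
      ev x a = event k x (head a)

      ν : Measure (Msg n)
      ν = advance k μ

      W : ℚ
      W = ∫ ν λ a → ∫ ν λ b → χ (decide₂ ks a b)

      L : ℚ
      L = ∫ μ λ a → ∫ σ λ x → isLose (ev x a)

      T : Set
      T = Bool × Bool × Bool × Vec Coins n × Msg (suc n) × Msg (suc n) × Msg (suc n)

      Fun : Set
      Fun = Bool → Bool → Bool → Vec Coins n → Msg (suc n) → Msg (suc n) → Msg (suc n) → ℚ

      on : Fun → T → ℚ
      on h (x , y , z , l , a , b , c) = h x y z l a b c

      joint : Measure T
      joint = σ >>= λ x → σ >>= λ y → σ >>= λ z → measure (streams n) >>= λ l →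
        μ >>= λ a → μ >>= λ b → μ >>= λ c → dirac (x , y , z , l , a , b , c)

      reorder₃ : ∀ (h : Fun) → ∫ joint (on h) ≡
        ∫ (measure (streams n)) λ l → ∫ μ λ a → ∫ σ λ x → ∫ μ λ b → ∫ σ λ y → ∫ μ λ c → ∫ σ λ z → h x y z l a b c
      reorder₃ h = trans
        (∫-cong σ λ x → trans
          (∫-cong σ λ y → commutes side
            (measure (streams n) >>= λ l → μ >>= λ a → μ >>= λ b → μ >>= λ c → dirac (l , a , b , c))
            (λ { z (l , a , b , c) → h x y z l a b c }))
          (commutes side
            (measure (streams n) >>= λ l → μ >>= λ a → μ >>= λ b → dirac (l , a , b))
            (λ { y (l , a , b) → ∫ μ λ c → ∫ σ λ z → h x y z l a b c })))
        (commutes side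
          (measure (streams n) >>= λ l → μ >>= λ a → dirac (l , a))
          (λ { x (l , a) → ∫ μ λ b → ∫ σ λ y → ∫ μ λ c → ∫ σ λ z → h x y z l a b c }))

      μσ : Measure (Bool × Msg (suc n))
      μσ = μ >>= λ a → σ >>= λ x → dirac (x , a)

      pull : ∀ k (f : Bool → Msg (suc n) → ℚ) → (∫ μ λ a → ∫ σ λ x → k * f x a) ≡ k * ∫ μ λ a → ∫ σ λ x → f x a
      pull k f = ∫-* μσ k λ { (x , a) → f x a }

      pullʳ : ∀ k (f : Bool → Msg (suc n) → ℚ) → (∫ μ λ a → ∫ σ λ x → f x a * k) ≡ (∫ μ λ a → ∫ σ λ x → f x a) * k
      pullʳ k f = ∫-*ʳ μσ k λ { (x , a) → f x a }

      cong-μσ : ∀ {f g : Bool → Msg (suc n) → ℚ} → (∀ x a → f x a ≡ g x a) →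
        (∫ μ λ a → ∫ σ λ x → f x a) ≡ (∫ μ λ a → ∫ σ λ x → g x a)
      cong-μσ f≡g = ∫-cong μ λ a → ∫-cong σ λ x → f≡g x a

      h₀ h₁ h₂ h₃ : Fun
      h₀ x y z l a b c = isQuiet (ev x a) * (isQuiet (ev y b) * (isQuiet (ev z c) *
        χ (decide₃ ks l (tail a) (tail b) (tail c))))
      h₁ x y z l a b c = isLose (ev x a) * (isQuiet (ev y b) * (isQuiet (ev z c) *
        χ (decide₂ ks (tail b) (tail c))))
      h₂ x y z l a b c = isQuiet (ev x a) * (isLose (ev y b) * (isQuiet (ev z c) *
        χ (decide₂ ks (tail a) (tail c))))
      h₃ x y z l a b c = isQuiet (ev x a) * (isQuiet (ev y b) * (isLose (ev z c) *
        χ (decide₂ ks (tail a) (tail b))))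

      e₀ : ∫ joint (on h₀) ≡ V₃ ks ν
      e₀ = trans (reorder₃ h₀) (∫-cong (measure (streams n)) λ l → cong-μσ λ x a → trans
        (cong-μσ λ y b → trans (pull (isQuiet (ev x a)) _)
          (cong (isQuiet (ev x a) *_) (pull (isQuiet (ev y b)) _)))
        (pull (isQuiet (ev x a)) _))

      e₁ : ∫ joint (on h₁) ≡ L * W
      e₁ = trans (reorder₃ h₁) (trans
        (∫-cong (measure (streams n)) λ l → trans
          (cong-μσ λ x a → trans
            (cong-μσ λ y b → trans (pull (isLose (ev x a)) _)
              (cong (isLose (ev x a) *_) (pull (isQuiet (ev y b)) _)))
            (pull (isLose (ev x a)) _))
          (pullʳ W λ x a → isLose (ev x a)))
        (∫-const₁ (streams n) (L * W)))

      e₂ : ∫ joint (on h₂) ≡ L * W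
      e₂ = trans (reorder₃ h₂) (trans
        (∫-cong (measure (streams n)) λ l → trans
          (cong-μσ λ x a → let I = ∫ ν λ c → χ (decide₂ ks (tail a) c) in trans
            (cong-μσ λ y b → trans (pull (isQuiet (ev x a)) _)
              (cong (isQuiet (ev x a) *_) (pull (isLose (ev y b)) _)))
            (trans (pull (isQuiet (ev x a)) _) (trans
              (cong (isQuiet (ev x a) *_) (pullʳ I λ y b → isLose (ev y b)))
              (solve 3 (λ q l i → q :* (l :* i) := l :* (q :* i)) refl (isQuiet (ev x a)) L I))))
          (pull L λ x a → isQuiet (ev x a) * ∫ ν λ c → χ (decide₂ ks (tail a) c)))
        (∫-const₁ (streams n) (L * W)))

      e₃ : ∫ joint (on h₃) ≡ L * W
      e₃ = trans (reorder₃ h₃) (trans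
        (∫-cong (measure (streams n)) λ l → trans
          (cong-μσ λ x a → let I = ∫ ν λ b → χ (decide₂ ks (tail a) b) in trans
            (cong-μσ λ y b → let D = χ (decide₂ ks (tail a) (tail b)) in trans
              (pull (isQuiet (ev x a)) _)
              (trans (cong (isQuiet (ev x a) *_) (trans (pull (isQuiet (ev y b)) _)
                (cong (isQuiet (ev y b) *_) (pullʳ D λ z c → isLose (ev z c)))))
              (solve 4 (λ q q′ l d → q :* (q′ :* (l :* d)) := (q :* l) :* (q′ :* d)) refl
                (isQuiet (ev x a)) (isQuiet (ev y b)) L D)))
            (trans (pull (isQuiet (ev x a) * L) _)
              (solve 3 (λ q l i → (q :* l) :* i := l :* (q :* i)) refl (isQuiet (ev x a)) L I)))
          (pull L λ x a → isQuiet (ev x a) * ∫ ν λ b → χ (decide₂ ks (tail a) b)))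
        (∫-const₁ (streams n) (L * W)))

    -- Either the vertex stays real, or exactly one of its three arms is lost and the other two
    -- judge it as a smoothed vertex. The three choices of the lost arm have equal weight `L * W`,
    -- by independence.
    V₃-step : V₃ ks ν + (L * W + (L * W + L * W)) ≤ V₃ (k ∷ ks) μ
    V₃-step = begin
      V₃ ks ν + (L * W + (L * W + L * W))
        ≡⟨ sym (cong₂ _+_ e₀ (cong₂ _+_ e₁ (cong₂ _+_ e₂ e₃))) ⟩
      ∫ joint (on h₀) + (∫ joint (on h₁) + (∫ joint (on h₂) + ∫ joint (on h₃)))
        ≡⟨ sym (trans (∫-+ joint (on h₀) _) (cong (_+_ (∫ joint (on h₀)))
             (trans (∫-+ joint (on h₁) _) (cong (_+_ (∫ joint (on h₁))) (∫-+ joint (on h₂) (on h₃)))))) ⟩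
      ∫ joint (λ t → on h₀ t + (on h₁ t + (on h₂ t + on h₃ t)))
        ≤⟨ ∫-mono joint (λ { (x , y , z , l , a , b , c) → cases₃≤decide₃′ (ev x a) (ev y b) (ev z c)
             (decide₃ ks l (tail a) (tail b) (tail c)) (decide₂ ks (tail a) (tail b))
             (decide₂ ks (tail a) (tail c)) (decide₂ ks (tail b) (tail c)) }) ⟩
      V₃ (k ∷ ks) μ ∎
      where open ℚ.≤-Reasoning

-- Bookkeeping for smoothed vertices

record Pairs : Set where
  constructor pairs
  field
    ee eo oe oo : ℚ

open Pairs public

record NonNegᵖ (m : Pairs) : Set where
  field
    0≤ee : 0ℚ ≤ ee m
    0≤eo : 0ℚ ≤ eo m
    0≤oe : 0ℚ ≤ oe m
    0≤oo : 0ℚ ≤ oo m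

open NonNegᵖ public

infixr 6 _⊞_
infixr 7 _⊡_ _⊠_

_⊞_ : Pairs → Pairs → Pairs
a ⊞ b = pairs (ee a + ee b) (eo a + eo b) (oe a + oe b) (oo a + oo b)

_⊡_ : ℚ → Pairs → Pairs
c ⊡ a = pairs (c * ee a) (c * eo a) (c * oe a) (c * oo a)

_⊠_ : Weights → Weights → Pairs
v ⊠ w = pairs (even v * even w) (even v * odd w) (odd v * even w) (odd v * odd w)

⊞-nonneg : ∀ {a b} → NonNegᵖ a → NonNegᵖ b → NonNegᵖ (a ⊞ b)
⊞-nonneg p q = record { 0≤ee = 0≤+ (0≤ee p) (0≤ee q) ; 0≤eo = 0≤+ (0≤eo p) (0≤eo q)
                      ; 0≤oe = 0≤+ (0≤oe p) (0≤oe q) ; 0≤oo = 0≤+ (0≤oo p) (0≤oo q) }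

⊡-nonneg : ∀ {c a} → 0ℚ ≤ c → NonNegᵖ a → NonNegᵖ (c ⊡ a)
⊡-nonneg p q = record { 0≤ee = 0≤* p (0≤ee q) ; 0≤eo = 0≤* p (0≤eo q)
                      ; 0≤oe = 0≤* p (0≤oe q) ; 0≤oo = 0≤* p (0≤oo q) }

⊠-nonneg : ∀ {v w} → NonNegʷ v → NonNegʷ w → NonNegᵖ (v ⊠ w)
⊠-nonneg p q = record
  { 0≤ee = 0≤* (0≤even p) (0≤even q) ; 0≤eo = 0≤* (0≤even p) (0≤odd q)
  ; 0≤oe = 0≤* (0≤odd p) (0≤even q) ; 0≤oo = 0≤* (0≤odd p) (0≤odd q) }

-- The selection that is immediate for a smoothed vertex with arms of weights v and w.
now : (S : ℚ) → Weights → Weights → ℚ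
now S v w = (drop v * (even w + odd w) + (even v + odd v) * drop w) * (S * S) + drop v * drop w

module Gain (side : Probability Bool) where

  open Law side
  open Evolution side
  open Round side
  open Selection side

  private
    σ : Measure Bool
    σ = measure side

  -- The coefficients are the weights with which the observed vertex is by now smoothed, sorted by
  -- the parities of its two arms; they include the weight of having come this far.
  ΣV₂ : ∀ {n} → Pairs → Vec Bool n → Measure (Msg n) → ℚ
  ΣV₂ m ks μ = ee m * V₂ ks false false μ + (eo m * V₂ ks false true μ +
    (oe m * V₂ ks true false μ + oo m * V₂ ks true true μ))

  ΣV₂-⊞ : ∀ {n} a b (ks : Vec Bool n) μ → ΣV₂ (a ⊞ b) ks μ ≡ ΣV₂ a ks μ + ΣV₂ b ks μ
  ΣV₂-⊞ a b ks μ = solve 12 (λ p q r s p′ q′ r′ s′ P Q R S →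
    (p :+ p′) :* P :+ ((q :+ q′) :* Q :+ ((r :+ r′) :* R :+ (s :+ s′) :* S)) :=
    (p :* P :+ (q :* Q :+ (r :* R :+ s :* S))) :+ (p′ :* P :+ (q′ :* Q :+ (r′ :* R :+ s′ :* S)))) refl
    (ee a) (eo a) (oe a) (oo a) (ee b) (eo b) (oe b) (oo b)
    (V₂ ks false false μ) (V₂ ks false true μ) (V₂ ks true false μ) (V₂ ks true true μ)

  ΣV₂-⊡ : ∀ {n} c a (ks : Vec Bool n) μ → ΣV₂ (c ⊡ a) ks μ ≡ c * ΣV₂ a ks μ
  ΣV₂-⊡ c a ks μ = solve 9 (λ c p q r s P Q R S →
    (c :* p) :* P :+ ((c :* q) :* Q :+ ((c :* r) :* R :+ (c :* s) :* S)) :=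
    c :* (p :* P :+ (q :* Q :+ (r :* R :+ s :* S)))) refl
    c (ee a) (eo a) (oe a) (oo a)
    (V₂ ks false false μ) (V₂ ks false true μ) (V₂ ks true false μ) (V₂ ks true true μ)

  V₂-nonneg : ∀ {n} (ks : Vec Bool n) p q μ → 0ℚ ≤ V₂ ks p q μ
  V₂-nonneg ks p q μ = ∫-nonneg (part ks p μ) λ a → ∫-nonneg (part ks q μ) λ b → 0≤χ (decide₂ ks a b)

  ΣV₂-nonneg : ∀ {n m} → NonNegᵖ m → ∀ (ks : Vec Bool n) μ → 0ℚ ≤ ΣV₂ m ks μ
  ΣV₂-nonneg 0≤m ks μ = 0≤+ (0≤* (0≤ee 0≤m) (V₂-nonneg ks false false μ))
    (0≤+ (0≤* (0≤eo 0≤m) (V₂-nonneg ks false true μ))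
    (0≤+ (0≤* (0≤oe 0≤m) (V₂-nonneg ks true false μ)) (0≤* (0≤oo 0≤m) (V₂-nonneg ks true true μ))))

  V₃-nonneg : ∀ {n} (ks : Vec Bool n) μ → 0ℚ ≤ V₃ ks μ
  V₃-nonneg {n} ks μ = ∫-nonneg (measure (streams n)) λ l → ∫-nonneg μ λ a → ∫-nonneg μ λ b →
    ∫-nonneg μ λ c → 0≤χ (decide₃ ks l a b c)

  ⟪_,_⟫ : ∀ {n} → Weights → Weights → Vec Bool n → Measure (Msg n) → ℚ
  ⟪ v , w ⟫ ks μ = ⟦ v ⟧ ks μ λ a → ⟦ w ⟧ ks μ λ b → χ (decide₂ ks a b)

  ⟦⟧-mono : ∀ {n w} → NonNegʷ w → ∀ (ks : Vec Bool n) μ {f g} → (∀ a → f a ≤ g a) → ⟦ w ⟧ ks μ f ≤ ⟦ w ⟧ ks μ g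
  ⟦⟧-mono 0≤w ks μ {f} {g} f≤g = ⟦⟧-lower 0≤w ks {μ} {g} (∫-mono (part ks false μ) f≤g)
    (∫-mono (part ks true μ) f≤g) (f≤g (pending false _)) (f≤g (pending true _))

  ⟦⟧-testˡ : ∀ {n w} → NonNegʷ w → ∀ (ks : Vec Bool n) μ → Test λ a → ⟦ w ⟧ ks μ λ b → χ (decide₂ ks a b)
  ⟦⟧-testˡ {w = w} 0≤w ks μ = record
    { nonneg = λ a → 0≤+ (0≤* (0≤even 0≤w) (∫-nonneg (part ks false μ) λ b → 0≤χ (decide₂ ks a b)))
        (0≤+ (0≤* (0≤odd 0≤w) (∫-nonneg (part ks true μ) λ b → 0≤χ (decide₂ ks a b)))
        (0≤+ (0≤* (0≤drop 0≤w) (0≤χ (decide₂ ks a (pending false _))))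
             (0≤* (0≤out 0≤w) (0≤χ (decide₂ ks a (pending true _))))))
    ; mono = λ a⊑a′ → ⟦⟧-mono 0≤w ks μ λ b → χ-mono (decide₂-mono ks a⊑a′ (⊑-refl {a = b})) }

  -- A pending arm settles the vertex in the coming round: `pending false` selects it against a live
  -- arm or another `pending false`, which gives `now`, and `pending true` contributes nothing. Two
  -- live arms stay in `ΣV₂`. A round `k` must be left in which the pending state is read.
  ⟪⟫-lower : ∀ {n v w} → NonNegʷ v → NonNegʷ w → ∀ k (ks : Vec Bool n) μ {S} → 0ℚ ≤ S → S ≤ mass μ →
    ΣV₂ (v ⊠ w) (k ∷ ks) μ + now S v w ≤ ⟪ v , w ⟫ (k ∷ ks) μ
  ⟪⟫-lower {n} {v} {w} 0≤v 0≤w k ks μ {S} 0≤S S≤ = begin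
    ΣV₂ (v ⊠ w) (k ∷ ks) μ + now S v w
      ≡⟨ solve 11 (λ e o d e′ o′ d′ s A B C D →
           ((e :* e′) :* A :+ ((e :* o′) :* B :+ ((o :* e′) :* C :+ (o :* o′) :* D))) :+
             ((d :* (e′ :+ o′) :+ (e :+ o) :* d′) :* s :+ d :* d′) :=
           e :* (e′ :* A :+ (o′ :* B :+ d′ :* s)) :+ (o :* (e′ :* C :+ (o′ :* D :+ d′ :* s)) :+
             d :* (e′ :* s :+ (o′ :* s :+ d′)))) refl
           (even v) (odd v) (drop v) (even w) (odd w) (drop w) (S * S)
           (V₂ (k ∷ ks) false false μ) (V₂ (k ∷ ks) false true μ)
           (V₂ (k ∷ ks) true false μ) (V₂ (k ∷ ks) true true μ) ⟩
    even v * row false + (odd v * row true + drop v * (even w * (S * S) + (odd w * (S * S) + drop w)))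
      ≡⟨ solve 4 (λ a b c u → a :+ (b :+ c) := a :+ (b :+ (c :+ u :* con 0ℚ))) refl
           (even v * row false) (odd v * row true) (drop v * (even w * (S * S) + (odd w * (S * S) + drop w))) (out v) ⟩
    even v * row false + (odd v * row true + (drop v * (even w * (S * S) + (odd w * (S * S) + drop w)) + out v * 0ℚ))
      ≤⟨ ⟦⟧-lower 0≤v (k ∷ ks) {μ} {G} (row-lower false) (row-lower true) drop-lower′
           (nonneg (⟦⟧-testˡ 0≤w (k ∷ ks) μ) (pending true (suc n))) ⟩
    ⟪ v , w ⟫ (k ∷ ks) μ ∎
    where
    open ℚ.≤-Reasoning
    G : Msg (suc n) → ℚ
    G a = ⟦ w ⟧ (k ∷ ks) μ λ b → χ (decide₂ (k ∷ ks) a b)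
    row : Bool → ℚ
    row p = even w * V₂ (k ∷ ks) p false μ + (odd w * V₂ (k ∷ ks) p true μ + drop w * (S * S))
    SS≤ : ∀ p → S * S ≤ mass (part (k ∷ ks) p μ)
    SS≤ p = ≤-trans (*-mono-≤ 0≤S 0≤S S≤ S≤) (≤-reflexive (sym (part-mass (k ∷ ks) p μ)))
    pend-right : ∀ p → S * S ≤ ∫ (part (k ∷ ks) p μ) λ a → χ (decide₂ (k ∷ ks) a (pending false (suc n)))
    pend-right p = ≤-trans (SS≤ p) (≤-reflexive (trans (part-∷ k ks p μ λ _ → 1ℚ)
      (sym (part-∷ k ks p μ λ a → χ (decide₂ (k ∷ ks) a (pending false (suc n)))))))
    pend-left : ∀ p → S * S ≤ ∫ (part (k ∷ ks) p μ) λ b → χ (decide₂ (k ∷ ks) (pending false (suc n)) b)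
    pend-left p = ≤-trans (SS≤ p) (≤-reflexive (trans (part-∷ k ks p μ λ _ → 1ℚ)
      (sym (part-∷ k ks p μ λ b → χ (decide₂ (k ∷ ks) (pending false (suc n)) b)))))
    row-lower : ∀ p → row p ≤ ∫ (part (k ∷ ks) p μ) G
    row-lower p = ≤-trans
      (ℚ.+-monoʳ-≤ (even w * V₂ (k ∷ ks) p false μ) (ℚ.+-monoʳ-≤ (odd w * V₂ (k ∷ ks) p true μ)
        (≤-trans (≤-reflexive (sym (ℚ.+-identityʳ (drop w * (S * S)))))
          (+-mono-≤ (*-monoˡ (0≤drop 0≤w) (pend-right p))
            (0≤* (0≤out 0≤w) (∫-nonneg M λ a → 0≤χ (decide₂ (k ∷ ks) a (pending true (suc n)))))))))
      (≤-reflexive (sym (trans (∫-+ M g₀ λ a → g₁ a + (g₂ a + g₃ a)) (cong₂ _+_ (∫-* M (even w) f₀)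
        (trans (∫-+ M g₁ λ a → g₂ a + g₃ a) (cong₂ _+_ (∫-* M (odd w) f₁)
        (trans (∫-+ M g₂ g₃) (cong₂ _+_ (∫-* M (drop w) f₂) (∫-* M (out w) f₃)))))))))
      where
      M : Measure (Msg (suc n))
      M = part (k ∷ ks) p μ
      f₀ f₁ f₂ f₃ g₀ g₁ g₂ g₃ : Msg (suc n) → ℚ
      f₀ a = ∫ (part (k ∷ ks) false μ) λ b → χ (decide₂ (k ∷ ks) a b)
      f₁ a = ∫ (part (k ∷ ks) true μ) λ b → χ (decide₂ (k ∷ ks) a b)
      f₂ a = χ (decide₂ (k ∷ ks) a (pending false (suc n)))
      f₃ a = χ (decide₂ (k ∷ ks) a (pending true (suc n)))
      g₀ a = even w * f₀ a
      g₁ a = odd w * f₁ a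
      g₂ a = drop w * f₂ a
      g₃ a = out w * f₃ a
    drop-lower′ : even w * (S * S) + (odd w * (S * S) + drop w) ≤ G (pending false (suc n))
    drop-lower′ = ≤-trans
      (≤-reflexive (solve 5 (λ a b d u s → a :+ (b :+ d) := a :+ (b :+ (d :* con 1ℚ :+ u :* con 0ℚ))) refl
        (even w * (S * S)) (odd w * (S * S)) (drop w) (out w) S))
      (⟦⟧-lower 0≤w (k ∷ ks) {μ} {λ b → χ (decide₂ (k ∷ ks) (pending false (suc n)) b)}
        (pend-left false) (pend-left true) ≤-refl ≤-refl)

module GainBound (side : Probability Bool) (J : ℕ) where

  open Law side
  open Evolution side
  open Round side
  open Selection side
  open Gain side

  private
    σ : Measure Bool
    σ = measure side

    outcome : Bool → Event
    outcome b = if b then leave else quiet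

    outcome-cases : ∀ b c d → χ (if b then c else d) ≡ isLeave (outcome b) * χ c + isQuiet (outcome b) * χ d
    outcome-cases true  c d = solve 2 (λ c d → c := con 1ℚ :* c :+ con 0ℚ :* d) refl (χ c) (χ d)
    outcome-cases false c d = solve 2 (λ c d → d := con 0ℚ :* c :+ con 1ℚ :* d) refl (χ c) (χ d)

  module _ {n} (k : Bool) (ks : Vec Bool n) (μ : Measure (Msg (suc n))) where

    pair-step : Bool → Bool → ℚ
    pair-step p q = ∫ (step k ks μ p) λ a → ∫ (step k ks μ q) λ b → χ (decide₂ ks a b)

    -- The two pieces of arm and the vertex between them form one arm of parity `not (p xor q)`. Its
    -- firing depends only on the two end coins, which are independent of the rest of both messages;
    -- this gives an exact formula.
    V₂-step : ∀ p q → V₂ (k ∷ ks) p q μ ≡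
      fire k (not (p xor q)) * (χ (not p ∧ not q) * ((mass μ * mass μ) * (mass μ * mass μ))) +
      calm k (not (p xor q)) * pair-step p q
    V₂-step p q = begin
      V₂ (k ∷ ks) p q μ
        ≡⟨ trans (part-∷ k ks p μ λ a → ∫ (part (k ∷ ks) q μ) λ b → χ (decide₂ (k ∷ ks) a b))
             (∫-cong σ λ o → ∫-cong P λ a → part-∷ k ks q μ λ b → χ (decide₂ (k ∷ ks) ((alive p , o) ∷ a) b)) ⟩
      (∫ σ λ o → ∫ P λ a → ∫ σ λ x → ∫ Q λ b → χ (if fires k odd? o x then both else decide₂ ks a b))
        ≡⟨ (∫-cong σ λ o → sym (commutes side P λ x a →
              ∫ Q λ b → χ (if fires k odd? o x then both else decide₂ ks a b))) ⟩
      (∫ σ λ o → ∫ σ λ x → ∫ P λ a → ∫ Q λ b → χ (if fires k odd? o x then both else decide₂ ks a b))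
        ≡⟨ (∫-cong σ λ o → ∫-cong σ λ x → inner o x) ⟩
      (∫ σ λ o → ∫ σ λ x → isLeave (outcome (fires k odd? x o)) * (χ both * M) + isQuiet (outcome (fires k odd? x o)) * pair-step p q)
        ≡⟨ (∫-+ σσ (λ { (o , x) → isLeave (outcome (fires k odd? x o)) * (χ both * M) })
              (λ { (o , x) → isQuiet (outcome (fires k odd? x o)) * pair-step p q })) ⟩
      (∫ σ λ o → ∫ σ λ x → isLeave (outcome (fires k odd? x o)) * (χ both * M)) +
      (∫ σ λ o → ∫ σ λ x → isQuiet (outcome (fires k odd? x o)) * pair-step p q)
        ≡⟨ cong₂ _+_ (∫-*ʳ σσ (χ both * M) λ { (o , x) → isLeave (outcome (fires k odd? x o)) })
             (∫-*ʳ σσ (pair-step p q) λ { (o , x) → isQuiet (outcome (fires k odd? x o)) }) ⟩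
      fire k odd? * (χ both * M) + calm k odd? * pair-step p q ∎
      where
      open ≡-Reasoning
      odd? both : Bool
      odd? = not (p xor q)
      both = not p ∧ not q
      P Q : Measure (Msg n)
      P = step k ks μ p
      Q = step k ks μ q
      M : ℚ
      M = (mass μ * mass μ) * (mass μ * mass μ)
      σσ : Measure (Bool × Bool)
      σσ = σ >>= λ o → σ >>= λ x → dirac (o , x)
      PQ : Measure (Msg n × Msg n)
      PQ = P >>= λ a → Q >>= λ b → dirac (a , b)
      mass-PQ : mass PQ ≡ M
      mass-PQ = trans (∫-const P (mass Q)) (trans (cong₂ _*_ (mass-step k ks μ q) (mass-step k ks μ p)) refl)
      inner : ∀ o x → (∫ P λ a → ∫ Q λ b → χ (if fires k odd? o x then both else decide₂ ks a b)) ≡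
        isLeave (outcome (fires k odd? x o)) * (χ both * M) + isQuiet (outcome (fires k odd? x o)) * pair-step p q
      inner o x rewrite fires-comm k odd? o x = trans
        (∫-cong PQ {g = λ { (a , b) → A * χ both + B * χ (decide₂ ks a b) }}
          λ { (a , b) → outcome-cases (fires k odd? x o) both (decide₂ ks a b) })
        (trans (∫-+ PQ (λ _ → A * χ both) λ { (a , b) → B * χ (decide₂ ks a b) })
          (cong₂ _+_
            (trans (∫-const PQ (A * χ both)) (trans (cong (A * χ both *_) mass-PQ) (ℚ.*-assoc A (χ both) M)))
            (∫-* PQ B λ { (a , b) → χ (decide₂ ks a b) })))
        where
        A B : ℚ
        A = isLeave (outcome (fires k odd? x o))
        B = isQuiet (outcome (fires k odd? x o))

  value : ∀ {n} → Vec Bool n → Pairs → Measure (Msg n) → ℚ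
  value ks m μ = V₃ ks μ + ΣV₂ m ks μ

  value-nonneg : ∀ {n m} → NonNegᵖ m → ∀ (ks : Vec Bool n) μ → 0ℚ ≤ value ks m μ
  value-nonneg 0≤m ks μ = 0≤+ (V₃-nonneg ks μ) (ΣV₂-nonneg 0≤m ks μ)

  module Transition (k : Bool) (S : ℚ) (w : Weights) (m : Pairs) where

    open Formula k S w public

    w′ u₀ u₁ : Weights
    w′ = iterate J refine
    u₀ = after false w′
    u₁ = after true w′

    c₀₀ c₀₁ c₁₀ c₁₁ c : ℚ
    c₀₀ = calm k true * ee m
    c₀₁ = calm k false * eo m
    c₁₀ = calm k false * oe m
    c₁₁ = calm k true * oo m
    c = drop w + (drop w + drop w)

    -- The first four summands carry an already smoothed vertex through a round in which its arm
    -- does not fire, with both pieces updated by `after`. The last one adds a vertex smoothed in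
    -- this round: any of its three arms may be the lost one, whence `c`, and its two other messages
    -- have weights `w′`.
    m′ : Pairs
    m′ = c₀₀ ⊡ u₀ ⊠ u₀ ⊞ c₀₁ ⊡ u₀ ⊠ u₁ ⊞ c₁₀ ⊡ u₁ ⊠ u₀ ⊞ c₁₁ ⊡ u₁ ⊠ u₁ ⊞ c ⊡ w′ ⊠ w′

    selected : ℚ
    -- Even pieces on both sides of the vertex make an odd arm; when this fires, the alternation
    -- selects the vertex.
    selected = fire k true * (ee m * ((S * S) * (S * S))) +
      (c₀₀ * now nn u₀ u₀ + (c₀₁ * now nn u₀ u₁ + (c₁₀ * now nn u₁ u₀ +
        (c₁₁ * now nn u₁ u₁ + c * now nn w′ w′))))

  -- Arms may merge with arms that merge in the same round, and so on: J bounds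
  -- the number of such mergers that are taken into account.
  gain : ∀ {n} → Vec Bool n → ℚ → Weights → Pairs → ℚ
  gain [] S w m = 0ℚ
  gain (k ∷ []) S w m = 0ℚ
  gain (k ∷ k′ ∷ ks) S w m = selected + gain (k′ ∷ ks) nn w′ m′
    where open Transition k S w m

  -- Truncation depths add up: `depth` for the bound on `N`, `j` for the mergers of this round, and
  -- `D` for the later rounds.
  gain-step : ∀ {n k k′} {ks : Vec Bool n} {S w N m} (R : Regular (k ∷ k′ ∷ ks) S w N) → NonNegᵖ m →
    let open Transition k S w m in
    (∀ {N′} → Regular (k′ ∷ ks) nn w′ N′ → NonNegᵖ m′ →
      ∃[ D ] (∀ d → gain (k′ ∷ ks) nn w′ m′ ≤ value (k′ ∷ ks) m′ (N′ (D ℕ.+ d)))) →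
    ∃[ D ] (∀ d → gain (k ∷ k′ ∷ ks) S w m ≤ value (k ∷ k′ ∷ ks) m (N (D ℕ.+ d)))
  gain-step {n} {k} {k′} {ks} {S} {w} {N} {m} R 0≤m hyp =
    depth ℕ.+ (j ℕ.+ D) , λ d → subst (λ x → gain (k ∷ k′ ∷ ks) S w m ≤ value (k ∷ k′ ∷ ks) m (N x))
      (trans (cong (depth ℕ.+_) (sym (ℕ.+-assoc j D d))) (sym (ℕ.+-assoc depth (j ℕ.+ D) d)))
      (≤-trans (ℚ.+-monoʳ-≤ selected (proj₂ rec d)) (transition (D ℕ.+ d)))
    where
    open Regular R
    open Transition k S w m
    R′ : Regular (k′ ∷ ks) nn w′ (N′ R)
    R′ = evolve R J
    0≤w′ : NonNegʷ w′
    0≤w′ = Regular.0≤w R′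
    j : ℕ
    j = iterate-depth R J
    0≤u : ∀ p → NonNegʷ (after p w′)
    0≤u p = round-nonneg (0≤+ (0≤drop 0≤w) (0≤drop 0≤w))
      (0≤+ (0≤* (0≤er R) (0≤+ (0≤er R) (0≤+ (0≤drop 0≤w) (0≤nn R)))) (0≤* (0≤+ (0≤drop 0≤w) (0≤nn R)) (0≤er R)))
      (0≤* (0≤drop 0≤w) (0≤drop 0≤w)) p 0≤w′
    0≤c : 0ℚ ≤ c
    0≤c = 0≤+ (0≤drop 0≤w) (0≤+ (0≤drop 0≤w) (0≤drop 0≤w))
    0≤c₀₀ : 0ℚ ≤ c₀₀
    0≤c₀₀ = 0≤* (0≤calm k true) (0≤ee 0≤m)
    0≤c₀₁ : 0ℚ ≤ c₀₁
    0≤c₀₁ = 0≤* (0≤calm k false) (0≤eo 0≤m)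
    0≤c₁₀ : 0ℚ ≤ c₁₀
    0≤c₁₀ = 0≤* (0≤calm k false) (0≤oe 0≤m)
    0≤c₁₁ : 0ℚ ≤ c₁₁
    0≤c₁₁ = 0≤* (0≤calm k true) (0≤oo 0≤m)
    0≤m′ : NonNegᵖ m′
    0≤m′ = ⊞-nonneg (⊡-nonneg 0≤c₀₀ (⊠-nonneg (0≤u false) (0≤u false)))
      (⊞-nonneg (⊡-nonneg 0≤c₀₁ (⊠-nonneg (0≤u false) (0≤u true)))
      (⊞-nonneg (⊡-nonneg 0≤c₁₀ (⊠-nonneg (0≤u true) (0≤u false)))
      (⊞-nonneg (⊡-nonneg 0≤c₁₁ (⊠-nonneg (0≤u true) (0≤u true)))
      (⊡-nonneg 0≤c (⊠-nonneg 0≤w′ 0≤w′)))))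
    rec : ∃[ D ] (∀ d → gain (k′ ∷ ks) nn w′ m′ ≤ value (k′ ∷ ks) m′ (N′ R (D ℕ.+ d)))
    rec = hyp R′ 0≤m′
    D : ℕ
    D = proj₁ rec
    transition : ∀ d → selected + value (k′ ∷ ks) m′ (N′ R d) ≤ value (k ∷ k′ ∷ ks) m (N (depth ℕ.+ (j ℕ.+ d)))
    transition d = begin
      selected + value (k′ ∷ ks) m′ ν
        ≡⟨ cong (λ z → selected + (V₃ (k′ ∷ ks) ν + z)) expand ⟩
      selected + (V₃ (k′ ∷ ks) ν + (c₀₀ * E u₀ u₀ + (c₀₁ * E u₀ u₁ + (c₁₀ * E u₁ u₀ + (c₁₁ * E u₁ u₁ + c * E w′ w′)))))
        ≡⟨ rearrange ⟩
      (V₃ (k′ ∷ ks) ν + c * (E w′ w′ + now nn w′ w′)) +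
        ((fire k true * (ee m * ((S * S) * (S * S))) + c₀₀ * (E u₀ u₀ + now nn u₀ u₀)) +
        (c₀₁ * (E u₀ u₁ + now nn u₀ u₁) + (c₁₀ * (E u₁ u₀ + now nn u₁ u₀) + c₁₁ * (E u₁ u₁ + now nn u₁ u₁))))
        ≤⟨ +-mono-≤ V₃-lower (+-mono-≤ pair-lower₀ (+-mono-≤ (pair-lower false true (0≤eo 0≤m) refl)
             (+-mono-≤ (pair-lower true false (0≤oe 0≤m) refl) (pair-lower true true (0≤oo 0≤m) refl)))) ⟩
      V₃ (k ∷ k′ ∷ ks) μ + (ee m * V₂ (k ∷ k′ ∷ ks) false false μ + (eo m * V₂ (k ∷ k′ ∷ ks) false true μ +
        (oe m * V₂ (k ∷ k′ ∷ ks) true false μ + oo m * V₂ (k ∷ k′ ∷ ks) true true μ))) ∎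
      where
      open ℚ.≤-Reasoning
      μ : Measure (Msg _)
      μ = N (depth ℕ.+ (j ℕ.+ d))
      ν : Measure (Msg _)
      ν = N′ R d
      E : Weights → Weights → ℚ
      E v u = ΣV₂ (v ⊠ u) (k′ ∷ ks) ν
      expand : ΣV₂ m′ (k′ ∷ ks) ν ≡ c₀₀ * E u₀ u₀ + (c₀₁ * E u₀ u₁ + (c₁₀ * E u₁ u₀ + (c₁₁ * E u₁ u₁ + c * E w′ w′)))
      expand =
        trans (ΣV₂-⊞ (c₀₀ ⊡ u₀ ⊠ u₀) _ (k′ ∷ ks) ν) (cong₂ _+_ (ΣV₂-⊡ c₀₀ (u₀ ⊠ u₀) (k′ ∷ ks) ν)
        (trans (ΣV₂-⊞ (c₀₁ ⊡ u₀ ⊠ u₁) _ (k′ ∷ ks) ν) (cong₂ _+_ (ΣV₂-⊡ c₀₁ (u₀ ⊠ u₁) (k′ ∷ ks) ν)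
        (trans (ΣV₂-⊞ (c₁₀ ⊡ u₁ ⊠ u₀) _ (k′ ∷ ks) ν) (cong₂ _+_ (ΣV₂-⊡ c₁₀ (u₁ ⊠ u₀) (k′ ∷ ks) ν)
        (trans (ΣV₂-⊞ (c₁₁ ⊡ u₁ ⊠ u₁) (c ⊡ w′ ⊠ w′) (k′ ∷ ks) ν) (cong₂ _+_
          (ΣV₂-⊡ c₁₁ (u₁ ⊠ u₁) (k′ ∷ ks) ν) (ΣV₂-⊡ c (w′ ⊠ w′) (k′ ∷ ks) ν))))))))
      rearrange : selected + (V₃ (k′ ∷ ks) ν + (c₀₀ * E u₀ u₀ + (c₀₁ * E u₀ u₁ + (c₁₀ * E u₁ u₀ + (c₁₁ * E u₁ u₁ + c * E w′ w′))))) ≡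
        (V₃ (k′ ∷ ks) ν + c * (E w′ w′ + now nn w′ w′)) +
        ((fire k true * (ee m * ((S * S) * (S * S))) + c₀₀ * (E u₀ u₀ + now nn u₀ u₀)) +
        (c₀₁ * (E u₀ u₁ + now nn u₀ u₁) + (c₁₀ * (E u₁ u₀ + now nn u₁ u₀) + c₁₁ * (E u₁ u₁ + now nn u₁ u₁))))
      rearrange = solve 17
        (λ a b c d e f v A B C D F A′ B′ C′ D′ F′ →
          (f :+ (a :* A′ :+ (b :* B′ :+ (c :* C′ :+ (d :* D′ :+ e :* F′))))) :+
            (v :+ (a :* A :+ (b :* B :+ (c :* C :+ (d :* D :+ e :* F))))) :=
          (v :+ e :* (F :+ F′)) :+ ((f :+ a :* (A :+ A′)) :+
            (b :* (B :+ B′) :+ (c :* (C :+ C′) :+ d :* (D :+ D′))))) refl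
        c₀₀ c₀₁ c₁₀ c₁₁ c (fire k true * (ee m * ((S * S) * (S * S)))) (V₃ (k′ ∷ ks) ν)
        (E u₀ u₀) (E u₀ u₁) (E u₁ u₀) (E u₁ u₁) (E w′ w′)
        (now nn u₀ u₀) (now nn u₀ u₁) (now nn u₁ u₀) (now nn u₁ u₁) (now nn w′ w′)
      X : Bool → Bool → ℚ
      X p q = E (after p w′) (after q w′) + now nn (after p w′) (after q w′)
      X≤ : ∀ p q → X p q ≤ pair-step k (k′ ∷ ks) μ p q
      X≤ p q = ≤-trans (⟪⟫-lower (0≤u p) (0≤u q) k′ ks ν (0≤nn R) (size′ R d)) (≤-trans
        (round-lower R p {j} {w′} (iterate-lower R J) d (⟦⟧-testˡ (0≤u q) (k′ ∷ ks) ν))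
        (∫-mono (step k (k′ ∷ ks) μ p) λ a →
          round-lower R q {j} {w′} (iterate-lower R J) d (decide₂-testʳ (k′ ∷ ks) a)))
      SS≤ : (S * S) * (S * S) ≤ (mass μ * mass μ) * (mass μ * mass μ)
      SS≤ = *-mono-≤ (0≤* 0≤S 0≤S) (0≤* 0≤S 0≤S) S²≤ S²≤
        where
        S²≤ : S * S ≤ mass μ * mass μ
        S²≤ = *-mono-≤ 0≤S 0≤S (size (depth ℕ.+ (j ℕ.+ d))) (size (depth ℕ.+ (j ℕ.+ d)))
      V₂-lower : ∀ p q → fire k (not (p xor q)) * (χ (not p ∧ not q) * ((S * S) * (S * S))) +
        calm k (not (p xor q)) * X p q ≤ V₂ (k ∷ k′ ∷ ks) p q μ
      V₂-lower p q = ≤-trans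
        (+-mono-≤ (*-monoˡ (0≤fire k (not (p xor q))) (*-monoˡ (0≤χ (not p ∧ not q)) SS≤))
          (*-monoˡ (0≤calm k (not (p xor q))) (X≤ p q)))
        (≤-reflexive (sym (V₂-step k (k′ ∷ ks) μ p q)))
      pair-lower : ∀ p q {a} → 0ℚ ≤ a → not p ∧ not q ≡ false →
        (calm k (not (p xor q)) * a) * X p q ≤ a * V₂ (k ∷ k′ ∷ ks) p q μ
      pair-lower p q {a} 0≤a unselected = ≤-trans
        (≤-reflexive (solve 5 (λ f g a x s → (g :* a) :* x := a :* (f :* (con 0ℚ :* s) :+ g :* x)) refl
          (fire k (not (p xor q))) (calm k (not (p xor q))) a (X p q) ((S * S) * (S * S))))
        (*-monoˡ 0≤a (subst (λ b → fire k (not (p xor q)) * (χ b * ((S * S) * (S * S))) +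
          calm k (not (p xor q)) * X p q ≤ V₂ (k ∷ k′ ∷ ks) p q μ) unselected (V₂-lower p q)))
      pair-lower₀ : fire k true * (ee m * ((S * S) * (S * S))) + c₀₀ * X false false ≤ ee m * V₂ (k ∷ k′ ∷ ks) false false μ
      pair-lower₀ = ≤-trans
        (≤-reflexive (solve 5 (λ f g a x s → f :* (a :* s) :+ (g :* a) :* x := a :* (f :* (con 1ℚ :* s) :+ g :* x)) refl
          (fire k true) (calm k true) (ee m) (X false false) ((S * S) * (S * S))))
        (*-monoˡ (0≤ee 0≤m) (V₂-lower false false))
      Y : ℚ
      Y = E w′ w′ + now nn w′ w′
      μ′ : Measure (Msg _)
      μ′ = N′ R (j ℕ.+ d)
      W L : ℚ
      W = ∫ μ′ λ a → ∫ μ′ λ b → χ (decide₂ (k′ ∷ ks) a b)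
      L = ∫ μ λ a → ∫ σ λ x → isLose (event k x (head a))
      Y≤W : Y ≤ W
      Y≤W = ≤-trans (⟪⟫-lower 0≤w′ 0≤w′ k′ ks ν (0≤nn R) (size′ R d)) (≤-trans
        (iterate-lower R J d (⟦⟧-testˡ 0≤w′ (k′ ∷ ks) ν))
        (∫-mono μ′ λ a → iterate-lower R J d (decide₂-testʳ (k′ ∷ ks) a)))
      0≤W : 0ℚ ≤ W
      0≤W = ∫-nonneg μ′ λ a → ∫-nonneg μ′ λ b → 0≤χ (decide₂ (k′ ∷ ks) a b)
      drop≤L : drop w ≤ L
      drop≤L = subst₂ _≤_ (ℚ.*-identityʳ (drop w))
        (∫-cong μ λ a → ∫-cong σ λ x → ℚ.*-identityʳ (isLose (event k x (head a))))
        (drop-lower R (j ℕ.+ d) {λ _ → 1ℚ} record { nonneg = λ _ → 0≤1 ; mono = λ _ → ≤-refl })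
      dropY≤LW : drop w * Y ≤ L * W
      dropY≤LW = ≤-trans (*-monoˡ (0≤drop 0≤w) Y≤W) (*-monoʳ 0≤W drop≤L)
      V₃-lower : V₃ (k′ ∷ ks) ν + c * Y ≤ V₃ (k ∷ k′ ∷ ks) μ
      V₃-lower = begin
        V₃ (k′ ∷ ks) ν + c * Y
          ≡⟨ solve 3 (λ v z y → v :+ (z :+ (z :+ z)) :* y := v :+ (z :* y :+ (z :* y :+ z :* y))) refl
               (V₃ (k′ ∷ ks) ν) (drop w) Y ⟩
        V₃ (k′ ∷ ks) ν + (drop w * Y + (drop w * Y + drop w * Y))
          ≤⟨ +-mono-≤ (V₃-mono (k′ ∷ ks) {ν} {μ′} λ th → grow′⁺ R j d th)
               (+-mono-≤ dropY≤LW (+-mono-≤ dropY≤LW dropY≤LW)) ⟩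
        V₃ (k′ ∷ ks) μ′ + (L * W + (L * W + L * W)) ≤⟨ V₃-step k (k′ ∷ ks) μ ⟩
        V₃ (k ∷ k′ ∷ ks) μ ∎

  -- With at most one round left there is no later round in which a pending state could be read, so
  -- the recursion stops with the trivial bound 0.
  gain-bound : ∀ {n} (ks : Vec Bool n) {S w N m} → Regular ks S w N → NonNegᵖ m →
    ∃[ D ] (∀ d → gain ks S w m ≤ value ks m (N (D ℕ.+ d)))
  gain-bound [] {N = N} R 0≤m = 0 , λ d → value-nonneg 0≤m [] (N d)
  gain-bound (k ∷ []) {N = N} R 0≤m = 0 , λ d → value-nonneg 0≤m (k ∷ []) (N d)
  gain-bound (k ∷ k′ ∷ ks) R 0≤m = gain-step R 0≤m λ {N′} → gain-bound (k′ ∷ ks) {N = N′}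

-- Evaluation from below, in multiples of 1 / D

ι : ℕ → ℚ
ι x = ℚ.mkℚ (+ x) 0 (Coprime.sym (Coprime.1-coprimeTo x))

ι-+ : ∀ x y → ι (x ℕ.+ y) ≡ ι x + ι y
ι-+ x y = ℚ.toℚᵘ-injective (ℚᵘ.≃-trans
  (ℚᵘ.*≡* (cong (ℤ._* + 1) (sym (cong₂ ℤ._+_ (ℤ.*-identityʳ (+ x)) (ℤ.*-identityʳ (+ y))))))
  (ℚᵘ.≃-sym (ℚ.toℚᵘ-homo-+ (ι x) (ι y))))

ι-* : ∀ x y → ι (x ℕ.* y) ≡ ι x * ι y
ι-* x y = ℚ.toℚᵘ-injective (ℚᵘ.≃-trans
  (ℚᵘ.*≡* (cong (ℤ._* + 1) (ℤ.pos-* x y)))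
  (ℚᵘ.≃-sym (ℚ.toℚᵘ-homo-* (ι x) (ι y))))

ι-mono : ∀ {x y} → x ℕ.≤ y → ι x ≤ ι y
ι-mono {x} {y} x≤y = ℚ.*≤* (subst₂ ℤ._≤_ (sym (ℤ.*-identityʳ (+ x))) (sym (ℤ.*-identityʳ (+ y))) (ℤ.+≤+ x≤y))

0≤ι : ∀ x → 0ℚ ≤ ι x
0≤ι x = ι-mono {0} ℕ.z≤n

ι-positive : ∀ x .{{_ : ℕ.NonZero x}} → ℚ.Positive (ι x)
ι-positive (suc _) = _

module FixedPoint (D : ℕ) .{{D≢0 : ℕ.NonZero D}} where

  infixl 6 _+̂_
  infixl 7 _*̂_
  infixr 1 _!_

  -- `gain` consists of sums and products of nonnegative numbers, so rounding down always errs on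
  -- the safe side, however the errors accumulate.
  record Below (q : ℚ) : Set where
    constructor _by_
    field
      approx : ℕ
      bound : ι approx ≤ q * ι D

  open Below public

  -- Call by value: otherwise the type checker accumulates unevaluated terms.
  _!_ : ∀ {p q} → Below p → (Below p → Below q) → Below q
  x ! f = force (approx x) λ _ → f x

  private
    instance
      ιD>0 : ℚ.Positive (ι D)
      ιD>0 = ι-positive D

  zeroᴮ : Below 0ℚ
  zeroᴮ = 0 by ≤-reflexive (sym (ℚ.*-zeroˡ (ι D)))

  oneᴮ : Below 1ℚ
  oneᴮ = D by ≤-reflexive (sym (ℚ.*-identityˡ (ι D)))

  _+̂_ : ∀ {p q} → Below p → Below q → Below (p + q)
  _+̂_ {p} {q} (x by x≲p) (y by y≲q) = (x ℕ.+ y) by subst₂ _≤_ (sym (ι-+ x y)) (sym (ℚ.*-distribʳ-+ (ι D) p q))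
    (+-mono-≤ x≲p y≲q)

  _*̂_ : ∀ {p q} → Below p → Below q → Below (p * q)
  _*̂_ {p} {q} (x by x≲p) (y by y≲q) = ((x ℕ.* y) ℕ./ D) by ℚ.*-cancelʳ-≤-pos (ι D) (begin
    ι ((x ℕ.* y) ℕ./ D) * ι D ≡⟨ sym (ι-* ((x ℕ.* y) ℕ./ D) D) ⟩
    ι ((x ℕ.* y) ℕ./ D ℕ.* D) ≤⟨ ι-mono (ℕ.m/n*n≤m (x ℕ.* y) D) ⟩
    ι (x ℕ.* y)               ≡⟨ ι-* x y ⟩
    ι x * ι y                 ≤⟨ *-mono-≤ (0≤ι x) (0≤ι y) x≲p y≲q ⟩
    (p * ι D) * (q * ι D)     ≡⟨ solve 3 (λ p q d → (p :* d) :* (q :* d) := ((p :* q) :* d) :* d) refl p q (ι D) ⟩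
    ((p * q) * ι D) * ι D     ∎)
    where open ℚ.≤-Reasoning

  cancelᴮ : ∀ {q} a b (x : Below q) → a ℕ.* D ℕ.≤ b ℕ.* approx x → ι a ≤ ι b * q
  cancelᴮ {q} a b (x by x≲q) aD≤bx = ℚ.*-cancelʳ-≤-pos (ι D) (begin
    ι a * ι D       ≡⟨ sym (ι-* a D) ⟩
    ι (a ℕ.* D)     ≤⟨ ι-mono aD≤bx ⟩
    ι (b ℕ.* x)     ≡⟨ ι-* b x ⟩
    ι b * ι x       ≤⟨ *-monoˡ (0≤ι b) x≲q ⟩
    ι b * (q * ι D) ≡⟨ sym (ℚ.*-assoc (ι b) q (ι D)) ⟩
    (ι b * q) * ι D ∎)
    where open ℚ.≤-Reasoning

  -- A fraction whose denominator divides `D` is represented without rounding; this serves the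
  -- probabilities of the coins.
  multipleᴮ : ∀ a e b {q} → D ≡ e ℕ.* b → ι a ≡ q * ι b → Below q
  multipleᴮ a e b {q} D≡eb a≡qb = (a ℕ.* e) by ≤-reflexive (begin
    ι (a ℕ.* e)     ≡⟨ ι-* a e ⟩
    ι a * ι e       ≡⟨ cong (_* ι e) a≡qb ⟩
    (q * ι b) * ι e ≡⟨ ℚ.*-assoc q (ι b) (ι e) ⟩
    q * (ι b * ι e) ≡⟨ cong (q *_) (sym (trans (cong ι D≡eb) (trans (ι-* e b) (ℚ.*-comm (ι e) (ι b))))) ⟩
    q * ι D         ∎)
    where open ≡-Reasoning

  record Belowʷ (w : Weights) : Set where
    constructor weightsᴮ
    field
      evenᴮ : Below (even w)
      oddᴮ  : Below (odd w)
      dropᴮ : Below (drop w)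
      outᴮ  : Below (out w)

  open Belowʷ public

  -- Upwards from iteration `i` and in continuation style, so that the four weights are numerals
  -- before the next iteration, which uses each of them several times.
  iterateᴮ : ∀ {p₀ p₁ pe pr pl q} → Below p₀ → Below p₁ → Below pe → Below pr → Below pl →
    let f = λ v → mix p₀ (round pe pr pl false v) p₁ (round pe pr pl true v) in
    ∀ j i → Belowʷ (iterate i f) → (Belowʷ (iterate (i ℕ.+ j) f) → Below q) → Below q
  iterateᴮ d₀ d₁ e r l zero i w κ rewrite ℕ.+-identityʳ i = κ w
  iterateᴮ d₀ d₁ e r l (suc j) i (weightsᴮ a b c d) κ rewrite ℕ.+-suc i j =
    d₀ *̂ (oneᴮ +̂ e *̂ b) +̂ d₁ *̂ (e *̂ a) ! λ a′ →
    d₀ *̂ (e *̂ a) +̂ d₁ *̂ (oneᴮ +̂ e *̂ b) ! λ b′ →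
    d₀ *̂ (r +̂ e *̂ d) +̂ d₁ *̂ (l +̂ e *̂ c) ! λ c′ →
    d₀ *̂ (l +̂ e *̂ c) +̂ d₁ *̂ (r +̂ e *̂ d) ! λ d′ →
    iterateᴮ d₀ d₁ e r l j (suc i) (weightsᴮ a′ b′ c′ d′) κ

  sum₅ : ∀ {p₀ p₁ p₂ p₃ p₄ q₀ q₁ q₂ q₃ q₄} →
    Below p₀ → Below p₁ → Below p₂ → Below p₃ → Below p₄ →
    Below q₀ → Below q₁ → Below q₂ → Below q₃ → Below q₄ →
    Below (p₀ * q₀ + (p₁ * q₁ + (p₂ * q₂ + (p₃ * q₃ + p₄ * q₄))))
  sum₅ w₀ w₁ w₂ w₃ w₄ x₀ x₁ x₂ x₃ x₄ =
    w₀ *̂ x₀ +̂ (w₁ *̂ x₁ +̂ (w₂ *̂ x₂ +̂ (w₃ *̂ x₃ +̂ w₄ *̂ x₄)))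

  nowᴮ : ∀ {S v w} → Below S → Belowʷ v → Belowʷ w → Below (now S v w)
  nowᴮ s (weightsᴮ a b c _) (weightsᴮ a′ b′ c′ _) =
    (c *̂ (a′ +̂ b′) +̂ (a +̂ b) *̂ c′) *̂ (s *̂ s) +̂ c *̂ c′

  module _ (side : Probability Bool) (J : ℕ)
    (fireᴮ : ∀ k p → Below (Evolution.fire side k p))
    (calmᴮ : ∀ k p → Below (Evolution.calm side k p)) where

    open GainBound side J using (gain)

    gain-stepᴮ : ∀ {n} k k′ (ks : Vec Bool n) →
      (∀ {S w m} → Below S → Belowʷ w → Below (ee m) → Below (eo m) → Below (oe m) → Below (oo m) →
        Below (gain (k′ ∷ ks) S w m)) →
      ∀ {S w m} → Below S → Belowʷ w → Below (ee m) → Below (eo m) → Below (oe m) → Below (oo m) →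
        Below (gain (k ∷ k′ ∷ ks) S w m)
    gain-stepᴮ k k′ ks rec {S} {w} {m} s (weightsᴮ a b c d) m₀₀ m₀₁ m₁₀ m₁₁ =
      a *̂ calmᴮ k false ! λ d₀ →
      b *̂ calmᴮ k true ! λ d₁ →
      (d₀ +̂ d₁) *̂ (s *̂ s) ! λ nn →
      d +̂ (a *̂ fireᴮ k false +̂ b *̂ fireᴮ k true) *̂ (s *̂ s) ! λ er →
      c +̂ c ! λ e →
      er *̂ (er +̂ (c +̂ nn)) +̂ (c +̂ nn) *̂ er ! λ r →
      c *̂ c ! λ l →
      iterateᴮ d₀ d₁ e r l J 0 (weightsᴮ zeroᴮ zeroᴮ zeroᴮ zeroᴮ) λ w′ →
      let a′ = evenᴮ w′ ; b′ = oddᴮ w′ ; c′ = dropᴮ w′ ; d′ = outᴮ w′ in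
      -- The weights `u₁` are those of `u₀` with even and odd, and drop and out, exchanged; four
      -- numbers serve for both.
      oneᴮ +̂ e *̂ b′ ! λ x₁ →
      e *̂ a′ ! λ x₀ →
      r +̂ e *̂ d′ ! λ y₀ →
      l +̂ e *̂ c′ ! λ y₁ →
      calmᴮ k true *̂ m₀₀ ! λ w₀ →
      calmᴮ k false *̂ m₀₁ ! λ w₁ →
      calmᴮ k false *̂ m₁₀ ! λ w₂ →
      calmᴮ k true *̂ m₁₁ ! λ w₃ →
      c +̂ (c +̂ c) ! λ w₄ →
      fireᴮ k true *̂ (m₀₀ *̂ ((s *̂ s) *̂ (s *̂ s))) +̂
        sum₅ w₀ w₁ w₂ w₃ w₄
          (nowᴮ nn (weightsᴮ x₁ x₀ y₀ y₁) (weightsᴮ x₁ x₀ y₀ y₁))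
          (nowᴮ nn (weightsᴮ x₁ x₀ y₀ y₁) (weightsᴮ x₀ x₁ y₁ y₀))
          (nowᴮ nn (weightsᴮ x₀ x₁ y₁ y₀) (weightsᴮ x₁ x₀ y₀ y₁))
          (nowᴮ nn (weightsᴮ x₀ x₁ y₁ y₀) (weightsᴮ x₀ x₁ y₁ y₀))
          (nowᴮ nn w′ w′) ! λ g →
      sum₅ w₀ w₁ w₂ w₃ w₄ (x₁ *̂ x₁) (x₁ *̂ x₀) (x₀ *̂ x₁) (x₀ *̂ x₀) (a′ *̂ a′) ! λ m₀₀′ →
      sum₅ w₀ w₁ w₂ w₃ w₄ (x₁ *̂ x₀) (x₁ *̂ x₁) (x₀ *̂ x₀) (x₀ *̂ x₁) (a′ *̂ b′) ! λ m₀₁′ →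
      sum₅ w₀ w₁ w₂ w₃ w₄ (x₀ *̂ x₁) (x₀ *̂ x₀) (x₁ *̂ x₁) (x₁ *̂ x₀) (b′ *̂ a′) ! λ m₁₀′ →
      sum₅ w₀ w₁ w₂ w₃ w₄ (x₀ *̂ x₀) (x₀ *̂ x₁) (x₁ *̂ x₀) (x₁ *̂ x₁) (b′ *̂ b′) ! λ m₁₁′ →
      rec nn w′ m₀₀′ m₀₁′ m₁₀′ m₁₁′ ! λ rest →
      g +̂ rest

    gainᴮ : ∀ {n} (ks : Vec Bool n) {S w m} → Below S → Belowʷ w →
      Below (ee m) → Below (eo m) → Below (oe m) → Below (oo m) → Below (gain ks S w m)
    gainᴮ [] s w m₀₀ m₀₁ m₁₀ m₁₁ = zeroᴮ
    gainᴮ (k ∷ []) s w m₀₀ m₀₁ m₁₀ m₁₁ = zeroᴮ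
    gainᴮ (k ∷ k′ ∷ ks) = gain-stepᴮ k k′ ks (λ {S} {w} {m} → gainᴮ (k′ ∷ ks) {S} {w} {m})

-- The numerical instance

side : Probability Bool
-- A small probability makes simultaneous events at a vertex rare; those that select nothing are
-- lost for the bound.
side = coin (+ 1 / 300) (ℚ.nonNegative⁻¹ (+ 1 / 300)) (ℚ.nonNegative⁻¹ (1ℚ - + 1 / 300))

module _ (J : ℕ) where

  open Evolution side
  open GainBound side J

  total-gain : ∀ {n} → Vec Bool n → ℚ
  total-gain ks = gain ks 1ℚ (weights 1ℚ 0ℚ 0ℚ 0ℚ) (pairs 0ℚ 0ℚ 0ℚ 0ℚ)

  module _ (D unit : ℕ) (D≡ : D ≡ unit ℕ.* 90000) {{_ : ℕ.NonZero D}} where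

    open FixedPoint D

    fireᴮ : ∀ k p → Below (fire k p)
    fireᴮ true  false = multipleᴮ 1 unit 90000 {fire true false} D≡ refl
    fireᴮ true  true  = multipleᴮ 0 unit 90000 {fire true true} D≡ refl
    fireᴮ false false = multipleᴮ 0 unit 90000 {fire false false} D≡ refl
    -- Of the 300² equally likely outcomes of two coins, 299² = 89401 leave an odd arm quiet and the
    -- other 599 let it fire. In a kick, a single outcome makes an even arm fire.
    fireᴮ false true  = multipleᴮ 599 unit 90000 {fire false true} D≡ refl

    calmᴮ : ∀ k p → Below (calm k p)
    calmᴮ true  false = multipleᴮ 89999 unit 90000 {calm true false} D≡ refl
    calmᴮ true  true  = multipleᴮ 90000 unit 90000 {calm true true} D≡ refl
    calmᴮ false false = multipleᴮ 90000 unit 90000 {calm false false} D≡ refl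
    calmᴮ false true  = multipleᴮ 89401 unit 90000 {calm false true} D≡ refl

    total-gainᴮ : ∀ {n} (ks : Vec Bool n) → Below (total-gain ks)
    total-gainᴮ ks = gainᴮ side J fireᴮ calmᴮ ks
      {S = 1ℚ} {w = weights 1ℚ 0ℚ 0ℚ 0ℚ} {m = pairs 0ℚ 0ℚ 0ℚ 0ℚ}
      oneᴮ (weightsᴮ oneᴮ zeroᴮ zeroᴮ zeroᴮ) zeroᴮ zeroᴮ zeroᴮ zeroᴮ

    -- As 2.2978 = 11489 / 5000, the required inequality becomes a comparison of natural numbers, to
    -- be settled by evaluation.
    large-gain : ∀ {n} (ks : Vec Bool n) → (5000 ℕ.* D ℕ.≤ᵇ 11489 ℕ.* approx (total-gainᴮ ks)) ≡ true →
      ι 5000 ≤ ι 11489 * total-gain ks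
    large-gain ks h = cancelᴮ 5000 11489 (total-gainᴮ ks) (ℕ.≤ᵇ⇒≤ _ _ (subst Bool.T (sym h) _))

-- Message laws at finite depth

shift-false : ∀ {n} (m : Msg n) → shift false m ≡ m
shift-false [] = refl
shift-false ((unknown , κ) ∷ m) = cong (_ ∷_) (shift-false m)
shift-false ((alive p , κ) ∷ m) = cong (_ ∷_) (shift-false m)
shift-false ((pend p  , κ) ∷ m) = cong (_ ∷_) (shift-false m)

module MessageLaw (side : Probability Bool) {n} (ks : Vec Bool n) where

  open Law side
  open Evolution side
  open Round side

  law : ℕ → Probability (Msg n)
  law zero    = return (silent n)
  law (suc d) = bind (streams n) λ l → bind (law d) λ a → bind (law d) λ b → return (forward ks l a b)

  law-part : ∀ d f → 𝔼 (law (suc d)) f ≡ ∫ (part ks false (measure (law d))) f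
  law-part d f = ∫-cong (measure (streams n)) λ l → ∫-cong (measure (law d)) λ a →
    ∫-cong (measure (law d)) λ b → cong f (sym (shift-false (forward ks l a b)))

  law-grow : ∀ d {f} → Test f → 𝔼 (law d) f ≤ 𝔼 (law (suc d)) f
  law-grow zero {f} tf = ≤-trans (≤-reflexive (sym (∫-const₁ (streams n) (f (silent n)))))
    (∫-mono (measure (streams n)) λ l → mono tf (silent-least (forward ks l (silent n) (silent n))))
  law-grow (suc d) {f} tf = subst₂ _≤_ (sym (law-part d f)) (sym (law-part (suc d) f))
    (part-mono ks false {measure (law d)} {measure (law (suc d))} tf (law-grow d))

  -- At first every arm is an edge, hence alive and even: the weights are one and three zeros. One
  -- level of depth suffices because the law at depth `suc d` is the even part over the law at depth
  -- `d`.
  law-regular : Regular ks 1ℚ (weights 1ℚ 0ℚ 0ℚ 0ℚ) (λ d → measure (law d))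
  law-regular = record
    { 0≤S   = 0≤1
    ; 0≤w   = record { 0≤even = 0≤1 ; 0≤odd = ≤-refl ; 0≤drop = ≤-refl ; 0≤out = ≤-refl }
    ; grow  = law-grow
    ; size  = λ d → ≤-reflexive (sym (mass≡1 (law d)))
    ; depth = 1
    ; lower = λ d {f} tf → ≤-reflexive (trans
        (solve 4 (λ a b c d → con 1ℚ :* a :+ (con 0ℚ :* b :+ (con 0ℚ :* c :+ con 0ℚ :* d)) := a) refl
          (∫ (part ks false (measure (law d))) f) (∫ (part ks true (measure (law d))) f)
          (f (pending false n)) (f (pending true n)))
        (sym (law-part d f)))
    }

  -- The observed vertex is real at the start, so all `Pairs` vanish and `value` reduces to `V₃`.
  selection-bound : ∀ J → ∃[ D ] GainBound.gain side J ks 1ℚ (weights 1ℚ 0ℚ 0ℚ 0ℚ) (pairs 0ℚ 0ℚ 0ℚ 0ℚ) ≤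
    Selection.V₃ side ks (measure (law D))
  selection-bound J with GainBound.gain-bound side J ks {m = pairs 0ℚ 0ℚ 0ℚ 0ℚ} law-regular
    record { 0≤ee = ≤-refl ; 0≤eo = ≤-refl ; 0≤oe = ≤-refl ; 0≤oo = ≤-refl }
  ... | D , h = D ℕ.+ 0 , ≤-trans (h 0) (≤-reflexive
    (solve 5 (λ v a b c d → v :+ (con 0ℚ :* a :+ (con 0ℚ :* b :+ (con 0ℚ :* c :+ con 0ℚ :* d))) := v) refl
      (V₃ ks μ) (V₂ ks false false μ) (V₂ ks false true μ) (V₂ ks true false μ) (V₂ ks true true μ)))
    where
    open Selection side
    μ : Measure (Msg n)
    μ = measure (law (D ℕ.+ 0))

  -- The three coins of a vertex are exchangeable, so the law of its message does not depend on the
  -- edge along which it is sent.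
  coins-front : ∀ j f → 𝔼 coins (f ∘ front j) ≡ 𝔼 coins f
  coins-front zero f = refl
  coins-front 1F f = commutes side (measure side) λ x y → 𝔼 side λ z → f (y , x , z)
  coins-front 2F f = trans
    (∫-cong (measure side) λ x → commutes side (measure side) λ y z → f (z , x , y))
    (commutes side (measure side) λ x z → 𝔼 side λ y → f (z , x , y))

  replicate-front : ∀ m j f → 𝔼 (streams m) (f ∘ Vec.map (front j)) ≡ 𝔼 (streams m) f
  replicate-front zero j f = refl
  replicate-front (suc m) j f = trans
    (∫-cong (measure coins) λ c → replicate-front m j λ l → f (front j c ∷ l))
    (coins-front j λ c → 𝔼 (streams m) λ l → f (c ∷ l))

-- Resampling

Tree : Set → ℕ → Set
Tree Ω zero    = ⊤
Tree Ω (suc d) = Ω × Tree Ω d × Tree Ω d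

treeᴾ : Probability Ω → ∀ d → Probability (Tree Ω d)
treeᴾ P zero    = return tt
treeᴾ P (suc d) = bind P λ a → bind (treeᴾ P d) λ l → bind (treeᴾ P d) λ r → return (a , l , r)

mapᵀ : ∀ {d} → (Ω → Ω′) → Tree Ω d → Tree Ω′ d
mapᵀ {d = zero}  f _ = tt
mapᵀ {d = suc d} f (a , l , r) = f a , mapᵀ f l , mapᵀ f r

_∈ᵀ_ : ∀ {d} → Ω → Tree Ω d → Set
_∈ᵀ_ {d = zero}  x _ = ⊥
_∈ᵀ_ {d = suc d} x (a , l , r) = x ≡ a ⊎ (x ∈ᵀ l ⊎ x ∈ᵀ r)

Disjoint : ∀ {d e} → Tree Ω d → Tree Ω e → Set
Disjoint s t = ∀ {x} → x ∈ᵀ s → x ∈ᵀ t → ⊥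

Distinct : ∀ {d} → Tree Ω d → Set
Distinct {d = zero}  _ = ⊤
Distinct {d = suc d} (a , l , r) =
  ¬ a ∈ᵀ l × ¬ a ∈ᵀ r × Disjoint l r × Distinct l × Distinct r

mapᵀ-cong : ∀ {d} {f g : Ω → Ω′} (t : Tree Ω d) → (∀ {x} → x ∈ᵀ t → f x ≡ g x) → mapᵀ f t ≡ mapᵀ g t
mapᵀ-cong {d = zero}  t f≡g = refl
mapᵀ-cong {d = suc d} (a , l , r) f≡g = cong₂ _,_ (f≡g (inj₁ refl))
  (cong₂ _,_ (mapᵀ-cong l (f≡g ∘ inj₂ ∘ inj₁)) (mapᵀ-cong r (f≡g ∘ inj₂ ∘ inj₂)))

module Resampling {L : Set} (P : Probability L) where

  resample : ∀ {m} (x : Fin m) (ψ : Vec L m → ℚ) →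
    𝔼 (replicateᴾ P m) ψ ≡ 𝔼 P λ l → 𝔼 (replicateᴾ P m) λ ω → ψ (ω [ x ]≔ l)
  resample {suc m} zero ψ = ∫-cong (measure P) λ l → sym (∫-const₁ P (𝔼 (replicateᴾ P m) λ ω → ψ (l ∷ ω)))
  resample {suc m} (suc x) ψ = trans
    (∫-cong (measure P) λ a → resample x λ ω → ψ (a ∷ ω))
    (commutes P (measure P) λ a l → 𝔼 (replicateᴾ P m) λ ω → ψ (a ∷ (ω [ x ]≔ l)))

  override : ∀ {m d} → Tree (Fin m) d → Tree L d → Vec L m → Vec L m
  override {d = zero}  _ _ ω = ω
  override {d = suc d} (x , s , s′) (l , t , t′) ω = override s t (override s′ t′ ω) [ x ]≔ l

  -- Overwriting labels by fresh independent ones preserves the law of the labelling, even when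
  -- vertices of the tree repeat. This is how independence is obtained: if the vertices are
  -- distinct, `override-same` reads back exactly the fresh labels, and the old labelling integrates
  -- out.
  resampleᵀ : ∀ {m d} (s : Tree (Fin m) d) (ψ : Vec L m → ℚ) →
    𝔼 (replicateᴾ P m) ψ ≡ 𝔼 (treeᴾ P d) λ t → 𝔼 (replicateᴾ P m) λ ω → ψ (override s t ω)
  resampleᵀ {d = zero}  s ψ = refl
  resampleᵀ {d = suc d} (x , s , s′) ψ = trans (resample x ψ) (∫-cong (measure P) λ l → trans
    (resampleᵀ s λ ω → ψ (ω [ x ]≔ l))
    (∫-cong (measure (treeᴾ P d)) λ t → resampleᵀ s′ λ ω → ψ (override s t ω [ x ]≔ l)))

  override-other : ∀ {m d} (s : Tree (Fin m) d) t ω {x} → ¬ x ∈ᵀ s → lookup (override s t ω) x ≡ lookup ω x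
  override-other {d = zero}  s t ω x∉s = refl
  override-other {d = suc d} (y , s , s′) (l , t , t′) ω {x} x∉s = trans
    (Vec.lookup∘update′ (x∉s ∘ inj₁) (override s t (override s′ t′ ω)) l)
    (trans (override-other s t (override s′ t′ ω) (x∉s ∘ inj₂ ∘ inj₁))
      (override-other s′ t′ ω (x∉s ∘ inj₂ ∘ inj₂)))

  override-same : ∀ {m d} (s : Tree (Fin m) d) t ω → Distinct s → mapᵀ (lookup (override s t ω)) s ≡ t
  override-same {d = zero}  s t ω _ = refl
  override-same {d = suc d} (x , s , s′) (l , t , t′) ω (x∉s , x∉s′ , s#s′ , ds , ds′) = cong₂ _,_
    (Vec.lookup∘update x ω″ l)
    (cong₂ _,_
      (trans (mapᵀ-cong s λ y∈s → Vec.lookup∘update′ (λ { refl → x∉s y∈s }) ω″ l)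
        (override-same s t ω′ ds))
      (trans (mapᵀ-cong s′ λ y∈s′ → trans (Vec.lookup∘update′ (λ { refl → x∉s′ y∈s′ }) ω″ l)
          (override-other s t ω′ λ y∈s → s#s′ y∈s y∈s′))
        (override-same s′ t′ ω ds′)))
    where
    ω′ ω″ : Vec L _
    ω′ = override s′ t′ ω
    ω″ = override s t ω′

-- Cubic graphs

element : ∀ {n} (p : Subset n) → Fin ∣ p ∣ → Fin n
element (outside ∷ p) i       = suc (element p i)
element (inside  ∷ p) zero    = zero
element (inside  ∷ p) (suc i) = suc (element p i)

element-∈ : ∀ {n} (p : Subset n) i → element p i ∈ p
element-∈ (outside ∷ p) i       = there (element-∈ p i)
element-∈ (inside  ∷ p) zero    = here
element-∈ (inside  ∷ p) (suc i) = there (element-∈ p i)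

element-injective : ∀ {n} (p : Subset n) {i j} → element p i ≡ element p j → i ≡ j
element-injective (outside ∷ p) eq = element-injective p (Fin.suc-injective eq)
element-injective (inside  ∷ p) {zero}  {zero}  eq = refl
element-injective (inside  ∷ p) {suc i} {suc j} eq = cong suc (element-injective p (Fin.suc-injective eq))

element-surjective : ∀ {n} (p : Subset n) {x} → x ∈ p → ∃[ i ] element p i ≡ x
element-surjective (inside  ∷ p) here = zero , refl
element-surjective (outside ∷ p) (there x∈p) with element-surjective p x∈p
... | i , refl = i , refl
element-surjective (inside  ∷ p) (there x∈p) with element-surjective p x∈p
... | i , refl = suc i , refl

record Slots (G : Graph) : Set where
  open Graph G
  field
    nbr            : Vertex → Fin 3 → Vertex
    nbr-adjacent   : ∀ v i → v ~ nbr v i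
    nbr-injective  : ∀ v {i j} → nbr v i ≡ nbr v j → i ≡ j
    nbr-surjective : ∀ {v u} → v ~ u → ∃[ i ] nbr v i ≡ u

cubic-slots : ∀ G → Cubic G → Slots G
cubic-slots G cubic = record
  { nbr = λ v i → element (neighbours v) (slot v i)
  ; nbr-adjacent = λ v i → ∈⇒~ (element-∈ (neighbours v) (slot v i))
  ; nbr-injective = λ v {i} {j} eq → subst-injective (sym (cubic v)) (element-injective (neighbours v) eq)
  ; nbr-surjective = λ {v} v~u → let (i , eq) = element-surjective (neighbours v) (~⇒∈ v~u) in
      subst Fin (cubic v) i , trans (cong (element (neighbours v)) (subst-sym-subst (cubic v))) eq
  }
  where
  open Graph G
  slot : ∀ v → Fin 3 → Fin (degree v)
  slot v = subst Fin (sym (cubic v))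
  ∈⇒~ : ∀ {v u} → u ∈ neighbours v → v ~ u
  ∈⇒~ {v} {u} u∈ with v ~? u | trans (sym (Vec.lookup∘tabulate (λ u → does (v ~? u)) u)) (Vec.[]=⇒lookup u∈)
  ... | yes v~u | _ = v~u
  ~⇒∈ : ∀ {v u} → v ~ u → u ∈ neighbours v
  ~⇒∈ {v} {u} v~u = Vec.lookup⇒[]= u (neighbours v)
    (trans (Vec.lookup∘tabulate (λ u → does (v ~? u)) u) (dec-true (v ~? u) v~u))

module Messages {G : Graph} (slots : Slots G) {n} (ks : Vec Bool n) where

  open Graph G
  open Slots slots

  back : Vertex → Fin 3 → Fin 3
  back v i = proj₁ (nbr-surjective (~-sym (nbr-adjacent v i)))

  nbr-back : ∀ v i → nbr (nbr v i) (back v i) ≡ v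
  nbr-back v i = proj₂ (nbr-surjective (~-sym (nbr-adjacent v i)))

  Labelling : Set
  Labelling = Vec (Vec Coins n) order

  module _ (ω : Labelling) where

    message : ℕ → Vertex → Fin 3 → Msg n
    message zero    v i = silent n
    message (suc d) v i = forward ks (Vec.map (front j) (lookup ω u)) (message d u (other₁ j)) (message d u (other₂ j))
      where
      u = nbr v i
      j = back v i

    message-grow : ∀ d v i → message d v i ⊑ message (suc d) v i
    message-grow zero    v i = silent-least _
    message-grow (suc d) v i = forward-mono ks _
      (message-grow d (nbr v i) (other₁ (back v i))) (message-grow d (nbr v i) (other₂ (back v i)))

    selected : ℕ → Vertex → Bool
    selected d v = decide₃ ks (lookup ω v) (message d v zero) (message d v 1F) (message d v 2F)

    message-across : ∀ d {u v i j} → nbr u j ≡ v → nbr v i ≡ u → message (suc d) u j ≡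
      forward ks (Vec.map (front i) (lookup ω v)) (message d v (other₁ i)) (message d v (other₂ i))
    message-across d {u} {i = i} {j = j} refl vi≡u
      rewrite nbr-injective (nbr u j) (trans (nbr-back u j) (sym vi≡u)) = refl

    -- At depth `d`, `u` judges `v` by a message built from depth `d - 1` information, while `v`
    -- decides with messages of depth `d`. Raising the message to depth `suc d` preserves the
    -- selection of `u` and makes it the `forward` of precisely those messages that decide `v`, as
    -- `exclusive₃₃` requires.
    selected-across : ∀ d {u v i j} → nbr u j ≡ v → nbr v i ≡ u → selected d u ≡ true →
      decide₃ ks (Vec.map (front j) (lookup ω u))
        (forward ks (Vec.map (front i) (lookup ω v)) (message d v (other₁ i)) (message d v (other₂ i)))
        (message d u (other₁ j)) (message d u (other₂ j)) ≡ true
    selected-across d {u} {v} {i} {j} uj≡v vi≡u sel = subst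
      (λ m → decide₃ ks (Vec.map (front j) (lookup ω u)) m (message d u (other₁ j)) (message d u (other₂ j)) ≡ true)
      (message-across d uj≡v vi≡u)
      (decide₃-mono ks (Vec.map (front j) (lookup ω u)) (message-grow d u j) ⊑-refl ⊑-refl
        (trans (sym (decide₃-front ks (lookup ω u) (message d u) j)) sel))

    selected-independent : ∀ d {u v} → u ~ v → selected d u ≡ true → selected d v ≡ true → ⊥
    selected-independent d {u} {v} u~v su sv with nbr-surjective u~v | nbr-surjective (~-sym u~v)
    ... | j , uj≡v | i , vi≡u = exclusive₃₃ ks
      (Vec.map (front j) (lookup ω u)) (Vec.map (front i) (lookup ω v))
      (message d u (other₁ j)) (message d u (other₂ j)) (message d v (other₁ i)) (message d v (other₂ i))
      (selected-across d uj≡v vi≡u su) (selected-across d vi≡u uj≡v sv)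

  branch : ∀ d → Vertex → Fin 3 → Tree Vertex d
  branch zero    v i = tt
  branch (suc d) v i = u , branch d u (other₁ j) , branch d u (other₂ j)
    where
    u = nbr v i
    j = back v i

  evaluate : ∀ d → Vertex → Fin 3 → Tree (Vec Coins n) d → Msg n
  evaluate zero    v i _ = silent n
  evaluate (suc d) v i (l , s , t) =
    forward ks (Vec.map (front j) l) (evaluate d u (other₁ j) s) (evaluate d u (other₂ j) t)
    where
    u = nbr v i
    j = back v i

  message-evaluate : ∀ ω d v i → message ω d v i ≡ evaluate d v i (mapᵀ (lookup ω) (branch d v i))
  message-evaluate ω zero    v i = refl
  message-evaluate ω (suc d) v i = cong₂ (forward ks _)
    (message-evaluate ω d (nbr v i) (other₁ (back v i))) (message-evaluate ω d (nbr v i) (other₂ (back v i)))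

  module _ (side : Probability Bool) where

    open Law side
    open MessageLaw side ks
    open Resampling (streams n)

    labelling : Probability Labelling
    labelling = replicateᴾ (streams n) order

    evaluate-law : ∀ d v i f → 𝔼 (treeᴾ (streams n) d) (f ∘ evaluate d v i) ≡ 𝔼 (law d) f
    evaluate-law zero    v i f = refl
    evaluate-law (suc d) v i f = trans
      (∫-cong (measure (streams n)) λ l → trans
        (evaluate-law d u (other₁ j) λ a → 𝔼 (treeᴾ (streams n) d) λ t →
          f (forward ks (Vec.map (front j) l) a (evaluate d u (other₂ j) t)))
        (∫-cong (measure (law d)) λ a → evaluate-law d u (other₂ j) λ b → f (forward ks (Vec.map (front j) l) a b)))
      (replicate-front n j λ l → 𝔼 (law d) λ a → 𝔼 (law d) λ b → f (forward ks l a b))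
      where
      u = nbr v i
      j = back v i

    record Treelike (d : ℕ) (v : Vertex) : Set where
      field
        root     : ∀ i → ¬ v ∈ᵀ branch d v i
        disjoint : ∀ {i j} → i ≢ j → Disjoint (branch d v i) (branch d v j)
        distinct : ∀ i → Distinct (branch d v i)

    -- The labels are redrawn at `v` and then along its three branches. As no vertex occurs twice,
    -- each message becomes a function of the fresh labels of its own branch alone.
    selected-law : ∀ d v → Treelike d v →
      𝔼 labelling (λ ω → χ (selected ω d v)) ≡ Selection.V₃ side ks (measure (law d))
    selected-law d v treelike = begin
      𝔼 labelling (λ ω → χ (selected ω d v))
        ≡⟨ resample v (λ ω → χ (selected ω d v)) ⟩
      (𝔼 (streams n) λ l → 𝔼 labelling λ ω → χ (selected (ω [ v ]≔ l) d v))
        ≡⟨ (∫-cong (measure (streams n)) λ l → trans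
             (resampleᵀ (b zero) λ ω → χ (selected (ω [ v ]≔ l) d v)) (∫-cong (measure T) λ r → trans
             (resampleᵀ (b 1F) λ ω → χ (selected (override (b zero) r ω [ v ]≔ l) d v)) (∫-cong (measure T) λ s →
             resampleᵀ (b 2F) λ ω →
               χ (selected (override (b zero) r (override (b 1F) s ω) [ v ]≔ l) d v)))) ⟩
      (𝔼 (streams n) λ l → 𝔼 T λ r → 𝔼 T λ s → 𝔼 T λ t → 𝔼 labelling λ ω → χ (selected (ω′ l r s t ω) d v))
        ≡⟨ (∫-cong (measure (streams n)) λ l → ∫-cong (measure T) λ r → ∫-cong (measure T) λ s → ∫-cong (measure T) λ t →
             trans (∫-cong (measure labelling) λ ω → cong χ (selected-override l r s t ω))
               (∫-const₁ labelling (χ (decide₃ ks l (e zero r) (e 1F s) (e 2F t))))) ⟩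
      (𝔼 (streams n) λ l → 𝔼 T λ r → 𝔼 T λ s → 𝔼 T λ t → χ (decide₃ ks l (e zero r) (e 1F s) (e 2F t)))
        ≡⟨ (∫-cong (measure (streams n)) λ l → trans
             (evaluate-law d v zero λ a → 𝔼 T λ s → 𝔼 T λ t → χ (decide₃ ks l a (e 1F s) (e 2F t)))
             (∫-cong (measure (law d)) λ a → trans
             (evaluate-law d v 1F λ b → 𝔼 T λ t → χ (decide₃ ks l a b (e 2F t)))
             (∫-cong (measure (law d)) λ b → evaluate-law d v 2F λ c → χ (decide₃ ks l a b c)))) ⟩
      Selection.V₃ side ks (measure (law d)) ∎
      where
      open ≡-Reasoning
      open Treelike treelike
      T : Probability (Tree (Vec Coins n) d)
      T = treeᴾ (streams n) d
      b : ∀ i → Tree Vertex d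
      b = branch d v
      e : ∀ i → Tree (Vec Coins n) d → Msg n
      e = evaluate d v
      module _ (l : Vec Coins n) (r s t : Tree (Vec Coins n) d) (ω : Labelling) where
        ω₂ ω₁ ω₀ ω′ : Labelling
        ω₂ = override (b 2F) t ω
        ω₁ = override (b 1F) s ω₂
        ω₀ = override (b zero) r ω₁
        ω′ = ω₀ [ v ]≔ l
        off-root : ∀ i {x} → x ∈ᵀ b i → lookup ω′ x ≡ lookup ω₀ x
        off-root i x∈ = Vec.lookup∘update′ (λ { refl → root i x∈ }) ω₀ l
        message₀ : message ω′ d v zero ≡ e zero r
        message₀ = trans (message-evaluate ω′ d v zero) (cong (e zero) (trans
          (mapᵀ-cong (b zero) (off-root zero))
          (override-same (b zero) r ω₁ (distinct zero))))
        message₁ : message ω′ d v 1F ≡ e 1F s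
        message₁ = trans (message-evaluate ω′ d v 1F) (cong (e 1F) (trans
          (mapᵀ-cong (b 1F) λ x∈ → trans (off-root 1F x∈)
            (override-other (b zero) r ω₁ λ x∈₀ → disjoint (λ ()) x∈₀ x∈))
          (override-same (b 1F) s ω₂ (distinct 1F))))
        message₂ : message ω′ d v 2F ≡ e 2F t
        message₂ = trans (message-evaluate ω′ d v 2F) (cong (e 2F) (trans
          (mapᵀ-cong (b 2F) λ x∈ → trans (off-root 2F x∈) (trans
            (override-other (b zero) r ω₁ λ x∈₀ → disjoint (λ ()) x∈₀ x∈)
            (override-other (b 1F) s ω₂ λ x∈₁ → disjoint (λ ()) x∈₁ x∈)))
          (override-same (b 2F) t ω (distinct 2F))))
        selected-override : selected ω′ d v ≡ decide₃ ks l (e zero r) (e 1F s) (e 2F t)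
        selected-override rewrite message₀ | message₁ | message₂ | Vec.lookup∘update v ω₀ l = refl

-- Large girth: non-backtracking walks and tree-like neighbourhoods

module Walks (G : Graph) where

  open Graph G

  data Walk : List Vertex → Set where
    point : ∀ {x} → Walk (x ∷ [])
    edge  : ∀ {x y} → x ~ y → Walk (x ∷ y ∷ [])
    step  : ∀ {x y z xs} → x ~ y → x ≢ z → Walk (y ∷ z ∷ xs) → Walk (x ∷ y ∷ z ∷ xs)

  walk-step : ∀ {x y xs} → Walk (x ∷ y ∷ xs) → x ~ y
  walk-step (edge x~y)     = x~y
  walk-step (step x~y _ _) = x~y

  walk-tail : ∀ {x y xs} → Walk (x ∷ y ∷ xs) → Walk (y ∷ xs)
  walk-tail (edge _)     = point
  walk-tail (step _ _ w) = w

  -- The form is that of `Cycle`, so that an edge from `x` to `y` closes the path. The bound on `m`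
  -- remembers that the path was cut out of a walk.
  record Path (x y : Vertex) (ys : List Vertex) : Set where
    field
      {m}       : ℕ
      vertex    : Fin (suc m) → Vertex
      start     : vertex zero ≡ y
      end       : vertex (fromℕ m) ≡ x
      steps     : ∀ i → vertex (inject₁ i) ~ vertex (suc i)
      injective : ∀ {i j} → vertex i ≡ vertex j → i ≡ j
      within    : ∀ i → vertex i ∈ˡ (y ∷ ys)
      short     : m ℕ.≤ List.length ys

  open Path

  trivial : ∀ {x ys} → Path x x ys
  trivial {x} = record
    { m = 0 ; vertex = λ _ → x ; start = refl ; end = refl ; steps = λ ()
    ; injective = λ { {zero} {zero} _ → refl } ; within = λ _ → Any.here refl ; short = ℕ.z≤n }

  extend : ∀ {x y z zs} → y ~ z → All (y ≢_) (z ∷ zs) → Path x z zs → Path x y (z ∷ zs)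
  extend {x} {y} {z} {zs} y~z y∉ p = record
    { m = suc (m p) ; vertex = vertex′ ; start = refl ; end = end p ; steps = steps′
    ; injective = injective′ ; within = within′ ; short = ℕ.s≤s (short p) }
    where
    vertex′ : Fin (suc (suc (m p))) → Vertex
    vertex′ zero    = y
    vertex′ (suc i) = vertex p i
    steps′ : ∀ i → vertex′ (inject₁ i) ~ vertex′ (suc i)
    steps′ zero    = subst (y ~_) (sym (start p)) y~z
    steps′ (suc i) = steps p i
    injective′ : ∀ {i j} → vertex′ i ≡ vertex′ j → i ≡ j
    injective′ {zero}  {zero}  _  = refl
    injective′ {zero}  {suc j} eq = contradiction eq (All.lookup y∉ (within p j))
    injective′ {suc i} {zero}  eq = contradiction (sym eq) (All.lookup y∉ (within p i))
    injective′ {suc i} {suc j} eq = cong suc (injective p eq)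
    within′ : ∀ i → vertex′ i ∈ˡ (y ∷ z ∷ zs)
    within′ zero    = Any.here refl
    within′ (suc i) = Any.there (within p i)

  path : ∀ {x y ys} → Walk (y ∷ ys) → Unique (y ∷ ys) → x ∈ˡ (y ∷ ys) → Path x y ys
  path w u (Any.here refl) = trivial
  path {ys = z ∷ zs} w (y∉ ∷ u) (Any.there x∈) = extend (walk-step w) y∉ (path (walk-tail w) u x∈)

  module _ {g : ℕ} (no-short : ∀ (C : Cycle G) → g ℕ.≤ Cycle.length C) where

    -- A return to `x` after three or more steps closes a cycle with fewer than `g` vertices.
    -- Earlier returns are excluded by irreflexivity and by the absence of backtracking.
    start-fresh : ∀ {x y ys} → Walk (x ∷ y ∷ ys) → Unique (y ∷ ys) →
      List.length (x ∷ y ∷ ys) ℕ.≤ g → ¬ x ∈ˡ (y ∷ ys)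
    start-fresh w u len (Any.here refl) = ~-irrefl refl (walk-step w)
    start-fresh (step _ x≢x _) u len (Any.there (Any.here refl)) = x≢x refl
    start-fresh {x} {y} {z ∷ z′ ∷ zs} (step x~y _ (step y~z _ w)) (y∉ ∷ z∉ ∷ u) len (Any.there (Any.there x∈)) =
      ℕ.<⇒≱ (ℕ.≤-trans (ℕ.s≤s (ℕ.s≤s (short p))) len) (no-short cycle)
      where
      q : Path x z′ zs
      q = path (walk-tail w) u x∈
      p : Path x y (z ∷ z′ ∷ zs)
      p = extend y~z y∉ (extend (walk-step w) z∉ q)
      cycle : Cycle G
      cycle = record
        { m = m p ; 2≤m = ℕ.s≤s (ℕ.s≤s ℕ.z≤n) ; vertex = vertex p ; injective = injective p
        ; step = steps p ; close = subst (_~ y) (sym (end p)) x~y }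

    walk-unique : ∀ {xs} → Walk xs → List.length xs ℕ.≤ g → Unique xs
    walk-unique point _ = [] ∷ []
    walk-unique w@(edge _) len = All.¬Any⇒All¬ _ (start-fresh w ([] ∷ []) len) ∷ ([] ∷ [])
    walk-unique w@(step _ _ w′) len = All.¬Any⇒All¬ _ (start-fresh w unique len) ∷ unique
      where
      unique : Unique _
      unique = walk-unique w′ (ℕ.≤-trans (ℕ.n≤1+n _) len)

-- The girth, a least length, is needed only under a double negation.
girth⇒no-short : ∀ {g} G → GirthAtLeast g G → ∀ (C : Cycle G) → g ℕ.≤ Cycle.length C
girth⇒no-short {g} G girth C = ℕ.≮⇒≥ (<-rec (λ k → ∀ C → Cycle.length C ≡ k → ¬ k < g)
  (λ k rec C length≡k k<g → ℕ.<⇒≱ k<g (girth ((C , length≡k) , λ { {x} (C′ , length≡x) →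
    ℕ.≮⇒≥ λ x<k → rec x<k C′ length≡x (ℕ.<-trans x<k k<g) }))) (Cycle.length C) C refl)

module Locally {G : Graph} (slots : Slots G) {n} (ks : Vec Bool n) where

  open Graph G
  open Slots slots
  open Messages slots ks
  open Walks G

  other₁≢ : ∀ j → other₁ j ≢ j
  other₁≢ zero ()
  other₁≢ 1F ()
  other₁≢ 2F ()

  other₂≢ : ∀ j → other₂ j ≢ j
  other₂≢ zero ()
  other₂≢ 1F ()
  other₂≢ 2F ()

  other₁≢other₂ : ∀ j → other₁ j ≢ other₂ j
  other₁≢other₂ zero ()
  other₁≢other₂ 1F ()
  other₁≢other₂ 2F ()

  forth : ∀ v i {k} → k ≢ back v i → v ≢ nbr (nbr v i) k
  forth v i k≢ eq = k≢ (nbr-injective (nbr v i) (trans (sym eq) (sym (nbr-back v i))))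

  walk-out : ∀ d v i {x} → x ∈ᵀ branch d v i → ∃[ xs ]
    (Walk (v ∷ nbr v i ∷ xs) × x ∈ˡ (nbr v i ∷ xs) × List.length (nbr v i ∷ xs) ℕ.≤ d)
  walk-out (suc d) v i (inj₁ refl) = [] , edge (nbr-adjacent v i) , Any.here refl , ℕ.s≤s ℕ.z≤n
  walk-out (suc d) v i (inj₂ (inj₁ x∈)) with walk-out d (nbr v i) (other₁ (back v i)) x∈
  ... | xs , w , x∈xs , len = _ , step (nbr-adjacent v i) (forth v i (other₁≢ _)) w , Any.there x∈xs , ℕ.s≤s len
  walk-out (suc d) v i (inj₂ (inj₂ x∈)) with walk-out d (nbr v i) (other₂ (back v i)) x∈
  ... | xs , w , x∈xs , len = _ , step (nbr-adjacent v i) (forth v i (other₂≢ _)) w , Any.there x∈xs , ℕ.s≤s len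

  -- The walk grows at its front, from `v` into the branch, so that the stretch `p` on the other
  -- side of `v` survives in its tail.
  walk-in : ∀ d v i {x p} → x ∈ᵀ branch d v i → Walk (nbr v i ∷ v ∷ p) → ∃[ xs ]
    (Walk (x ∷ xs) × (∀ {y} → y ∈ˡ p → y ∈ˡ xs) × List.length (x ∷ xs) ℕ.≤ d ℕ.+ List.length (v ∷ p))
  walk-in (suc d) v i (inj₁ refl) w = _ , w , Any.there , ℕ.s≤s (ℕ.m≤n+m _ d)
  walk-in (suc d) v i (inj₂ (inj₁ x∈)) w with walk-in d (nbr v i) (other₁ (back v i)) x∈
    (step (~-sym (nbr-adjacent (nbr v i) _)) (forth v i (other₁≢ _) ∘ sym) w)
  ... | xs , w′ , ⊆ , len = xs , w′ , ⊆ ∘ Any.there , ℕ.≤-trans len (ℕ.≤-reflexive (ℕ.+-suc d _))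
  walk-in (suc d) v i (inj₂ (inj₂ x∈)) w with walk-in d (nbr v i) (other₂ (back v i)) x∈
    (step (~-sym (nbr-adjacent (nbr v i) _)) (forth v i (other₂≢ _) ∘ sym) w)
  ... | xs , w′ , ⊆ , len = xs , w′ , ⊆ ∘ Any.there , ℕ.≤-trans len (ℕ.≤-reflexive (ℕ.+-suc d _))

  module _ {g : ℕ} (no-short : ∀ (C : Cycle G) → g ℕ.≤ Cycle.length C) where

    off-root : ∀ d v i → suc (d ℕ.+ d) ℕ.≤ g → ¬ v ∈ᵀ branch d v i
    off-root d v i ≤g v∈ with walk-out d v i v∈
    ... | xs , w , v∈xs , len with walk-unique no-short w (ℕ.≤-trans (ℕ.s≤s (ℕ.≤-trans len (ℕ.m≤m+n d d))) ≤g)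
    ... | v∉ ∷ _ = All.lookup v∉ v∈xs refl

    -- A common vertex would give a walk from it through one branch to `v` and on through the other
    -- branch, meeting it again. The walk does not backtrack at `v` because `i ≢ j`, and it has at
    -- most 2d + 1 vertices.
    branches-disjoint : ∀ d v {i j} → suc (d ℕ.+ d) ℕ.≤ g → i ≢ j → Disjoint (branch d v i) (branch d v j)
    branches-disjoint d v {i} {j} ≤g i≢j x∈i x∈j with walk-out d v j x∈j
    ... | xs , w , x∈xs , len with walk-in d v i x∈i (step (~-sym (nbr-adjacent v i)) (i≢j ∘ nbr-injective v) w)
    ... | ys , w′ , ⊆ , len′ with walk-unique no-short w′
      (ℕ.≤-trans len′ (ℕ.≤-trans (ℕ.+-monoʳ-≤ d (ℕ.s≤s len)) (ℕ.≤-trans (ℕ.≤-reflexive (ℕ.+-suc d d)) ≤g)))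
    ... | x∉ ∷ _ = All.lookup x∉ (⊆ x∈xs) refl

    branch-distinct : ∀ d v i → suc (d ℕ.+ d) ℕ.≤ g → Distinct (branch d v i)
    branch-distinct zero    v i ≤g = tt
    branch-distinct (suc d) v i ≤g =
      off-root d (nbr v i) _ ≤g′ , off-root d (nbr v i) _ ≤g′ ,
      branches-disjoint d (nbr v i) ≤g′ (other₁≢other₂ (back v i)) ,
      branch-distinct d (nbr v i) _ ≤g′ , branch-distinct d (nbr v i) _ ≤g′
      where
      ≤g′ : suc (d ℕ.+ d) ℕ.≤ g
      ≤g′ = ℕ.≤-trans (ℕ.s≤s (ℕ.+-mono-≤ (ℕ.n≤1+n d) (ℕ.n≤1+n d))) ≤g

    treelike : ∀ side d v → suc (d ℕ.+ d) ℕ.≤ g → Treelike side d v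
    treelike side d v ≤g = record
      { root = λ i → off-root d v i ≤g ; disjoint = branches-disjoint d v ≤g ; distinct = λ i → branch-distinct d v i ≤g }

-- Linear programs: Fourier–Motzkin elimination

-- The affine form with the given coefficients and constant term.
Form : ℕ → Set
Form n = Vec ℚ n × ℚ

eval : ∀ {n} → Form n → Vec ℚ n → ℚ
eval ([] , c) [] = c
eval (a ∷ as , c) (x ∷ xs) = a * x + eval (as , c) xs

_⊹_ : ∀ {n} → Form n → Form n → Form n
(as , c) ⊹ (bs , d) = Vec.zipWith _+_ as bs , c + d

_·_ : ∀ {n} → ℚ → Form n → Form n
k · (as , c) = Vec.map (k *_) as , k * c

eval-⊹ : ∀ {n} (f g : Form n) xs → eval (f ⊹ g) xs ≡ eval f xs + eval g xs
eval-⊹ ([] , c) ([] , d) [] = refl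
eval-⊹ (a ∷ as , c) (b ∷ bs , d) (x ∷ xs) rewrite eval-⊹ (as , c) (bs , d) xs =
  solve 5 (λ a b x p q → (a :+ b) :* x :+ (p :+ q) := (a :* x :+ p) :+ (b :* x :+ q)) refl
    a b x (eval (as , c) xs) (eval (bs , d) xs)

eval-· : ∀ {n} k (f : Form n) xs → eval (k · f) xs ≡ k * eval f xs
eval-· k ([] , c) [] = refl
eval-· k (a ∷ as , c) (x ∷ xs) rewrite eval-· k (as , c) xs =
  solve 4 (λ k a x p → (k :* a) :* x :+ k :* p := k :* (a :* x :+ p)) refl k a x (eval (as , c) xs)

-- Everything is kept up to an error of a multiple of ε, for the sake of real solutions.
record Split {n} (F : List (Form (suc n))) : Set where
  field
    lowers uppers rests : List (Form n)
    M    : ℚ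
    0≤M  : 0ℚ ≤ M
    sound : ∀ {ε} → 0ℚ ≤ ε → ∀ x xs → All (λ f → - ε ≤ eval f (x ∷ xs)) F →
      All (λ p → - (M * ε) ≤ x + eval p xs) lowers ×
      All (λ q → - (M * ε) ≤ - x + eval q xs) uppers ×
      All (λ r → - (M * ε) ≤ eval r xs) rests
    complete : ∀ x xs → All (λ p → 0ℚ ≤ x + eval p xs) lowers → All (λ q → 0ℚ ≤ - x + eval q xs) uppers →
      All (λ r → 0ℚ ≤ eval r xs) rests → All (λ f → 0ℚ ≤ eval f (x ∷ xs)) F

open Split public

weaken : ∀ {M M′ ε y} → 0ℚ ≤ ε → M ≤ M′ → - (M * ε) ≤ y → - (M′ * ε) ≤ y
weaken 0≤ε M≤M′ = ≤-trans (ℚ.neg-antimono-≤ (*-monoʳ 0≤ε M≤M′))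

≤+ʳ : ∀ {a b} → 0ℚ ≤ b → a ≤ a + b
≤+ʳ {a} {b} 0≤b = subst (_≤ a + b) (ℚ.+-identityʳ a) (ℚ.+-monoʳ-≤ a 0≤b)

≤+ˡ : ∀ {a b} → 0ℚ ≤ b → a ≤ b + a
≤+ˡ {a} {b} 0≤b = subst (_≤ b + a) (ℚ.+-identityˡ a) (ℚ.+-monoˡ-≤ a 0≤b)

scaled-sound : ∀ {k y z ε} → 0ℚ ≤ k → k * y ≡ z → - ε ≤ y → - (k * ε) ≤ z
scaled-sound {k} {y} {z} {ε} 0≤k ky≡z -ε≤y = subst₂ _≤_
  (sym (ℚ.neg-distribʳ-* k ε)) ky≡z (*-monoˡ 0≤k -ε≤y)

-- Dividing a form by the absolute value of its leading coefficient also scales the permitted error;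
-- `M` sums these factors and therefore bounds each of them.
split : ∀ {n} (F : List (Form (suc n))) → Split F
split [] = record
  { lowers = [] ; uppers = [] ; rests = [] ; M = 0ℚ ; 0≤M = ≤-refl
  ; sound = λ _ _ _ _ → [] , [] , [] ; complete = λ _ _ _ _ _ → [] }
split ((a ∷ as , c) ∷ F) with ℚ.<-cmp 0ℚ a | split F
... | tri≈ _ refl _ | S = record
  { lowers = lowers S ; uppers = uppers S ; rests = (as , c) ∷ rests S
  ; M = M S + 1ℚ ; 0≤M = 0≤+ (0≤M S) 0≤1
  ; sound = λ { {ε} 0≤ε x xs (h ∷ hs) → let (l , u , r) = sound S 0≤ε x xs hs in
      All.map (weaken 0≤ε (≤+ʳ {M S} 0≤1)) l , All.map (weaken 0≤ε (≤+ʳ {M S} 0≤1)) u ,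
      weaken 0≤ε (≤+ˡ {1ℚ} (0≤M S)) (subst₂ _≤_ (cong -_ (sym (ℚ.*-identityˡ ε))) (zero-coefficient x xs) h) ∷ All.map (weaken 0≤ε (≤+ʳ {M S} 0≤1)) r }
  ; complete = λ { x xs l u (h ∷ r) → subst (0ℚ ≤_) (sym (zero-coefficient x xs)) h ∷ complete S x xs l u r } }
  where
  zero-coefficient : ∀ x xs → 0ℚ * x + eval (as , c) xs ≡ eval (as , c) xs
  zero-coefficient x xs = solve 2 (λ x e → con 0ℚ :* x :+ e := e) refl x (eval (as , c) xs)
... | tri< 0<a _ _ | S = record
  { lowers = (k · (as , c)) ∷ lowers S ; uppers = uppers S ; rests = rests S
  ; M = M S + k ; 0≤M = 0≤+ (0≤M S) 0≤k
  ; sound = λ { {ε} 0≤ε x xs (h ∷ hs) → let (l , u , r) = sound S 0≤ε x xs hs in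
      weaken 0≤ε (≤+ˡ {k} (0≤M S)) (scaled-sound 0≤k (normal x xs) h) ∷ All.map (weaken 0≤ε (≤+ʳ {M S} 0≤k)) l , All.map (weaken 0≤ε (≤+ʳ {M S} 0≤k)) u , All.map (weaken 0≤ε (≤+ʳ {M S} 0≤k)) r }
  ; complete = λ { x xs (h ∷ l) u r →
      subst (0ℚ ≤_) (denormal x xs) (0≤* (ℚ.<⇒≤ 0<a) h) ∷ complete S x xs l u r } }
  where
  instance
    _ = ℚ.positive 0<a
    _ = ℚ.pos⇒nonZero a
  k : ℚ
  k = ℚ.1/ a
  0≤k : 0ℚ ≤ k
  0≤k = ℚ.<⇒≤ (ℚ.positive⁻¹ k {{ℚ.1/pos⇒pos a}})
  normal : ∀ x xs → k * (a * x + eval (as , c) xs) ≡ x + eval (k · (as , c)) xs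
  normal x xs rewrite eval-· k (as , c) xs = trans
    (solve 4 (λ k a x e → k :* (a :* x :+ e) := (k :* a) :* x :+ k :* e) refl k a x (eval (as , c) xs))
    (cong (_+ k * eval (as , c) xs) (trans (cong (_* x) (ℚ.*-inverseˡ a)) (ℚ.*-identityˡ x)))
  denormal : ∀ x xs → a * (x + eval (k · (as , c)) xs) ≡ a * x + eval (as , c) xs
  denormal x xs rewrite eval-· k (as , c) xs = trans
    (solve 4 (λ k a x e → a :* (x :+ k :* e) := a :* x :+ (a :* k) :* e) refl k a x (eval (as , c) xs))
    (cong (_+_ (a * x)) (trans (cong (_* eval (as , c) xs) (ℚ.*-inverseʳ a)) (ℚ.*-identityˡ _)))
... | tri> _ _ a<0 | S = record
  { lowers = lowers S ; uppers = (k · (as , c)) ∷ uppers S ; rests = rests S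
  ; M = M S + k ; 0≤M = 0≤+ (0≤M S) 0≤k
  ; sound = λ { {ε} 0≤ε x xs (h ∷ hs) → let (l , u , r) = sound S 0≤ε x xs hs in
      All.map (weaken 0≤ε (≤+ʳ {M S} 0≤k)) l , weaken 0≤ε (≤+ˡ {k} (0≤M S)) (scaled-sound 0≤k (normal x xs) h) ∷ All.map (weaken 0≤ε (≤+ʳ {M S} 0≤k)) u , All.map (weaken 0≤ε (≤+ʳ {M S} 0≤k)) r }
  ; complete = λ { x xs l (h ∷ u) r →
      subst (0ℚ ≤_) (denormal x xs) (0≤* (ℚ.<⇒≤ 0<b) h) ∷ complete S x xs l u r } }
  where
  b : ℚ
  b = - a
  0<b : 0ℚ ℚ.< b
  0<b = ℚ.neg-antimono-< a<0
  instance
    _ = ℚ.positive 0<b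
    _ = ℚ.pos⇒nonZero b
  k : ℚ
  k = ℚ.1/ b
  0≤k : 0ℚ ≤ k
  0≤k = ℚ.<⇒≤ (ℚ.positive⁻¹ k {{ℚ.1/pos⇒pos b}})
  normal : ∀ x xs → k * (a * x + eval (as , c) xs) ≡ - x + eval (k · (as , c)) xs
  normal x xs rewrite eval-· k (as , c) xs = trans
    (solve 4 (λ k a x e → k :* (a :* x :+ e) := (k :* (:- a)) :* (:- x) :+ k :* e) refl k a x (eval (as , c) xs))
    (cong (_+ k * eval (as , c) xs) (trans (cong (_* (- x)) (ℚ.*-inverseˡ b)) (ℚ.*-identityˡ (- x))))
  denormal : ∀ x xs → b * (- x + eval (k · (as , c)) xs) ≡ a * x + eval (as , c) xs
  denormal x xs rewrite eval-· k (as , c) xs = trans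
    (solve 4 (λ k a x e → (:- a) :* ((:- x) :+ k :* e) := a :* x :+ ((:- a) :* k) :* e) refl k a x (eval (as , c) xs))
    (cong (_+_ (a * x)) (trans (cong (_* eval (as , c) xs) (ℚ.*-inverseʳ b)) (ℚ.*-identityˡ _)))

-- Minimisation of the last variable

pairwise : ∀ {n} → List (Form n) → List (Form n) → List (Form n)
pairwise ps qs = List.cartesianProductWith _⊹_ ps qs

negate-⊹ : ∀ x p q → (x + p) + (- x + q) ≡ p + q
negate-⊹ = solve 3 (λ x p q → (x :+ p) :+ ((:- x) :+ q) := p :+ q) refl

above : ∀ {y z} → - y ≤ z → 0ℚ ≤ z + y
above {y} {z} h = subst (_≤ z + y) (ℚ.+-inverseˡ y) (ℚ.+-monoˡ-≤ y h)

above⁻¹ : ∀ {y z} → 0ℚ ≤ z + y → - y ≤ z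
above⁻¹ {y} {z} h = subst₂ _≤_ (ℚ.+-identityˡ (- y))
  (solve 2 (λ z y → (z :+ y) :- y := z) refl z y) (ℚ.+-monoˡ-≤ (- y) h)

pairwise-sound : ∀ {n} M ε x (xs : Vec ℚ n) ps qs →
  All (λ p → - (M * ε) ≤ x + eval p xs) ps → All (λ q → - (M * ε) ≤ - x + eval q xs) qs →
  All (λ f → - ((M + M) * ε) ≤ eval f xs) (pairwise ps qs)
pairwise-sound M ε x xs [] qs hs gs = []
pairwise-sound M ε x xs (p ∷ ps) qs (h ∷ hs) gs = All.++⁺
  (All.map⁺ (All.map (λ {q} g → subst₂ _≤_
    (solve 2 (λ m e → (:- (m :* e)) :+ (:- (m :* e)) := :- ((m :+ m) :* e)) refl M ε)
    (trans (negate-⊹ x (eval p xs) (eval q xs)) (sym (eval-⊹ p q xs)))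
    (+-mono-≤ h g)) gs))
  (pairwise-sound M ε x xs ps qs hs gs)

-- The witness is the maximum of the lower bounds and of the smallest among 0 and the upper bounds.
-- Each sum in `pairwise` says that a lower bound does not exceed an upper one.
between : ∀ {n} (xs : Vec ℚ n) ps qs → All (λ f → 0ℚ ≤ eval f xs) (pairwise ps qs) →
  ∃[ x ] (All (λ p → 0ℚ ≤ x + eval p xs) ps × All (λ q → 0ℚ ≤ - x + eval q xs) qs)
between xs [] [] _ = 0ℚ , [] , []
between xs [] (q ∷ qs) _ with between xs [] qs []
... | x , _ , hs = x ℚ.⊓ eval q xs , [] ,
  subst (0ℚ ≤_) (ℚ.+-comm (eval q xs) _) (above′ (ℚ.p⊓q≤q x (eval q xs))) ∷
  All.map (λ h → ≤-trans h (ℚ.+-monoˡ-≤ _ (ℚ.neg-antimono-≤ (ℚ.p⊓q≤p x (eval q xs))))) hs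
  where
  above′ : ∀ {y z} → y ≤ z → 0ℚ ≤ z - y
  above′ {y} {z} h = subst (_≤ z - y) (ℚ.+-inverseʳ y) (ℚ.+-monoˡ-≤ (- y) h)
between xs (p ∷ ps) qs all with between xs ps qs (All.++⁻ʳ (List.map (p ⊹_) qs) all)
... | x , hs , gs = x ℚ.⊔ l ,
  above (ℚ.p≤q⊔p x l) ∷ All.map (λ h → ≤-trans h (ℚ.+-monoˡ-≤ _ (ℚ.p≤p⊔q x l))) hs ,
  All.zipWith (λ { {q} (g , g′) → choose q g g′ }) (gs , All.map⁻ (All.++⁻ˡ (List.map (p ⊹_) qs) all))
  where
  l : ℚ
  l = - eval p xs
  choose : ∀ q → 0ℚ ≤ - x + eval q xs → 0ℚ ≤ eval (p ⊹ q) xs → 0ℚ ≤ - (x ℚ.⊔ l) + eval q xs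
  choose q g g′ with ℚ.⊔-sel x l
  ... | inj₁ eq = subst (λ z → 0ℚ ≤ - z + eval q xs) (sym eq) g
  ... | inj₂ eq = subst (λ z → 0ℚ ≤ - z + eval q xs) (sym eq)
    (subst (0ℚ ≤_) (trans (eval-⊹ p q xs)
      (solve 2 (λ p q → p :+ q := (:- (:- p)) :+ q) refl (eval p xs) (eval q xs))) g′)

-- A projection to the last coordinate, which will be the objective. Exact points lift back to `F`;
-- approximate points of `F` project with an error enlarged by a fixed factor.
record Elimination {n} (F : List (Form (suc n))) : Set where
  field
    forms : List (Form 1)
    K     : ℚ
    0≤K   : 0ℚ ≤ K
    sound′ : ∀ {ε} → 0ℚ ≤ ε → ∀ xs t → All (λ f → - ε ≤ eval f (xs Vec.∷ʳ t)) F →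
      All (λ f → - (K * ε) ≤ eval f (t ∷ [])) forms
    complete′ : ∀ t → All (λ f → 0ℚ ≤ eval f (t ∷ [])) forms →
      ∃[ xs ] All (λ f → 0ℚ ≤ eval f (xs Vec.∷ʳ t)) F

open Elimination public

eliminate : ∀ n (F : List (Form (suc n))) → Elimination F
eliminate zero F = record
  { forms = F ; K = 1ℚ ; 0≤K = 0≤1
  ; sound′ = λ { {ε} _ [] t hs → All.map (subst (_≤ _) (cong -_ (sym (ℚ.*-identityˡ ε)))) hs }
  ; complete′ = λ t hs → [] , hs }
eliminate (suc n) F = record
  { forms = forms E ; K = K E * (M S + M S) ; 0≤K = 0≤* (0≤K E) 0≤MM
  ; sound′ = λ { {ε} 0≤ε (x ∷ xs) t hs → let (l , u , r) = sound S 0≤ε x (xs Vec.∷ʳ t) hs in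
      All.map (subst (_≤ _) (cong -_ (sym (ℚ.*-assoc (K E) (M S + M S) ε))))
        (sound′ E (0≤* 0≤MM 0≤ε) xs t (All.++⁺
          (All.map (weaken 0≤ε (≤+ʳ {M S} (0≤M S))) r)
          (pairwise-sound (M S) ε x (xs Vec.∷ʳ t) (lowers S) (uppers S) l u))) }
  ; complete′ = λ t hs → let
      (xs , gs) = complete′ E t hs
      (x , l , u) = between (xs Vec.∷ʳ t) (lowers S) (uppers S) (All.++⁻ʳ (rests S) gs)
      in x ∷ xs , complete S x (xs Vec.∷ʳ t) l u (All.++⁻ˡ (rests S) gs)
  }
  where
  S : Split F
  S = split F
  E : Elimination (rests S List.++ pairwise (lowers S) (uppers S))
  E = eliminate n _
  0≤MM : 0ℚ ≤ M S + M S
  0≤MM = 0≤+ (0≤M S) (0≤M S)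

-- Violating the constraints by `ε` lowers the optimum by a bounded multiple of `ε` at most. This
-- linear stability carries minimality over to real colourings, whose rational approximations are
-- only nearly feasible.
record Optimum {n} (F : List (Form (suc n))) (k : ℚ) : Set where
  field
    point    : Vec ℚ n
    minimum  : ℚ
    feasible : All (λ f → 0ℚ ≤ eval f (point Vec.∷ʳ minimum)) F
    slack    : ℚ
    0≤slack  : 0ℚ ≤ slack
    optimal  : ∀ {ε} → 0ℚ ≤ ε → ∀ xs t → - (k * ε) ≤ t → All (λ f → - ε ≤ eval f (xs Vec.∷ʳ t)) F →
      minimum - slack * ε ≤ t

optimum : ∀ {n} (F : List (Form (suc n))) {k} → 0ℚ ≤ k → ∀ xs₀ t₀ → 0ℚ ≤ t₀ →
  All (λ f → 0ℚ ≤ eval f (xs₀ Vec.∷ʳ t₀)) F → Optimum F k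
optimum {n} F {k} 0≤k xs₀ t₀ 0≤t₀ F₀ = record
  { point = proj₁ solution ; minimum = t⋆ ; feasible = proj₂ solution
  ; slack = M S * K E + k ; 0≤slack = 0≤+ (0≤* (0≤M S) (0≤K E)) 0≤k
  ; optimal = λ {ε} 0≤ε xs t 0≤t hs → highest-least (lowers S)
      (≤-trans (≤-reflexive (ℚ.+-identityˡ _)) (weaken 0≤ε (≤+ˡ {k} (0≤* (0≤M S) (0≤K E))) 0≤t))
      (All.map (λ {p} h → lower-bound {p} (weaken 0≤ε (≤+ʳ {M S * K E} 0≤k)
          (subst (_≤ _) (cong -_ (sym (ℚ.*-assoc (M S) (K E) ε))) h)))
        (proj₁ (sound S (0≤* (0≤K E) 0≤ε) t [] (sound′ E 0≤ε xs t hs))))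
  }
  where
  E : Elimination F
  E = eliminate n F
  S : Split (forms E)
  S = split (forms E)
  highest : List (Form 0) → ℚ
  -- The initial value 0 covers an empty list of lower bounds; in `optimal` the assumption
  -- `- (k * ε) ≤ t` accounts for it.
  highest = List.foldr (λ p x → - eval p [] ℚ.⊔ x) 0ℚ
  t⋆ : ℚ
  t⋆ = highest (lowers S)
  bounds₀ : All (λ p → - (M S * 0ℚ) ≤ t₀ + eval p []) (lowers S) ×
    All (λ q → - (M S * 0ℚ) ≤ - t₀ + eval q []) (uppers S) × All (λ r → - (M S * 0ℚ) ≤ eval r []) (rests S)
  bounds₀ = sound S ≤-refl t₀ [] (All.map (subst (_≤ _) (cong -_ (ℚ.*-zeroʳ (K E))))
    (sound′ E ≤-refl xs₀ t₀ F₀))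
  exact : ∀ {y} → - (M S * 0ℚ) ≤ y → 0ℚ ≤ y
  exact = subst (_≤ _) (cong -_ (ℚ.*-zeroʳ (M S)))
  highest-≤ : ∀ {y} ps → 0ℚ ≤ y → All (λ p → - eval p [] ≤ y) ps → highest ps ≤ y
  highest-≤ [] 0≤y [] = 0≤y
  highest-≤ (p ∷ ps) 0≤y (h ∷ hs) = ℚ.⊔-lub h (highest-≤ ps 0≤y hs)
  highest-least : ∀ {y z} ps → 0ℚ - y ≤ z → All (λ p → - eval p [] - y ≤ z) ps → highest ps - y ≤ z
  highest-least {y} {z} ps h hs = shift-back (highest-≤ ps (shift-on h) (All.map shift-on hs))
    where
    shift-on : ∀ {x} → x - y ≤ z → x ≤ z + y
    shift-on {x} h = subst (_≤ z + y) (solve 2 (λ x y → (x :- y) :+ y := x) refl x y) (ℚ.+-monoˡ-≤ y h)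
    shift-back : ∀ {x} → x ≤ z + y → x - y ≤ z
    shift-back {x} h = subst (x - y ≤_) (solve 2 (λ z y → (z :+ y) :- y := z) refl z y) (ℚ.+-monoˡ-≤ (- y) h)
  lower-bound : ∀ {p : Form 0} {y t} → - y ≤ t + eval p [] → - eval p [] - y ≤ t
  lower-bound {p} {y} {t} h = subst₂ _≤_ (ℚ.+-comm (- y) (- eval p []))
    (solve 2 (λ t p → (t :+ p) :- p := t) refl t (eval p [])) (ℚ.+-monoˡ-≤ (- eval p []) h)
  highest-above : ∀ ps → All (λ p → 0ℚ ≤ highest ps + eval p []) ps
  highest-above [] = []
  highest-above (p ∷ ps) = above (ℚ.p≤p⊔q (- eval p []) (highest ps)) ∷
    All.map (λ h → ≤-trans h (ℚ.+-monoˡ-≤ _ (ℚ.p≤q⊔p (- eval p []) (highest ps)))) (highest-above ps)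
  t⋆≤t₀ : t⋆ ≤ t₀
  t⋆≤t₀ = highest-≤ (lowers S) 0≤t₀ (All.map (above⁻¹ ∘ exact) (proj₁ bounds₀))
  solution : ∃[ xs ] All (λ f → 0ℚ ≤ eval f (xs Vec.∷ʳ t⋆)) F
  solution = complete′ E t⋆ (complete S t⋆ [] (highest-above (lowers S))
    (All.map (λ h → ≤-trans (exact h) (ℚ.+-monoˡ-≤ _ (ℚ.neg-antimono-≤ t⋆≤t₀))) (proj₁ (proj₂ bounds₀)))
    (All.map exact (proj₂ (proj₂ bounds₀))))

-- Existence of the fractional chromatic number

Σᴸ : {X : Set} → (X → ℚ) → List X → ℚ
Σᴸ f []       = 0ℚ
Σᴸ f (x ∷ xs) = f x + Σᴸ f xs

Σᴸ-mono : {X : Set} {f g : X → ℚ} → ∀ xs → All (λ x → f x ≤ g x) xs → Σᴸ f xs ≤ Σᴸ g xs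
Σᴸ-mono [] [] = ≤-refl
Σᴸ-mono (x ∷ xs) (h ∷ hs) = +-mono-≤ h (Σᴸ-mono xs hs)

Σᴸ-* : {X : Set} (k : ℚ) (f : X → ℚ) → ∀ xs → Σᴸ (λ x → k * f x) xs ≡ k * Σᴸ f xs
Σᴸ-* k f [] = sym (ℚ.*-zeroʳ k)
Σᴸ-* k f (x ∷ xs) rewrite Σᴸ-* k f xs = sym (ℚ.*-distribˡ-+ k (f x) (Σᴸ f xs))

Σᴸ-filter : {X : Set} {Q : X → Set} (Q? : ∀ x → Dec (Q x)) (f : X → ℚ) → ∀ xs →
  Σᴸ f (List.filter Q? xs) ≡ Σᴸ (λ x → χ (does (Q? x)) * f x) xs
Σᴸ-filter Q? f [] = refl
Σᴸ-filter Q? f (x ∷ xs) with does (Q? x)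
... | true  = cong₂ _+_ (sym (ℚ.*-identityˡ (f x))) (Σᴸ-filter Q? f xs)
... | false = trans (Σᴸ-filter Q? f xs) (solve 2 (λ y z → z := con 0ℚ :* y :+ z) refl (f x) _)

values : {X : Set} → (X → ℚ) → (xs : List X) → Vec ℚ (List.length xs)
values f []       = []
values f (x ∷ xs) = f x ∷ values f xs

eval-values : {X : Set} (κ w : X → ℚ) (b c t : ℚ) → ∀ xs →
  eval (values κ xs Vec.∷ʳ b , c) (values w xs Vec.∷ʳ t) ≡ Σᴸ (λ x → κ x * w x) xs + (b * t + c)
eval-values κ w b c t [] = sym (ℚ.+-identityˡ _)
eval-values κ w b c t (x ∷ xs) rewrite eval-values κ w b c t xs =
  sym (ℚ.+-assoc (κ x * w x) (Σᴸ (λ x → κ x * w x) xs) (b * t + c))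

zeros : ∀ {n} → Vec ℚ n
zeros = Vec.replicate _ 0ℚ

eval-zeros : ∀ {n} (xs : Vec ℚ n) → eval (zeros , 0ℚ) xs ≡ 0ℚ
eval-zeros [] = refl
eval-zeros (x ∷ xs) rewrite eval-zeros xs = solve 1 (λ x → con 0ℚ :* x :+ con 0ℚ := con 0ℚ) refl x

units : ∀ n → List (Form (suc n))
units zero    = []
units (suc n) = (1ℚ ∷ zeros , 0ℚ) ∷ List.map (λ { (as , c) → 0ℚ ∷ as , c }) (units n)

unit-head : ∀ {n} x (xs : Vec ℚ n) → eval (1ℚ ∷ zeros , 0ℚ) (x ∷ xs) ≡ x
unit-head x xs rewrite eval-zeros xs = solve 1 (λ x → con 1ℚ :* x :+ con 0ℚ := x) refl x

unit-tail : ∀ x e → e ≡ 0ℚ * x + e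
unit-tail = solve 2 (λ x e → e := con 0ℚ :* x :+ e) refl

module _ {X : Set} {l : ℚ} (w : X → ℚ) (t : ℚ) where

  units⁺ : ∀ xs → All (λ x → l ≤ w x) xs → All (λ f → l ≤ eval f (values w xs Vec.∷ʳ t)) (units (List.length xs))
  units⁺ [] [] = []
  units⁺ (x ∷ xs) (h ∷ hs) = subst (l ≤_) (sym (unit-head (w x) (values w xs Vec.∷ʳ t))) h ∷
    All.map⁺ (All.map (λ {f} → subst (l ≤_) (unit-tail (w x) (eval f (values w xs Vec.∷ʳ t)))) (units⁺ xs hs))

  units⁻ : ∀ xs → All (λ f → l ≤ eval f (values w xs Vec.∷ʳ t)) (units (List.length xs)) → All (λ x → l ≤ w x) xs
  units⁻ [] [] = []
  units⁻ (x ∷ xs) (h ∷ hs) = subst (l ≤_) (unit-head (w x) (values w xs Vec.∷ʳ t)) h ∷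
    units⁻ xs (All.map (λ {f} → subst (l ≤_) (sym (unit-tail (w x) (eval f (values w xs Vec.∷ʳ t))))) (All.map⁻ hs))

module _ {X : Set} (_≟_ : ∀ (x y : X) → Dec (x ≡ y)) where

  assign : (xs : List X) → Vec ℚ (List.length xs) → X → ℚ
  assign []       []       y = 0ℚ
  assign (x ∷ xs) (a ∷ as) y = if does (x ≟ y) then a else assign xs as y

  values-cong : ∀ {f g : X → ℚ} xs → All (λ x → f x ≡ g x) xs → values f xs ≡ values g xs
  values-cong [] [] = refl
  values-cong (x ∷ xs) (h ∷ hs) = cong₂ _∷_ h (values-cong xs hs)

  values-assign : ∀ xs as → Unique xs → values (assign xs as) xs ≡ as
  values-assign [] [] [] = refl
  values-assign (x ∷ xs) (a ∷ as) (x∉ ∷ u) = cong₂ _∷_ first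
    (trans (values-cong xs (All.map later x∉)) (values-assign xs as u))
    where
    first : assign (x ∷ xs) (a ∷ as) x ≡ a
    first rewrite dec-true (x ≟ x) refl = refl
    later : ∀ {y} → x ≢ y → assign (x ∷ xs) (a ∷ as) y ≡ assign xs as y
    later {y} x≢y rewrite dec-false (x ≟ y) x≢y = refl

  assign-nonneg : ∀ xs as → (∀ {x} → x ∈ˡ xs → 0ℚ ≤ assign xs as x) → ∀ y → 0ℚ ≤ assign xs as y
  assign-nonneg xs as h y with any-member xs
    where
    any-member : ∀ xs → Dec (y ∈ˡ xs)
    any-member = Any.any? (y ≟_)
  ... | yes y∈ = h y∈
  ... | no  y∉ = ≤-reflexive (sym (absent xs as y∉))
    where
    absent : ∀ xs as → ¬ y ∈ˡ xs → assign xs as y ≡ 0ℚ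
    absent [] [] _ = refl
    absent (x ∷ xs) (a ∷ as) y∉ rewrite dec-false (x ≟ y) (y∉ ∘ Any.here ∘ sym) = absent xs as (y∉ ∘ Any.there)

_≟ˢ_ : ∀ {n} (S T : Subset n) → Dec (S ≡ T)
_≟ˢ_ = Vec.≡-dec Bool._≟_

subsets-unique : ∀ n → Unique (subsets n)
subsets-unique zero    = [] ∷ []
subsets-unique (suc n) = Unique.++⁺
  (Unique.map⁺ Vec.∷-injectiveʳ (subsets-unique n)) (Unique.map⁺ Vec.∷-injectiveʳ (subsets-unique n))
  λ { (S∈ , T∈) → different (Membership.∈-map⁻ (outside ∷_) S∈) (Membership.∈-map⁻ (inside ∷_) T∈) }
  where
  different : ∀ {S : Subset (suc n)} → ∃[ T ] (T ∈ˡ subsets n × S ≡ outside ∷ T) →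
    ∃[ T ] (T ∈ˡ subsets n × S ≡ inside ∷ T) → ⊥
  different (_ , _ , refl) (_ , _ , ())

subsets-complete : ∀ {n} (S : Subset n) → S ∈ˡ subsets n
subsets-complete [] = Any.here refl
subsets-complete (outside ∷ S) = Membership.∈-++⁺ˡ (Membership.∈-map⁺ (outside ∷_) (subsets-complete S))
subsets-complete (inside ∷ S) =
  Membership.∈-++⁺ʳ (List.map (outside ∷_) (subsets _)) (Membership.∈-map⁺ (inside ∷_) (subsets-complete S))

constant-≤ᵣ : ∀ {p q} → p ≤ q → fromℚ p ≤ᵣ fromℚ q
constant-≤ᵣ p≤q ε 0<ε = 0 , λ _ _ → ≤-trans p≤q (≤+ʳ (ℚ.<⇒≤ 0<ε))

seq-sum : {X : Set} (f : X → ℝ) → ∀ xs n → seq (sumᵣ (List.map f xs)) n ≡ Σᴸ (λ x → seq (f x) n) xs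
seq-sum f []       n = refl
seq-sum f (x ∷ xs) n = cong (_+_ (seq (f x) n)) (seq-sum f xs n)

Eventually : (ℕ → Set) → Set
Eventually P = ∃[ N ] (∀ n → N ℕ.≤ n → P n)

eventually-All : {X : Set} {P : X → ℕ → Set} → ∀ xs → All (λ x → Eventually (P x)) xs →
  Eventually λ n → All (λ x → P x n) xs
eventually-All [] [] = 0 , λ _ _ → []
eventually-All (x ∷ xs) ((M , h) ∷ hs) with eventually-All xs hs
... | N , hs′ = M ℕ.⊔ N , λ n ≤n → h n (ℕ.m⊔n≤o⇒m≤o M N ≤n) ∷ hs′ n (ℕ.m⊔n≤o⇒n≤o M N ≤n)

small-multiple : ∀ {s ε} → 0ℚ ≤ s → 0ℚ ℚ.< ε → ∃[ δ ] (0ℚ ℚ.< δ × s * δ ≤ ε)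
small-multiple {s} {ε} 0≤s 0<ε = ε * k , subst (ℚ._< ε * k) (ℚ.*-zeroˡ k) (ℚ.*-monoˡ-<-pos k 0<ε) , (begin
  s * (ε * k)         ≤⟨ *-monoʳ (0≤* (ℚ.<⇒≤ 0<ε) (ℚ.<⇒≤ (ℚ.positive⁻¹ k))) (≤+ʳ {s} 0≤1) ⟩
  (s + 1ℚ) * (ε * k)  ≡⟨ rearrange (s + 1ℚ) ε k ⟩
  ε * ((s + 1ℚ) * k)  ≡⟨ cong (ε *_) (ℚ.*-inverseʳ (s + 1ℚ)) ⟩
  ε * 1ℚ              ≡⟨ ℚ.*-identityʳ ε ⟩
  ε                   ∎)
  where
  open ℚ.≤-Reasoning
  instance
    s+1-positive : ℚ.Positive (s + 1ℚ)
    s+1-positive = ℚ.positive (ℚ.<-≤-trans (ℚ.positive⁻¹ 1ℚ) (≤+ˡ 0≤s))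
    s+1-nonZero : ℚ.NonZero (s + 1ℚ)
    s+1-nonZero = ℚ.pos⇒nonZero (s + 1ℚ)
  k : ℚ
  k = ℚ.1/ (s + 1ℚ)
  instance
    k-positive : ℚ.Positive k
    k-positive = ℚ.1/pos⇒pos (s + 1ℚ)
  rearrange : ∀ a b c → a * (b * c) ≡ b * (a * c)
  rearrange = solve 3 (λ a b c → a :* (b :* c) := b :* (a :* c)) refl

module ChromaticNumber (G : Graph) where

  open Graph G

  sets : List (Subset order)
  sets = independentSets G

  sets-unique : Unique sets
  sets-unique = Unique.filter⁺ (independent? G) (subsets-unique order)

  sets-complete : ∀ {S} → Independent G S → S ∈ˡ sets
  sets-complete ind = Membership.∈-filter⁺ (independent? G) (subsets-complete _) ind

  sets-independent : ∀ {S} → S ∈ˡ sets → Independent G S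
  sets-independent S∈ = proj₂ (Membership.∈-filter⁻ (independent? G) {xs = subsets order} S∈)

  containing : Vertex → List (Subset order)
  containing v = List.filter (v ∈?_) sets

  cover : Vertex → Form (suc (List.length sets))
  cover v = values (λ S → χ (does (v ∈? S))) sets Vec.∷ʳ 0ℚ , - 1ℚ

  bound : Form (suc (List.length sets))
  bound = values (λ _ → - 1ℚ) sets Vec.∷ʳ 1ℚ , 0ℚ

  -- The last variable dominates the total weight, so that minimising the total means minimising a
  -- coordinate.
  program : List (Form (suc (List.length sets)))
  program = bound ∷ (units (List.length sets) List.++ List.map cover (List.allFin order))

  size : ℚ
  size = Σᴸ (λ _ → 1ℚ) sets

  module _ (w : Subset order → ℚ) (t : ℚ) where

    eval-cover : ∀ v → eval (cover v) (values w sets Vec.∷ʳ t) ≡ Σᴸ w (containing v) - 1ℚ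
    eval-cover v = trans (eval-values _ w 0ℚ (- 1ℚ) t sets) (cong₂ _+_ (sym (Σᴸ-filter (v ∈?_) w sets))
      (trans (cong (_+ - 1ℚ) (ℚ.*-zeroˡ t)) (ℚ.+-identityˡ (- 1ℚ))))

    eval-bound : eval bound (values w sets Vec.∷ʳ t) ≡ t - Σᴸ w sets
    eval-bound = trans (eval-values _ w 1ℚ 0ℚ t sets) (trans (cong (_+ (1ℚ * t + 0ℚ)) (Σᴸ-* (- 1ℚ) w sets))
      (solve 2 (λ s t → (:- con 1ℚ) :* s :+ (con 1ℚ :* t :+ con 0ℚ) := t :- s) refl (Σᴸ w sets) t))

    record Colours (ε : ℚ) : Set where
      field
        weights≥ : All (λ S → - ε ≤ w S) sets
        covers≥  : ∀ v → 1ℚ ≤ Σᴸ w (containing v) + ε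
        total≤   : Σᴸ w sets ≤ t + ε

    program⁺ : ∀ {ε} → Colours ε → All (λ f → - ε ≤ eval f (values w sets Vec.∷ʳ t)) program
    program⁺ {ε} c = subst (- ε ≤_) (sym eval-bound) (rearrange (Σᴸ w sets) t total≤) ∷ All.++⁺
      (units⁺ w t sets weights≥)
      (All.map⁺ (All.universal (λ v → subst (- ε ≤_) (sym (eval-cover v)) (rearrange 1ℚ (Σᴸ w (containing v)) (covers≥ v))) _))
      where
      open Colours c
      rearrange : ∀ x y → x ≤ y + ε → - ε ≤ y - x
      rearrange x y h = subst₂ _≤_ (solve 2 (λ x e → x :+ (:- (x :+ e)) := :- e) refl x ε)
        (solve 3 (λ x y e → (y :+ e) :+ (:- (x :+ e)) := y :- x) refl x y ε) (ℚ.+-monoˡ-≤ (- (x + ε)) h)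

    program⁻ : All (λ f → 0ℚ ≤ eval f (values w sets Vec.∷ʳ t)) program → Colours 0ℚ
    program⁻ (b ∷ hs) = record
      { weights≥ = units⁻ w t sets (All.++⁻ˡ (units (List.length sets)) hs)
      ; covers≥  = λ v → rearrange 1ℚ (Σᴸ w (containing v)) (subst (0ℚ ≤_) (eval-cover v)
          (All.lookup (All.map⁻ (All.++⁻ʳ (units (List.length sets)) hs)) (Membership.∈-allFin v)))
      ; total≤   = rearrange (Σᴸ w sets) t (subst (0ℚ ≤_) eval-bound b)
      }
      where
      rearrange : ∀ x y → 0ℚ ≤ y - x → x ≤ y + 0ℚ
      rearrange x y h = subst₂ _≤_ (ℚ.+-identityˡ x)
        (solve 2 (λ x y → (y :- x) :+ x := y :+ con 0ℚ) refl x y) (ℚ.+-monoˡ-≤ x h)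

    -- This is the a priori bound that `Optimum` asks for: each set contributes at least `- ε` to
    -- the total, and `total≤` costs one more `ε`.
    total≥ : ∀ {ε} → Colours ε → - ((size + 1ℚ) * ε) ≤ t
    total≥ {ε} c = subst₂ _≤_ (solve 2 (λ s e → (:- e) :* s :- e := :- ((s :+ con 1ℚ) :* e)) refl size ε)
      (solve 2 (λ t e → (t :+ e) :- e := t) refl t ε)
      (ℚ.+-monoˡ-≤ (- ε) (≤-trans (≤-trans
        (≤-reflexive (sym (Σᴸ-* (- ε) (λ _ → 1ℚ) sets)))
        (Σᴸ-mono sets (All.map (≤-trans (≤-reflexive (ℚ.*-identityʳ (- ε)))) (Colours.weights≥ c))))
        (Colours.total≤ c)))

  -- There are finitely many constraints, each of which holds up to `δ` from some index on; beyond
  -- the largest of these indices the rational approximations satisfy all of them together.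
  eventually-colours : ∀ (c : FractionalColouring G) x → FractionalColouring.total c ≤ᵣ x → ∀ δ → 0ℚ ℚ.< δ →
    Eventually λ n → Colours (λ S → seq (FractionalColouring.weight c S) n) (seq x n) δ
  eventually-colours c x total≤x δ 0<δ = let (N₁ , h₁) = ev₁ ; (N₂ , h₂) = ev₂ ; (N₃ , h₃) = ev₃ in
    N₁ ℕ.⊔ (N₂ ℕ.⊔ N₃) , λ n ≤n → let ≤n′ = ℕ.m⊔n≤o⇒n≤o N₁ (N₂ ℕ.⊔ N₃) ≤n in record
      { weights≥ = h₁ n (ℕ.m⊔n≤o⇒m≤o N₁ (N₂ ℕ.⊔ N₃) ≤n)
      ; covers≥  = λ v → All.lookup (h₂ n (ℕ.m⊔n≤o⇒m≤o N₂ N₃ ≤n′)) (Membership.∈-allFin v)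
      ; total≤   = h₃ n (ℕ.m⊔n≤o⇒n≤o N₂ N₃ ≤n′) }
    where
    open FractionalColouring c using (weight; covers)
    w : ℕ → Subset order → ℚ
    w n S = seq (weight S) n
    ev₁ : Eventually λ n → All (λ S → - δ ≤ w n S) sets
    ev₁ = eventually-All sets (All.tabulate λ {S} S∈ →
      let (N , h) = FractionalColouring.nonneg c {S} (sets-independent S∈) δ 0<δ in
      N , λ n N≤n → subst₂ _≤_ (ℚ.+-identityˡ (- δ)) (solve 2 (λ y d → (y :+ d) :- d := y) refl (w n S) δ)
        (ℚ.+-monoˡ-≤ (- δ) (h n N≤n)))
    ev₂ : Eventually λ n → All (λ v → 1ℚ ≤ Σᴸ (w n) (containing v) + δ) (List.allFin order)
    ev₂ = eventually-All (List.allFin order) (All.universal (λ v → let (N , h) = covers v δ 0<δ in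
      N , λ n N≤n → subst (λ z → 1ℚ ≤ z + δ) (seq-sum weight (containing v) n) (h n N≤n)) (List.allFin order))
    ev₃ : Eventually λ n → Σᴸ (w n) sets ≤ seq x n + δ
    ev₃ = let (N , h) = total≤x δ 0<δ in
      N , λ n N≤n → subst (_≤ seq x n + δ) (seq-sum weight sets n) (h n N≤n)

  optimum⇒chromatic-number : Optimum program (size + 1ℚ) → ∀ w t → Colours w t 0ℚ →
    ∃[ χ ] (IsFractionalChromaticNumber G χ × χ ≤ᵣ fromℚ t)
  optimum⇒chromatic-number O w₀ t₀ c₀ = fromℚ minimum ,
    ((colouring , total≤minimum , minimum≤total) , λ {x} → least {x}) , constant-≤ᵣ (at-least w₀ t₀ c₀)
    where
    open Optimum O
    w⋆ : Subset order → ℚ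
    w⋆ = assign _≟ˢ_ sets point
    c⋆ : Colours w⋆ minimum 0ℚ
    c⋆ = program⁻ w⋆ minimum (subst (λ xs → All (λ f → 0ℚ ≤ eval f (xs Vec.∷ʳ minimum)) program)
      (sym (values-assign _≟ˢ_ sets point sets-unique)) feasible)
    w⋆-nonneg : ∀ S → 0ℚ ≤ w⋆ S
    w⋆-nonneg = assign-nonneg _≟ˢ_ sets point (All.lookup (Colours.weights≥ c⋆))
    total-at : ∀ n → seq (sumᵣ (List.map (fromℚ ∘ w⋆) sets)) n ≡ Σᴸ w⋆ sets
    total-at = seq-sum (fromℚ ∘ w⋆) sets
    colouring : FractionalColouring G
    colouring = record
      { weight = fromℚ ∘ w⋆
      ; nonneg = λ {S} _ → constant-≤ᵣ (w⋆-nonneg S)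
      ; covers = λ v ε 0<ε → 0 , λ n _ → ≤-trans (Colours.covers≥ c⋆ v) (+-mono-≤
          (≤-reflexive (sym (seq-sum (fromℚ ∘ w⋆) (containing v) n))) (ℚ.<⇒≤ 0<ε))
      }
    at-least : ∀ w t → Colours w t 0ℚ → minimum ≤ t
    at-least w t c = subst (_≤ t) (solve 2 (λ m s → m :- s :* con 0ℚ := m) refl minimum slack)
      (optimal ≤-refl (values w sets) t (total≥ w t c) (program⁺ w t c))
    total≤minimum : FractionalColouring.total colouring ≤ᵣ fromℚ minimum
    total≤minimum ε 0<ε = 0 , λ n _ → ≤-trans (≤-reflexive (total-at n))
      (≤-trans (Colours.total≤ c⋆) (ℚ.+-monoʳ-≤ minimum (ℚ.<⇒≤ 0<ε)))
    minimum≤total : fromℚ minimum ≤ᵣ FractionalColouring.total colouring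
    minimum≤total ε 0<ε = 0 , λ n _ → ≤-trans
      (at-least w⋆ (Σᴸ w⋆ sets) record
        { weights≥ = Colours.weights≥ c⋆ ; covers≥ = Colours.covers≥ c⋆
        ; total≤ = ≤-reflexive (sym (ℚ.+-identityʳ (Σᴸ w⋆ sets))) })
      (≤-trans (≤-reflexive (sym (total-at n))) (≤+ʳ (ℚ.<⇒≤ 0<ε)))
    least : ∀ {x} → Σ[ c ∈ FractionalColouring G ] FractionalColouring.total c ≃ᵣ x → fromℚ minimum ≤ᵣ x
    least {x} (c , total≤x , _) ε 0<ε =
      let (δ , 0<δ , slackδ≤ε) = small-multiple 0≤slack 0<ε
          (N , colours) = eventually-colours c x total≤x δ 0<δ
      in N , λ n N≤n → subst (_≤ seq x n + ε)
        (solve 2 (λ a b → (a :- b) :+ b := a) refl minimum (slack * δ))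
        (+-mono-≤ (optimal (ℚ.<⇒≤ 0<δ) (values (λ S → seq (FractionalColouring.weight c S) n) sets) (seq x n)
          (total≥ _ (seq x n) (colours n N≤n)) (program⁺ _ (seq x n) (colours n N≤n))) slackδ≤ε)

  fractional-chromatic-number : ∀ w t → Colours w t 0ℚ →
    ∃[ χ ] (IsFractionalChromaticNumber G χ × χ ≤ᵣ fromℚ t)
  fractional-chromatic-number w t c = optimum⇒chromatic-number
    (optimum program 0≤size+1 (values w sets) t 0≤t (program⁺ w t c)) w t c
    where
    0≤size+1 : 0ℚ ≤ size + 1ℚ
    0≤size+1 = 0≤+ (subst (_≤ size) (trans (Σᴸ-* 0ℚ (λ _ → 1ℚ) sets) (ℚ.*-zeroˡ size))
      (Σᴸ-mono sets (All.universal (λ _ → 0≤1) sets))) 0≤1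
    0≤t : 0ℚ ≤ t
    0≤t = subst (_≤ t) (cong -_ (ℚ.*-zeroʳ (size + 1ℚ))) (total≥ w t c)

-- Colourings from random independent sets

count-≤ : ∀ {n} {T : Subset n} xs → Unique xs → Σᴸ (λ S → χ (does (T ≟ˢ S))) xs ≤ 1ℚ
count-≤ [] _ = 0≤1
count-≤ {T = T} (S ∷ xs) (S∉ ∷ u) with T ≟ˢ S
... | no  _    = ≤-trans (≤-reflexive (ℚ.+-identityˡ _)) (count-≤ {T = T} xs u)
... | yes refl = ≤-reflexive (trans (cong (_+_ 1ℚ) (absent xs S∉)) (ℚ.+-identityʳ 1ℚ))
  where
  absent : ∀ xs → All (T ≢_) xs → Σᴸ (λ S → χ (does (T ≟ˢ S))) xs ≡ 0ℚ
  absent [] [] = refl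
  absent (S ∷ xs) (T≢S ∷ h) rewrite dec-false (T ≟ˢ S) T≢S = trans (ℚ.+-identityˡ _) (absent xs h)

count-≥ : ∀ {n} {T : Subset n} {xs} → T ∈ˡ xs → 1ℚ ≤ Σᴸ (λ S → χ (does (T ≟ˢ S))) xs
count-≥ {T = T} {S ∷ xs} (Any.here refl) rewrite dec-true (T ≟ˢ T) refl = ≤+ʳ (nonneg-sum xs)
  where
  nonneg-sum : ∀ xs → 0ℚ ≤ Σᴸ (λ S → χ (does (T ≟ˢ S))) xs
  nonneg-sum []       = ≤-refl
  nonneg-sum (S ∷ xs) = 0≤+ (0≤χ (does (T ≟ˢ S))) (nonneg-sum xs)
count-≥ {T = T} {S ∷ xs} (Any.there T∈) = ≤-trans (count-≥ {T = T} T∈) (≤+ˡ (0≤χ (does (T ≟ˢ S))))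

Σᴸ-𝔼 : {X Y : Set} (P : Probability Y) (f : X → Y → ℚ) → ∀ xs →
  Σᴸ (λ x → 𝔼 P (f x)) xs ≡ 𝔼 P λ y → Σᴸ (λ x → f x y) xs
Σᴸ-𝔼 P f []       = sym (∫-const₁ P 0ℚ)
Σᴸ-𝔼 P f (x ∷ xs) = trans (cong (_+_ (𝔼 P (f x))) (Σᴸ-𝔼 P f xs)) (sym (∫-+ (measure P) (f x) _))

random-colouring : ∀ G {Y} (P : Probability Y) (I : Y → Subset (Graph.order G)) →
  (∀ y → Independent G (I y)) → ∀ {r} → 0ℚ ≤ r →
  (∀ v → 1ℚ ≤ r * 𝔼 P λ y → χ (lookup (I y) v)) →
  ∃[ χ ] (IsFractionalChromaticNumber G χ × χ ≤ᵣ fromℚ r)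
random-colouring G P I independent {r} 0≤r likely = fractional-chromatic-number w r record
  { weights≥ = All.universal (λ S → 0≤* 0≤r (∫-nonneg (measure P) λ y → 0≤χ (does (I y ≟ˢ S)))) sets
  ; covers≥  = λ v → ≤-trans (likely v) (≤-trans (*-monoˡ 0≤r (∫-mono (measure P) (member v)))
      (≤-reflexive (trans (sym (sum-weights (containing v))) (sym (ℚ.+-identityʳ (Σᴸ w (containing v)))))))
  ; total≤   = ≤-trans (≤-reflexive (sum-weights sets)) (≤-trans
      (*-monoˡ 0≤r (≤-trans (∫-mono (measure P) λ y → count-≤ {T = I y} sets sets-unique) (≤-reflexive (mass≡1 P))))
      (≤-reflexive (trans (ℚ.*-identityʳ r) (sym (ℚ.+-identityʳ r)))))
  }
  where
  open ChromaticNumber G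
  w : Subset (Graph.order G) → ℚ
  w S = r * 𝔼 P λ y → χ (does (I y ≟ˢ S))
  sum-weights : ∀ xs → Σᴸ w xs ≡ r * 𝔼 P λ y → Σᴸ (λ S → χ (does (I y ≟ˢ S))) xs
  sum-weights xs = trans (Σᴸ-* r (λ S → 𝔼 P λ y → χ (does (I y ≟ˢ S))) xs)
    (cong (r *_) (Σᴸ-𝔼 P (λ S y → χ (does (I y ≟ˢ S))) xs))
  member : ∀ v y → χ (lookup (I y) v) ≤ Σᴸ (λ S → χ (does (I y ≟ˢ S))) (containing v)
  member v y with lookup (I y) v in eq
  ... | true  = count-≥ {T = I y} (Membership.∈-filter⁺ (v ∈?_) (sets-complete (independent y)) (Vec.lookup⇒[]= v (I y) eq))
  ... | false = nonneg-sum (containing v)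
    where
    nonneg-sum : ∀ xs → 0ℚ ≤ Σᴸ (λ S → χ (does (I y ≟ˢ S))) xs
    nonneg-sum []       = ≤-refl
    nonneg-sum (S ∷ xs) = 0≤+ (0≤χ (does (I y ≟ˢ S))) (nonneg-sum xs)

-- The bound for cubic graphs of large girth

module _ {n} (ks : Vec Bool n) (J : ℕ) (large : ι 5000 ≤ ι 11489 * total-gain J ks) where

  open MessageLaw side ks

  private
    depth : ℕ
    depth = proj₁ (selection-bound J)

    girth : ℕ
    -- Two overlapping branches at a vertex yield a repetition in a non-backtracking walk on at most
    -- 2 · `depth` + 1 vertices.
    girth = suc (depth ℕ.+ depth)

    module _ (G : Graph) (cubic : Cubic G) (large-girth : GirthAtLeast girth G) where

      open Graph G

      slots : Slots G
      slots = cubic-slots G cubic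

      open Messages slots ks

      set : Labelling → Subset order
      set ω = Vec.tabulate (selected ω depth)

      in-set : ∀ ω {v} → v ∈ set ω → selected ω depth v ≡ true
      in-set ω {v} v∈ = trans (sym (Vec.lookup∘tabulate (selected ω depth) v)) (Vec.[]=⇒lookup v∈)

      set-independent : ∀ ω → Independent G (set ω)
      set-independent ω u v u∈ v∈ u~v = selected-independent ω depth u~v (in-set ω u∈) (in-set ω v∈)

      likely : ∀ v → 1ℚ ≤ (+ 22978 / 10000) * 𝔼 (labelling side) λ ω → χ (lookup (set ω) v)
      likely v = ℚ.*-cancelˡ-≤-pos (ι 5000) (begin
        ι 5000 * 1ℚ                                 ≡⟨ ℚ.*-identityʳ (ι 5000) ⟩
        ι 5000                                      ≤⟨ large ⟩
        ι 11489 * total-gain J ks                   ≤⟨ *-monoˡ (0≤ι 11489) (proj₂ (selection-bound J)) ⟩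
        ι 11489 * Selection.V₃ side ks (measure (law depth))
          ≡⟨ cong (ι 11489 *_) (sym probability) ⟩
        ι 11489 * p                                 ≡⟨ cong (_* p) (refl {x = ι 5000 * (+ 22978 / 10000)}) ⟩
        ι 5000 * (+ 22978 / 10000) * p              ≡⟨ ℚ.*-assoc (ι 5000) (+ 22978 / 10000) p ⟩
        ι 5000 * ((+ 22978 / 10000) * p)            ∎)
        where
        open ℚ.≤-Reasoning
        p : ℚ
        p = 𝔼 (labelling side) λ ω → χ (lookup (set ω) v)
        probability : p ≡ Selection.V₃ side ks (measure (law depth))
        probability = trans
          (∫-cong (measure (labelling side)) λ ω → cong χ (Vec.lookup∘tabulate (selected ω depth) v))
          (selected-law side depth v (Locally.treelike slots ks (girth⇒no-short G large-girth) side depth v ℕ.≤-refl))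

      colourable : ∃[ χ ] (IsFractionalChromaticNumber G χ × χ ≤ᵣ fromℚ (+ 22978 / 10000))
      colourable = random-colouring G (labelling side) set set-independent
        (ℚ.nonNegative⁻¹ (+ 22978 / 10000)) likely

  large-gain⇒bound : ∃[ g ] (0 < g ×
    (∀ (G : Graph) → Cubic G → GirthAtLeast g G →
      ∃[ χ ] (IsFractionalChromaticNumber G χ × χ ≤ᵣ fromℚ (+ 22978 / 10000))))
  large-gain⇒bound = girth , ℕ.s≤s ℕ.z≤n , colourable

corollary3 :
  ∃[ g ] (0 < g ×
    (∀ (G : Graph) → Cubic G → GirthAtLeast g G →
      ∃[ χ ] (IsFractionalChromaticNumber G χ × χ ≤ᵣ fromℚ (+ 22978 / 10000))))
-- The last `refl` carries out the computation: 620 transitions, each with 70 iterations for the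
-- mergers within a round.
corollary3 = large-gain⇒bound schedule 70 (large-gain 70 D unit refl schedule refl)
  where
  unit D : ℕ
  -- The factor 90000 = 300² in `D` keeps the coin probabilities exact; the power of two sets the
  -- working precision.
  unit = 2 ℕ.^ 900
  D = unit ℕ.* 90000
  schedule : Vec Bool 621
  -- All arms are even at first and would stay quiet for ever without a kick. The final round adds
  -- no gain; it only lets the pending states left by the round before be read.
  schedule = true ∷ Vec.replicate 620 false
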